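{- For every $n\ge1$, $c_5(n)\equiv c_{10}(n)\pmod 2$. Moreover: (1) $c_5(2n)\equiv 0\pmod 2$ for $n\ge1$, and for all $n\ge0$, $c_5(8n+3)\equiv 0$, $c_5(40n+5+8i)\equiv 0$ for $i\in\{1,2,3,4\}$, and $c_5(40n+7+8j)\equiv0\pmod 2$ for $j\in\{0,2\}$. (2) For every $n\ge1$, $c_5(40n-1)\equiv c_{X_{10}}(n)\pmod 2$. (3) For every $n\ge1$, $c_5(40n-9)\equiv c_{\chi_{10}}(n)\pmod 2$. (4) For every $n\ge0$, $c_5(8n+1)\equiv c_5(40n+5)\pmod 2$, and $c_5(8n+1)\equiv1\pmod 2$ if and only if $n=\frac{k(k+1)}{2}$ for some integer $k\ge0$. (5) For every $n\ge0$, $c_5(40n+15)\equiv p_{10}(n)\pmod 2$.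
   Context: Let $q=e^{2\pi i\tau}$, $(a,q)_n=\prod_{k=0}^{n-1}(1-aq^k)$, $(q)_n=(q,q)_n$, with the obvious infinite versions; $\eta_k=q^{k/24}(q^k)_\infty$. Define $j_5=\eta_1^6/\eta_5^6$ and $j_{10}=\eta_2\eta_5^5/(\eta_1\eta_{10}^5)$. Each has an expansion $j_N(\tau)=q^{ -1}+a_N+\sum_{n\ge1}c_N(n)q^n$, and $c_N(n)$ denotes the $n$-th Fourier coefficient. For a $q$-series $f$, $c_f(n)$ is the coefficient of $q^n$. The 10th order mock theta functions are $X_{10}(q)=\sum_{n\ge0}\frac{(-1)^nq^{n^2}}{(-q,q)_{2n}}$ and $\chi_{10}(q)=\sum_{n\ge0}\frac{(-1)^nq^{(n+1)^2}}{(-q,q)_{2n+1}}$. $p_{10}(n)$ is the number of partitions of $n$ in which no part is a multiple of $10$. -}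

module Defs where

open import Data.Bool using (Bool; true; false; if_then_else_; not)
open import Data.Nat as ℕ using (ℕ; zero; suc; _∸_; _≤ᵇ_; _≡ᵇ_)
open import Data.Nat.Divisibility using (_∣?_)
open import Data.Nat.DivMod using (_/_; _%_)
open import Data.Integer as ℤ using (ℤ; +_; -_; _-_)
open import Data.Integer.Divisibility using (_∣_)
open import Data.List using (List; []; _∷_; [_]; map; concatMap; filterᵇ; length; upTo)
open import Data.Bool using (_∧_)
open import Relation.Nullary.Decidable using (does)

-- Formal power series in q (nonnegative exponents), as coefficient functions.
Series : Set
Series = ℕ → ℤ

sumTo : ℕ → (ℕ → ℤ) → ℤ
sumTo zero f = f 0
sumTo (suc m) f = sumTo m f ℤ.+ f (suc m)

one : Series
one zero = + 1
one (suc _) = + 0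

_⊗_ : Series → Series → Series
(f ⊗ g) m = sumTo m (λ i → f i ℤ.* g (m ∸ i))

infixl 7 _⊗_

pow : Series → ℕ → Series
pow s zero = one
pow s (suc e) = s ⊗ pow s e

shift : ℕ → Series → Series
shift a s m = if a ≤ᵇ m then s (m ∸ a) else + 0

oneMinus : ℕ → Series
oneMinus k m = if m ≡ᵇ 0 then + 1 else (if m ≡ᵇ k then - (+ 1) else + 0)

-- 1/(1 - q^k) = Σ_j q^{kj}   (used for k ≥ 1)
geom : ℕ → Series
geom k m = if does (k ∣? m) then + 1 else + 0

-- 1/(1 + q^k) = Σ_j (-1)^j q^{kj}   (k ≥ 1)
altGeom : ℕ → Series
altGeom zero = one
altGeom (suc k) m = if does (suc k ∣? m) then (- (+ 1)) ℤ.^ (m / suc k) else + 0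

prodUpTo : (ℕ → Series) → ℕ → Series
prodUpTo t zero = one
prodUpTo t (suc N) = prodUpTo t N ⊗ t (suc N)

-- ∏_{k≥1} t k, where each t k ≡ 1 (mod q^k): the coefficient of q^m
-- only depends on the factors with k ≤ m.
infProd : (ℕ → Series) → Series
infProd t m = prodUpTo t m m

eulerPow : ℕ → ℕ → Series
eulerPow d e = infProd (λ k → pow (oneMinus (d ℕ.* k)) e)

invEulerPow : ℕ → ℕ → Series
invEulerPow d e = infProd (λ k → pow (geom (d ℕ.* k)) e)

-- q·j_5 = (q)_∞^6 / (q^5;q^5)_∞^6
F5 : Series
F5 = eulerPow 1 6 ⊗ invEulerPow 5 6

-- q·j_10 = (q^2;q^2)_∞ (q^5;q^5)_∞^5 / ((q)_∞ (q^10;q^10)_∞^5)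
F10 : Series
F10 = eulerPow 2 1 ⊗ eulerPow 5 5 ⊗ invEulerPow 1 1 ⊗ invEulerPow 10 5

-- c_N(n) = coefficient of q^n in j_N = q^{-1} F_N
c5 : ℕ → ℤ
c5 n = F5 (suc n)

c10 : ℕ → ℤ
c10 n = F10 (suc n)

invMinusPoch : ℕ → Series
invMinusPoch N = prodUpTo altGeom N

sgn : ℕ → ℤ
sgn n = (- (+ 1)) ℤ.^ n

-- X_10(q) = Σ_{n≥0} (-1)^n q^{n²} / (-q;q)_{2n}
-- (terms with n > m do not contribute to q^m)
X10 : Series
X10 m = sumTo m (λ n → sgn n ℤ.* shift (n ℕ.* n) (invMinusPoch (2 ℕ.* n)) m)

chi10 : Series
chi10 m = sumTo m (λ n → sgn n ℤ.* shift (suc n ℕ.* suc n) (invMinusPoch (suc (2 ℕ.* n))) m)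

-- Partitions of n into parts ≤ k, listed in nonincreasing order (fuel-bounded;
-- fuel ≥ n suffices since every part is ≥ 1).
partsBounded : (fuel n k : ℕ) → List (List ℕ)
partsBounded _ zero _ = [ [] ]
partsBounded zero (suc n) _ = []
partsBounded (suc f) (suc n) k =
  concatMap (λ p → map (p ∷_) (partsBounded f (suc n ∸ p) p))
            (filterᵇ (λ p → p ≤ᵇ k) (map suc (upTo (suc n))))

partitions : ℕ → List (List ℕ)
partitions n = partsBounded n n n

allᵇ : (ℕ → Bool) → List ℕ → Bool
allᵇ p [] = true
allᵇ p (x ∷ xs) = p x ∧ allᵇ p xs

p10 : ℕ → ℕ
p10 n = length (filterᵇ (allᵇ (λ p → not (p % 10 ≡ᵇ 0))) (partitions n))

_≡₂_ : ℤ → ℤ → Set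
a ≡₂ b = (+ 2) ∣ (a - b)

infix 4 _≡₂_

{-# OPTIONS --safe #-}
module Submission where

-- Everything is computed in 𝔽₂[[q]], where f² = f(q²). Write E = (q;q)_∞, P = 1/E, E₅ = E(q⁵), P₅ = P(q⁵).
--
-- The key identity is E E₅ = E⁶ + q E₅⁶. By the pentagonal number theorem the coefficients of E E₅ count the
-- representations of 4n+1 by s² - 2sv + 6v² = (s-v)² + 5v² with s ≡ 1 mod 6. Up to sign these are the representations
-- with s ≡ 1 mod 4 and 3 ∤ s; those with 3 ∣ s cancel under v ↦ s/3 - v, and among all of those with s ≡ 1 mod 4 only
-- the ones with v = 0 or s = v survive the reflections in the axes. The same argument for s² - 4sv + 12v² gives
-- E³ = Σ q^{k(k+1)/2}.
--
-- Now q j₅ = G² with G = (E P₅)³ and q j₁₀ = E P₅⁵ = G² + q. Multiplying the key identity by E² P₅⁴ gives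
-- G = (E² P₅)⁴ + q (E E₅)², so the 4-dissection of G consists of E² P₅, E³, 0 and E₅³. The 5-dissection of E² is read
-- off from the pentagonal numbers, and two of its components, times P, are the products in the Rogers identities
-- for Σ q^{n²}/(q)_{2n} and Σ q^{(n+1)²}/(q)_{2n+1}, to which X₁₀ and χ₁₀ reduce modulo 2.
--
-- The pentagonal number theorem and both Rogers identities come from the polynomial identity
-- Σ_j (-1)^j q^{j(3j+1)/2} [N, ⌊(N-3j)/2⌋] = 1, the latter two through Bailey's lemma with the q-Vandermonde sum.

open import Defs
open import Algebra.Bundles using (CommutativeRing)
import Algebra.Solver.Ring as RingSolver
open import Algebra.Solver.Ring.AlmostCommutativeRing using (AlmostCommutativeRing; fromCommutativeRing; _-Raw-AlmostCommutative⟶_)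
open import Data.Bool using (Bool; true; false; T; not; _∧_; _xor_; if_then_else_)
open import Data.Bool.Properties using (xor-assoc; xor-comm; xor-identityʳ; xor-same; xor-annihilates-not; not-distribˡ-xor; ∧-idem; ∧-comm; ∧-assoc; ∧-zeroʳ; ∧-identityʳ; ∧-distribˡ-xor; ∧-distribʳ-xor; xor-∧-commutativeRing) renaming (_≟_ to _≟ᵇ_)
open import Data.Fin using (Fin; zero; suc; toℕ; fromℕ<)
open import Data.Fin.Properties using (toℕ<n; toℕ-fromℕ<; toℕ-injective) renaming (_≟_ to _≟ᶠ_)
open import Data.Integer using (+_)
open import Data.Integer as ℤ using (ℤ; -[1+_]; ∣_∣; _⊖_)
open import Data.Integer.DivMod using (_/ℕ_; _%ℕ_; n%ℕd<d; a≡a%ℕn+[a/ℕn]*n)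
import Data.Integer.Properties as ℤₚ
open import Algebra.Properties.AbelianGroup ℤₚ.+-0-abelianGroup using () renaming (∙-cancelˡ to +ℤ-cancelˡ)
open import Data.Integer.Tactic.RingSolver using () renaming (solve-∀ to ℤ-solve-∀)
open import Data.List using (List; []; _∷_; [_]; map; cartesianProduct; _++_; deduplicate; allFin; concatMap; filterᵇ; length; upTo; _∷ʳ_)
open import Data.List.Membership.Propositional using (_∈_)
open import Data.List.Membership.Propositional.Properties using (∈-map⁺; ∈-map⁻; ∈-++⁺ˡ; ∈-++⁺ʳ; ∈-cartesianProduct⁺; ∈-deduplicate⁺; ∈-allFin; ∈-upTo⁺; ∈-upTo⁻)
open import Data.List.Properties using (upTo-∷ʳ)
open import Data.List.Relation.Unary.All using (All; []; _∷_; lookup; tabulate)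
open import Data.List.Relation.Unary.AllPairs using ([]; _∷_)
open import Data.List.Relation.Unary.Any using (here; there)
open import Data.List.Relation.Unary.Unique.DecPropositional.Properties using (deduplicate-!)
open import Data.List.Relation.Unary.Unique.Propositional using (Unique)
open import Data.List.Relation.Unary.Unique.Propositional.Properties using (map⁺; ++⁺; cartesianProduct⁺; allFin⁺; upTo⁺)
open import Data.Maybe using (Maybe; just; nothing)
open import Data.Nat using (ℕ; zero; suc; _+_; _*_; _/_; _%_; _≥_; _≤_; _<_; _∸_; _≡ᵇ_; _≤ᵇ_; _<ᵇ_; z≤n; s≤s; NonZero; >-nonZero⁻¹)
open import Data.Nat.DivMod using (m≡m%n+[m/n]*n; m%n<n; m<n⇒m%n≡m; m<n⇒m/n≡0; [m+n]%n≡m%n; [m+kn]%n≡m%n; m/n≤m; +-distrib-/-∣ˡ; n/n≡1; m*n/n≡m)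
open import Data.Nat.Divisibility using (_∣?_; divides; ∣m+n∣m⇒∣n; ∣m∣n⇒∣m+n; ∣-refl; _∣0; >⇒∤) renaming (_∣_ to _∣ℕ_)
open import Data.Nat.Properties using (_≟_; _<?_; ≤-refl; ≤-reflexive; ≤-trans; ≤-pred; n≤1+n; ≤-<-trans; ≮⇒≥; ≰⇒>; ≤⇒≯; <⇒≢; <-irrefl; <-cmp; ≤ᵇ⇒≤; ≤⇒≤ᵇ; <ᵇ⇒<; ≡ᵇ⇒≡; m≤n⇒m<n∨m≡n; m≤n⇒m≤1+n; suc-injective; +-suc; +-identityʳ; +-comm; +-assoc; +-cancelʳ-≡; +-mono-≤; +-monoˡ-≤; m≤m+n; m≤n+m; *-suc; *-zeroʳ; *-identityˡ; *-comm; *-distribʳ-+; *-cancelˡ-≡; *-cancelˡ-≤; *-monoʳ-≤; *-mono-<; m≤n*m; m≤m*n; ⊔-pres-<m; even≢odd; n∸n≡0; m∸n≤m; m∸n+n≡m; m+n∸m≡n; m+[n∸m]≡n; +-∸-assoc)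
open import Data.Nat.Tactic.RingSolver using (solve-∀)
open import Data.Product using (_×_; _,_; proj₁; proj₂; ∃)
open import Data.Product.Properties using () renaming (≡-dec to ×-≡-dec)
open import Data.Sum using (_⊎_; inj₁; inj₂; [_,_]′)
open import Data.Sum.Properties using (inj₁-injective; inj₂-injective) renaming (≡-dec to ⊎-≡-dec)
open import Data.Unit using (tt)
open import Function using (_∘_; id)
open import Function.Bundles using (_⇔_; mk⇔)
open import Level using (0ℓ)
open import Relation.Binary.Definitions using (DecidableEquality; tri<; tri≈; tri>)
open import Relation.Binary.PropositionalEquality using (_≡_; _≢_; refl; sym; trans; cong; cong₂; subst; module ≡-Reasoning)
import Relation.Binary.Reasoning.Setoid as SetoidReasoning
open import Relation.Nullary using (yes; no; does; ¬_; contradiction)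
open import Relation.Nullary.Decidable using (dec-true; dec-false; does-⇔)

-- The progressions of the theorem are dictated by the dissections. `c5 m` is the coefficient of
-- q^(m+1) in G², so it is even for even m, and m = 2k - 1 gives the coefficient of q^k in G. The
-- classes k = 0, 1, 2, 3 modulo 4 are m = 7, 1, 3, 5 modulo 8 and pick out E² P₅, E³, 0 and E₅³. In
-- E² P₅ the factor P₅ is a series in q⁵, so only E² has to be dissected modulo 5, and each
-- component is multiplied by P. In E³ only the exponents matter, and E₅³ is E³ with q⁵ in place of
-- q. Two difficulties shape the text. Limits are taken without a topology: a statement about
-- infinite sums or products is proved as a congruence `≈[ N ]` modulo q^(N+1) for every N. Theta
-- series are generating functions of weighted sets, so that each identity between them becomes a
-- weight-preserving bijection or a fixed-point-free involution on integers or pairs of integers.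
-- Such maps are checked by polynomial identities in ℤ after the exponents have been scaled to
-- complete squares; the scaling is removed at the end.

xor-interchange : ∀ a b c d → (a xor b) xor (c xor d) ≡ (a xor c) xor (b xor d)
xor-interchange a b c d =
  trans (xor-assoc a b (c xor d))
    (trans (cong (a xor_) (trans (sym (xor-assoc b c d)) (trans (cong (_xor d) (xor-comm b c)) (xor-assoc c b d))))
      (sym (xor-assoc a c (b xor d))))

xor-cancelʳ : ∀ a b → (a xor b) xor b ≡ a
xor-cancelʳ a b = trans (xor-assoc a b b) (trans (cong (a xor_) (xor-same b)) (xor-identityʳ a))

xor≡false⇒≡ : ∀ {a b} → a xor b ≡ false → a ≡ b
xor≡false⇒≡ {a} {b} h = trans (sym (xor-cancelʳ a b)) (cong (_xor b) h)

-- Convolution sums over 𝔽₂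

-- Peeling off the term with a = 0 makes `coeff (f · g) (suc n)` reduce to `(coeff f 0 ∧ coeff g
-- (suc n)) xor coeff (tail f · g) n`, so that statements about products can be proved by induction
-- along `tail`.
antidiag : ℕ → (ℕ → ℕ → Bool) → Bool
antidiag zero F = F 0 0
antidiag (suc N) F = F 0 (suc N) xor antidiag N (λ a b → F (suc a) b)

antidiag-cong : ∀ N {F G : ℕ → ℕ → Bool} → (∀ a b → a + b ≡ N → F a b ≡ G a b) → antidiag N F ≡ antidiag N G
antidiag-cong zero h = h 0 0 refl
antidiag-cong (suc N) h = cong₂ _xor_ (h 0 (suc N) refl) (antidiag-cong N (λ a b p → h (suc a) b (cong suc p)))

antidiag-xor : ∀ N (F G : ℕ → ℕ → Bool) → antidiag N (λ a b → F a b xor G a b) ≡ antidiag N F xor antidiag N G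
antidiag-xor zero F G = refl
antidiag-xor (suc N) F G =
  trans (cong ((F 0 (suc N) xor G 0 (suc N)) xor_) (antidiag-xor N (λ a → F (suc a)) (λ a → G (suc a))))
    (xor-interchange (F 0 (suc N)) (G 0 (suc N)) _ _)

antidiag-false : ∀ N → antidiag N (λ _ _ → false) ≡ false
antidiag-false zero = refl
antidiag-false (suc N) = antidiag-false N

antidiag-∧ˡ : ∀ N c (F : ℕ → ℕ → Bool) → antidiag N (λ a b → c ∧ F a b) ≡ c ∧ antidiag N F
antidiag-∧ˡ N true F = refl
antidiag-∧ˡ N false F = antidiag-false N

antidiag-last : ∀ N (F : ℕ → ℕ → Bool) → antidiag (suc N) F ≡ antidiag N (λ a b → F a (suc b)) xor F (suc N) 0
antidiag-last zero F = refl
antidiag-last (suc N) F =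
  trans (cong (F 0 (suc (suc N)) xor_) (antidiag-last N (λ a → F (suc a))))
    (sym (xor-assoc (F 0 (suc (suc N))) _ _))

antidiag-comm : ∀ N (F : ℕ → ℕ → Bool) → antidiag N F ≡ antidiag N (λ a b → F b a)
antidiag-comm zero F = refl
antidiag-comm (suc N) F =
  trans (antidiag-last N F)
    (trans (xor-comm _ (F (suc N) 0)) (cong (F (suc N) 0 xor_) (antidiag-comm N (λ a b → F a (suc b)))))

-- The ring 𝔽₂[[q]]

-- Power series over 𝔽₂; a record rather than ℕ → Bool so that unification does not unfold the operations.
record Ser : Set where
  no-eta-equality
  constructor series
  field
    coeff : ℕ → Bool
open Ser public

infix 4 _≈_ _≈[_]_
infixl 6 _⊕_
infixl 7 _·_

record _≈_ (f g : Ser) : Set where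
  constructor pointwise
  field
    at : ∀ n → coeff f n ≡ coeff g n
open _≈_ public

record _≈[_]_ (f : Ser) (N : ℕ) (g : Ser) : Set where
  constructor pointwise≤
  field
    at≤ : ∀ {n} → n ≤ N → coeff f n ≡ coeff g n
open _≈[_]_ public

_⊕_ : Ser → Ser → Ser
coeff (f ⊕ g) n = coeff f n xor coeff g n

_·_ : Ser → Ser → Ser
coeff (f · g) n = antidiag n (λ a b → coeff f a ∧ coeff g b)

𝟘 : Ser
coeff 𝟘 _ = false

q^ : ℕ → Ser
coeff (q^ a) n = n ≡ᵇ a

𝟙 : Ser
𝟙 = q^ 0

tail : Ser → Ser
coeff (tail f) n = coeff f (suc n)

≈-refl : ∀ {f} → f ≈ f
≈-refl = pointwise (λ _ → refl)

≈-sym : ∀ {f g} → f ≈ g → g ≈ f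
≈-sym h = pointwise (λ n → sym (at h n))

≈-trans : ∀ {f g k} → f ≈ g → g ≈ k → f ≈ k
≈-trans h k = pointwise (λ n → trans (at h n) (at k n))

·-cong[] : ∀ {f f′ g g′ N} → f ≈[ N ] f′ → g ≈[ N ] g′ → f · g ≈[ N ] f′ · g′
·-cong[] h k = pointwise≤ (λ {n} n≤N → antidiag-cong n (λ a b a+b≡n →
    cong₂ _∧_ (at≤ h (≤-trans (left a b a+b≡n) n≤N)) (at≤ k (≤-trans (right a b a+b≡n) n≤N))))
  where
  left : ∀ a b {n} → a + b ≡ n → a ≤ n
  left a b e = ≤-trans (m≤m+n a b) (≤-reflexive e)
  right : ∀ a b {n} → a + b ≡ n → b ≤ n
  right a b e = ≤-trans (m≤n+m b a) (≤-reflexive e)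

≈⇒≈[] : ∀ {f g N} → f ≈ g → f ≈[ N ] g
≈⇒≈[] h = pointwise≤ (λ {n} _ → at h n)

≈[]⇒≈ : ∀ {f g} → (∀ N → f ≈[ N ] g) → f ≈ g
≈[]⇒≈ h = pointwise (λ n → at≤ (h n) ≤-refl)

≈[]-refl : ∀ {f N} → f ≈[ N ] f
≈[]-refl = pointwise≤ (λ _ → refl)

≈[]-sym : ∀ {f g N} → f ≈[ N ] g → g ≈[ N ] f
≈[]-sym h = pointwise≤ (λ p → sym (at≤ h p))

≈[]-trans : ∀ {f g k N} → f ≈[ N ] g → g ≈[ N ] k → f ≈[ N ] k
≈[]-trans h k = pointwise≤ (λ p → trans (at≤ h p) (at≤ k p))

≈[]-weaken : ∀ {f g M N} → M ≤ N → f ≈[ N ] g → f ≈[ M ] g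
≈[]-weaken M≤N h = pointwise≤ (λ p → at≤ h (≤-trans p M≤N))

⊕-cong[] : ∀ {f f′ g g′ N} → f ≈[ N ] f′ → g ≈[ N ] g′ → f ⊕ g ≈[ N ] f′ ⊕ g′
⊕-cong[] h k = pointwise≤ (λ p → cong₂ _xor_ (at≤ h p) (at≤ k p))

⊕-cong : ∀ {f f′ g g′} → f ≈ f′ → g ≈ g′ → f ⊕ g ≈ f′ ⊕ g′
⊕-cong h k = pointwise (λ n → cong₂ _xor_ (at h n) (at k n))

·-cong : ∀ {f f′ g g′} → f ≈ f′ → g ≈ g′ → f · g ≈ f′ · g′
·-cong h k = ≈[]⇒≈ (λ N → ·-cong[] (≈⇒≈[] h) (≈⇒≈[] k))

·-comm : ∀ f g → f · g ≈ g · f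
·-comm f g = pointwise (λ n → trans (antidiag-comm n (λ a b → coeff f a ∧ coeff g b)) (antidiag-cong n (λ a b _ → ∧-comm (coeff f b) (coeff g a))))

·-distribˡ : ∀ f g k → f · (g ⊕ k) ≈ f · g ⊕ f · k
·-distribˡ f g k = pointwise (λ n → trans (antidiag-cong n (λ a b _ → ∧-distribˡ-xor (coeff f a) (coeff g b) (coeff k b)))
  (antidiag-xor n (λ a b → coeff f a ∧ coeff g b) (λ a b → coeff f a ∧ coeff k b)))

·-distribʳ : ∀ f g k → (g ⊕ k) · f ≈ g · f ⊕ k · f
·-distribʳ f g k = pointwise (λ n → trans (antidiag-cong n (λ a b _ → ∧-distribʳ-xor (coeff f b) (coeff g a) (coeff k a)))
  (antidiag-xor n (λ a b → coeff g a ∧ coeff f b) (λ a b → coeff k a ∧ coeff f b)))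

-- The tail of f · g is f₀ · tail g plus tail f · g; the induction on n is applied to the second
-- part, with `tail f` in place of f.
·-assoc-at : ∀ n f g k → coeff ((f · g) · k) n ≡ coeff (f · (g · k)) n
·-assoc-at zero f g k = ∧-assoc (coeff f 0) (coeff g 0) (coeff k 0)
·-assoc-at (suc n) f g k =
  trans (cong (((coeff f 0 ∧ coeff g 0) ∧ coeff k (suc n)) xor_)
          (trans (antidiag-cong n (λ a b _ → ∧-distribʳ-xor (coeff k b) (coeff f 0 ∧ coeff g (suc a)) (coeff (tail f · g) a)))
            (trans (antidiag-xor n (λ a b → (coeff f 0 ∧ coeff g (suc a)) ∧ coeff k b) (λ a b → coeff (tail f · g) a ∧ coeff k b))
              (cong₂ _xor_
                (trans (antidiag-cong n (λ a b _ → ∧-assoc (coeff f 0) (coeff g (suc a)) (coeff k b))) (antidiag-∧ˡ n (coeff f 0) _))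
                (·-assoc-at n (tail f) g k)))))
    (trans (sym (xor-assoc ((coeff f 0 ∧ coeff g 0) ∧ coeff k (suc n)) _ _))
      (cong (_xor coeff (tail f · (g · k)) n)
        (trans (cong (_xor (coeff f 0 ∧ coeff (tail g · k) n)) (∧-assoc (coeff f 0) (coeff g 0) (coeff k (suc n))))
          (sym (∧-distribˡ-xor (coeff f 0) _ _)))))

q^0· : ∀ f → 𝟙 · f ≈ f
q^0· f = pointwise go
  where
  go : ∀ n → coeff (𝟙 · f) n ≡ coeff f n
  go zero = refl
  go (suc n) = trans (cong (coeff f (suc n) xor_) (antidiag-false n)) (xor-identityʳ _)

serRing : CommutativeRing 0ℓ 0ℓ
serRing = record
  { Carrier = Ser ; _≈_ = _≈_ ; _+_ = _⊕_ ; _*_ = _·_ ; -_ = λ f → f ; 0# = 𝟘 ; 1# = 𝟙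
  ; isCommutativeRing = record
    { isRing = record
      { +-isAbelianGroup = record
        { isGroup = record
          { isMonoid = record
            { isSemigroup = record
              { isMagma = record
                { isEquivalence = record { refl = ≈-refl ; sym = ≈-sym ; trans = ≈-trans }
                ; ∙-cong = ⊕-cong }
              ; assoc = λ f g k → pointwise (λ n → xor-assoc (coeff f n) (coeff g n) (coeff k n)) }
            ; identity = (λ f → pointwise (λ _ → refl)) , (λ f → pointwise (λ n → xor-identityʳ (coeff f n))) }
          ; inverse = (λ f → pointwise (λ n → xor-same (coeff f n))) , (λ f → pointwise (λ n → xor-same (coeff f n)))
          ; ⁻¹-cong = λ h → h }
        ; comm = λ f g → pointwise (λ n → xor-comm (coeff f n) (coeff g n)) }
      ; *-cong = ·-cong
      ; *-assoc = λ f g k → pointwise (λ n → ·-assoc-at n f g k)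
      ; *-identity = q^0· , (λ f → ≈-trans (·-comm f 𝟙) (q^0· f))
      ; distrib = ·-distribˡ , ·-distribʳ }
    ; *-comm = ·-comm } }

serACR : AlmostCommutativeRing 0ℓ 0ℓ
serACR = fromCommutativeRing serRing

constant : Bool → Ser
constant true = 𝟙
constant false = 𝟘

constant-⊕ : ∀ a b → constant (a xor b) ≈ constant a ⊕ constant b
constant-⊕ true true = pointwise (λ n → sym (xor-same (coeff 𝟙 n)))
constant-⊕ true false = pointwise (λ n → sym (xor-identityʳ (coeff 𝟙 n)))
constant-⊕ false b = pointwise (λ _ → refl)

constant-· : ∀ a b → constant (a ∧ b) ≈ constant a · constant b
constant-· true b = ≈-sym (q^0· (constant b))
constant-· false b = pointwise (λ n → sym (antidiag-false n))

constantHom : CommutativeRing.rawRing xor-∧-commutativeRing -Raw-AlmostCommutative⟶ serACR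
constantHom = record
  { ⟦_⟧ = constant ; +-homo = constant-⊕ ; *-homo = constant-·
  ; -‿homo = λ _ → ≈-refl ; 0-homo = ≈-refl ; 1-homo = ≈-refl }

constant-≟ : ∀ a b → Maybe (constant a ≈ constant b)
constant-≟ a b with a ≟ᵇ b
... | yes refl = just ≈-refl
... | no _ = nothing

-- With coefficients in 𝔽₂ the solver knows that x + x = 0.
module Solver₂ = RingSolver (CommutativeRing.rawRing xor-∧-commutativeRing) serACR constantHom constant-≟
open Solver₂ using (solve; _:=_; _:+_; _:*_; con) public

module ≈R = SetoidReasoning (CommutativeRing.setoid serRing)
open CommutativeRing serRing public using () renaming (+-assoc to ⊕-assoc; +-comm to ⊕-comm; +-identityʳ to ⊕-identityʳ; *-assoc to ·-assoc; *-identityˡ to ·-identityˡ; *-identityʳ to ·-identityʳ; zeroˡ to ·-zeroˡ; zeroʳ to ·-zeroʳ)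

-- Monomials and squares

⊕-self : ∀ f → f ⊕ f ≈ 𝟘
⊕-self f = pointwise (λ n → xor-same (coeff f n))

q^-* : ∀ a b → q^ a · q^ b ≈ q^ (a + b)
q^-* a b = pointwise (go a)
  where
  go : ∀ a n → coeff (q^ a · q^ b) n ≡ coeff (q^ (a + b)) n
  go zero n = at (·-identityˡ (q^ b)) n
  go (suc a) zero = refl
  go (suc a) (suc n) = go a n

q^·-at-+ : ∀ a f n → coeff (q^ a · f) (a + n) ≡ coeff f n
q^·-at-+ zero f n = at (·-identityˡ f) n
q^·-at-+ (suc a) f n = q^·-at-+ a f n

q^·-at-< : ∀ a f {n} → n < a → coeff (q^ a · f) n ≡ false
q^·-at-< (suc a) f {zero} _ = refl
q^·-at-< (suc a) f {suc n} (s≤s p) = q^·-at-< a f p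

q^·-cong[] : ∀ a {f g N} → f ≈[ N ] g → q^ a · f ≈[ a + N ] q^ a · g
q^·-cong[] zero h = ·-cong[] ≈[]-refl h
q^·-cong[] (suc a) {f} {g} {N} h = pointwise≤ go
  where
  go : ∀ {n} → n ≤ suc a + N → coeff (q^ (suc a) · f) n ≡ coeff (q^ (suc a) · g) n
  go {zero} _ = refl
  go {suc n} (s≤s p) = at≤ (q^·-cong[] a h) p

-- The two end terms of the convolution are both f₀ f₍ₙ₊₂₎ and cancel in characteristic 2; the rest
-- is the convolution of `tail f` with itself. Iterated, this is f² = f(q²).
square-suc-suc : ∀ f n → coeff (f · f) (suc (suc n)) ≡ coeff (tail f · tail f) n
square-suc-suc f n =
  trans (cong ((coeff f 0 ∧ coeff f (suc (suc n))) xor_) (antidiag-last n (λ a b → coeff f (suc a) ∧ coeff f b)))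
    (trans (cong ((coeff f 0 ∧ coeff f (suc (suc n))) xor_) (trans (xor-comm (coeff (tail f · tail f) n) _) (cong (_xor coeff (tail f · tail f) n) (∧-comm (coeff f (suc (suc n))) (coeff f 0)))))
      (trans (sym (xor-assoc (coeff f 0 ∧ coeff f (suc (suc n))) _ _)) (cong (_xor coeff (tail f · tail f) n) (xor-same (coeff f 0 ∧ coeff f (suc (suc n)))))))

double-suc : ∀ n → 2 * suc n ≡ suc (suc (2 * n))
double-suc n = *-suc 2 n

square-even : ∀ f n → coeff (f · f) (2 * n) ≡ coeff f n
square-even f zero = ∧-idem (coeff f 0)
square-even f (suc n) = trans (cong (coeff (f · f)) (double-suc n)) (trans (square-suc-suc f (2 * n)) (square-even (tail f) n))

square-odd : ∀ f n → coeff (f · f) (suc (2 * n)) ≡ false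
square-odd f zero = trans (cong ((coeff f 0 ∧ coeff f 1) xor_) (∧-comm (coeff f 1) (coeff f 0))) (xor-same (coeff f 0 ∧ coeff f 1))
square-odd f (suc n) = trans (cong (λ k → coeff (f · f) (suc k)) (double-suc n)) (trans (square-suc-suc f (suc (2 * n))) (square-odd (tail f) n))

-- Finite sums of series

Σ[_] : ℕ → (ℕ → ℕ → Ser) → Ser
coeff (Σ[ N ] F) n = antidiag N (λ a b → coeff (F a b) n)

Σ-cong : ∀ N {F G : ℕ → ℕ → Ser} → (∀ a b → a + b ≡ N → F a b ≈ G a b) → Σ[ N ] F ≈ Σ[ N ] G
Σ-cong N h = pointwise (λ n → antidiag-cong N (λ a b p → at (h a b p) n))

Σ-cong[] : ∀ N {F G : ℕ → ℕ → Ser} {M} → (∀ a b → a + b ≡ N → F a b ≈[ M ] G a b) → Σ[ N ] F ≈[ M ] Σ[ N ] G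
Σ-cong[] N h = pointwise≤ (λ n≤M → antidiag-cong N (λ a b p → at≤ (h a b p) n≤M))

Σ-suc : ∀ N (F : ℕ → ℕ → Ser) → Σ[ suc N ] F ≈ F 0 (suc N) ⊕ Σ[ N ] (λ a → F (suc a))
Σ-suc N F = pointwise (λ _ → refl)

Σ-last : ∀ N (F : ℕ → ℕ → Ser) → Σ[ suc N ] F ≈ Σ[ N ] (λ a b → F a (suc b)) ⊕ F (suc N) 0
Σ-last N F = pointwise (λ n → antidiag-last N (λ a b → coeff (F a b) n))

Σ-⊕ : ∀ N (F G : ℕ → ℕ → Ser) → Σ[ N ] (λ a b → F a b ⊕ G a b) ≈ Σ[ N ] F ⊕ Σ[ N ] G
Σ-⊕ N F G = pointwise (λ n → antidiag-xor N (λ a b → coeff (F a b) n) (λ a b → coeff (G a b) n))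

Σ-·ˡ : ∀ N f (F : ℕ → ℕ → Ser) → Σ[ N ] (λ a b → f · F a b) ≈ f · Σ[ N ] F
Σ-·ˡ zero f F = pointwise (λ _ → refl)
Σ-·ˡ (suc N) f F = begin
  Σ[ suc N ] (λ a b → f · F a b) ≈⟨ Σ-suc N (λ a b → f · F a b) ⟩
  f · F 0 (suc N) ⊕ Σ[ N ] (λ a b → f · F (suc a) b) ≈⟨ ⊕-cong ≈-refl (Σ-·ˡ N f (λ a → F (suc a))) ⟩
  f · F 0 (suc N) ⊕ f · Σ[ N ] (λ a → F (suc a)) ≈⟨ ≈-sym (·-distribˡ f _ _) ⟩
  f · (F 0 (suc N) ⊕ Σ[ N ] (λ a → F (suc a))) ≈⟨ ·-cong ≈-refl (≈-sym (Σ-suc N F)) ⟩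
  f · Σ[ suc N ] F ∎
  where open ≈R

-- The common pattern of all q-Pascal arguments below: a term at (a, b) on the antidiagonal N + 1 is
-- divided between its neighbours (a, b - 1) and (a - 1, b) on the antidiagonal N, and the two end
-- terms have one neighbour each.
Σ-split : ∀ N (T L R : ℕ → ℕ → Ser) →
  (∀ a b → T (suc a) (suc b) ≈ L (suc a) b ⊕ R a (suc b)) →
  (∀ b → T 0 (suc b) ≈ L 0 b) → (∀ a → T (suc a) 0 ≈ R a 0) →
  Σ[ suc N ] T ≈ Σ[ N ] (λ a b → L a b ⊕ R a b)
Σ-split zero T L R inner left right = pointwise (λ n → cong₂ _xor_ (at (left 0) n) (at (right 0) n))
Σ-split (suc N) T L R inner left right = begin
  Σ[ suc (suc N) ] T ≈⟨ Σ-suc (suc N) T ⟩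
  T 0 (suc (suc N)) ⊕ Σ[ suc N ] (λ a b → T (suc a) b)
    ≈⟨ ⊕-cong (left (suc N)) (Σ-last N (λ a → T (suc a))) ⟩
  L 0 (suc N) ⊕ (Σ[ N ] (λ a b → T (suc a) (suc b)) ⊕ T (suc (suc N)) 0)
    ≈⟨ ⊕-cong ≈-refl (⊕-cong (≈-trans (Σ-cong N (λ a b _ → inner a b)) (Σ-⊕ N (λ a → L (suc a)) (λ a b → R a (suc b)))) (right (suc N))) ⟩
  L 0 (suc N) ⊕ ((Σ[ N ] (λ a → L (suc a)) ⊕ Σ[ N ] (λ a b → R a (suc b))) ⊕ R (suc N) 0)
    ≈⟨ solve 4 (λ x y z w → x :+ ((y :+ z) :+ w) := (x :+ y) :+ (z :+ w)) ≈-refl _ _ _ _ ⟩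
  (L 0 (suc N) ⊕ Σ[ N ] (λ a → L (suc a))) ⊕ (Σ[ N ] (λ a b → R a (suc b)) ⊕ R (suc N) 0)
    ≈⟨ ⊕-cong (≈-sym (Σ-suc N L)) (≈-sym (Σ-last N R)) ⟩
  Σ[ suc N ] L ⊕ Σ[ suc N ] R ≈⟨ ≈-sym (Σ-⊕ (suc N) L R) ⟩
  Σ[ suc N ] (λ a b → L a b ⊕ R a b) ∎
  where open ≈R

-- Infinite products

pow₂ : Ser → ℕ → Ser
pow₂ f zero = 𝟙
pow₂ f (suc e) = f · pow₂ f e

pow₂-cong : ∀ {f g} e → f ≈ g → pow₂ f e ≈ pow₂ g e
pow₂-cong zero h = ≈-refl
pow₂-cong (suc e) h = ·-cong h (pow₂-cong e h)

pow₂-cong[] : ∀ {f g N} e → f ≈[ N ] g → pow₂ f e ≈[ N ] pow₂ g e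
pow₂-cong[] zero h = ≈[]-refl
pow₂-cong[] (suc e) h = ·-cong[] h (pow₂-cong[] e h)

pow₂-𝟙 : ∀ e → pow₂ 𝟙 e ≈ 𝟙
pow₂-𝟙 zero = ≈-refl
pow₂-𝟙 (suc e) = ≈-trans (·-identityˡ _) (pow₂-𝟙 e)

∏ : (ℕ → Ser) → ℕ → Ser
∏ t zero = 𝟙
∏ t (suc N) = ∏ t N · t (suc N)

-- The diagonal definition mirrors `infProd`, so that reduction modulo 2 is coefficientwise.
-- `Unital` guarantees that later partial products have the same coefficients, which is `∏∞-≈`.
∏∞ : (ℕ → Ser) → Ser
coeff (∏∞ t) n = coeff (∏ t n) n

Unital : (ℕ → Ser) → Set
Unital t = ∀ N → t (suc N) ≈[ N ] 𝟙

∏-cong : ∀ N {t s} → (∀ k → t (suc k) ≈ s (suc k)) → ∏ t N ≈ ∏ s N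
∏-cong zero h = ≈-refl
∏-cong (suc N) h = ·-cong (∏-cong N h) (h N)

∏∞-cong : ∀ {t s} → (∀ k → t (suc k) ≈ s (suc k)) → ∏∞ t ≈ ∏∞ s
∏∞-cong h = pointwise (λ n → at (∏-cong n h) n)

∏-stable : ∀ {t} → Unital t → ∀ K N → ∏ t (K + N) ≈[ N ] ∏ t N
∏-stable u zero N = ≈[]-refl
∏-stable {t} u (suc K) N = ≈[]-trans (·-cong[] (∏-stable u K N) (≈[]-weaken (m≤n+m N K) (u (K + N))))
  (≈⇒≈[] (·-identityʳ (∏ t N)))

∏-≤ : ∀ {t} → Unital t → ∀ {M N} → N ≤ M → ∏ t M ≈[ N ] ∏ t N
∏-≤ {t} u {M} {N} N≤M = subst (λ k → ∏ t k ≈[ N ] ∏ t N) (m∸n+n≡m N≤M) (∏-stable u (M ∸ N) N)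

∏∞-≈ : ∀ {t} → Unital t → ∀ N → ∏∞ t ≈[ N ] ∏ t N
∏∞-≈ u N = pointwise≤ (λ {n} n≤N → sym (at≤ (∏-≤ u n≤N) ≤-refl))

∏-· : ∀ t s N → ∏ (λ k → t k · s k) N ≈ ∏ t N · ∏ s N
∏-· t s zero = ≈-sym (·-identityˡ 𝟙)
∏-· t s (suc N) = ≈-trans (·-cong (∏-· t s N) ≈-refl)
  (solve 4 (λ x y z w → x :* y :* (z :* w) := x :* z :* (y :* w)) ≈-refl (∏ t N) (∏ s N) (t (suc N)) (s (suc N)))

Unital-· : ∀ {t s} → Unital t → Unital s → Unital (λ k → t k · s k)
Unital-· u v N = ≈[]-trans (·-cong[] (u N) (v N)) (≈⇒≈[] (·-identityˡ 𝟙))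

∏∞-· : ∀ {t s} → Unital t → Unital s → ∏∞ (λ k → t k · s k) ≈ ∏∞ t · ∏∞ s
∏∞-· {t} {s} u v = ≈[]⇒≈ (λ N → ≈[]-trans (∏∞-≈ (Unital-· {t} {s} u v) N)
  (≈[]-trans (≈⇒≈[] (∏-· t s N)) (·-cong[] (≈[]-sym (∏∞-≈ u N)) (≈[]-sym (∏∞-≈ v N)))))

Unital-pow : ∀ {t} → Unital t → ∀ e → Unital (λ k → pow₂ (t k) e)
Unital-pow u e N = ≈[]-trans (pow₂-cong[] e (u N)) (≈⇒≈[] (pow₂-𝟙 e))

∏∞-one : ∏∞ (λ _ → 𝟙) ≈ 𝟙
∏∞-one = pointwise (λ n → at (go n) n)
  where
  go : ∀ N → ∏ (λ _ → 𝟙) N ≈ 𝟙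
  go zero = ≈-refl
  go (suc N) = ≈-trans (·-identityʳ _) (go N)

∏∞-pow : ∀ {t} → Unital t → ∀ e → ∏∞ (λ k → pow₂ (t k) e) ≈ pow₂ (∏∞ t) e
∏∞-pow u zero = ∏∞-one
∏∞-pow {t} u (suc e) = ≈-trans (∏∞-· u (Unital-pow {t} u e)) (·-cong ≈-refl (∏∞-pow u e))

1+q^ : ℕ → Ser
1+q^ k = 𝟙 ⊕ q^ k

geom₂ : ℕ → Ser
coeff (geom₂ k) n = does (k ∣? n)

q^-unit : ∀ N k → N < k → 1+q^ k ≈[ N ] 𝟙
q^-unit N k N<k = pointwise≤ (λ {n} n≤N → trans (cong (coeff 𝟙 n xor_) (small k n (≤-trans (s≤s n≤N) N<k))) (xor-identityʳ _))
  where
  small : ∀ k n → n < k → coeff (q^ k) n ≡ false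
  small (suc k) zero _ = refl
  small (suc k) (suc n) (s≤s p) = small k n p

1+q^-geom : ∀ k → 1+q^ (suc k) · geom₂ (suc k) ≈ 𝟙
1+q^-geom k = ≈-trans (·-distribʳ (geom₂ (suc k)) 𝟙 (q^ (suc k)))
  (≈-trans (⊕-cong (·-identityˡ _) ≈-refl) (pointwise go))
  where
  K = suc k
  shifted : ∀ n → K ≤ n → coeff (geom₂ K) n xor coeff (q^ K · geom₂ K) n ≡ coeff 𝟙 n
  shifted n K≤n with n ∸ K | trans (+-comm K (n ∸ K)) (m∸n+n≡m K≤n)
  ... | r | refl rewrite q^·-at-+ K (geom₂ K) r = trans (cong (_xor coeff (geom₂ K) r) lemma) (xor-same (coeff (geom₂ K) r))
    where
    lemma : coeff (geom₂ K) (K + r) ≡ coeff (geom₂ K) r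
    lemma = does-⇔ (mk⇔ (λ d → ∣m+n∣m⇒∣n d ∣-refl) (∣m∣n⇒∣m+n ∣-refl)) (K ∣? (K + r)) (K ∣? r)
  go : ∀ n → coeff (geom₂ K) n xor coeff (q^ K · geom₂ K) n ≡ coeff 𝟙 n
  go zero = trans (xor-identityʳ _) (dec-true (K ∣? 0) (K ∣0))
  go (suc n) with suc n <? K
  ... | yes small = cong₂ _xor_ (dec-false (K ∣? suc n) (>⇒∤ small)) (q^·-at-< K (geom₂ K) small)
  ... | no ¬small = shifted (suc n) (≮⇒≥ ¬small)

geom-unit : ∀ N k → N < k → geom₂ k ≈[ N ] 𝟙
geom-unit N k N<k = pointwise≤ go
  where
  go : ∀ {n} → n ≤ N → coeff (geom₂ k) n ≡ coeff 𝟙 n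
  go {zero} _ = dec-true (k ∣? 0) (k ∣0)
  go {suc n} n≤N = dec-false (k ∣? suc n) (>⇒∤ (≤-trans (s≤s n≤N) N<k))

-- Eₙ N = (q;q)_N and Pₙ N = 1/(q;q)_N

Eₙ Pₙ : ℕ → Ser
Eₙ = ∏ 1+q^
Pₙ = ∏ geom₂

E P : Ser
E = ∏∞ 1+q^
P = ∏∞ geom₂

1+q^-unital : Unital 1+q^
1+q^-unital N = q^-unit N (suc N) ≤-refl

geom-unital : Unital geom₂
geom-unital N = geom-unit N (suc N) ≤-refl

E≈Eₙ : ∀ N → E ≈[ N ] Eₙ N
E≈Eₙ = ∏∞-≈ 1+q^-unital

P≈Pₙ : ∀ N → P ≈[ N ] Pₙ N
P≈Pₙ = ∏∞-≈ geom-unital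

E·P : E · P ≈ 𝟙
E·P = ≈-trans (≈-sym (∏∞-· 1+q^-unital geom-unital)) (≈-trans (∏∞-cong 1+q^-geom) ∏∞-one)

Pₙ-step : ∀ N → 1+q^ (suc N) · Pₙ (suc N) ≈ Pₙ N
Pₙ-step N = begin
  1+q^ (suc N) · (Pₙ N · geom₂ (suc N)) ≈⟨ solve 3 (λ x y z → x :* (y :* z) := y :* (x :* z)) ≈-refl _ _ _ ⟩
  Pₙ N · (1+q^ (suc N) · geom₂ (suc N)) ≈⟨ ·-cong ≈-refl (1+q^-geom N) ⟩
  Pₙ N · 𝟙 ≈⟨ ·-identityʳ _ ⟩
  Pₙ N ∎
  where open ≈R

·-cancel-inverse : ∀ {u v f g} → u · v ≈ 𝟙 → u · f ≈ u · g → f ≈ g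
·-cancel-inverse {u} {v} {f} {g} uv h = ≈-trans (≈-sym (undo f)) (≈-trans (·-cong ≈-refl h) (undo g))
  where
  undo : ∀ k → v · (u · k) ≈ k
  undo k = ≈-trans (solve 3 (λ x y z → y :* (x :* z) := x :* y :* z) ≈-refl u v k) (≈-trans (·-cong uv ≈-refl) (·-identityˡ k))

1+q^-cancel : ∀ k {f g} → 1+q^ (suc k) · f ≈ 1+q^ (suc k) · g → f ≈ g
1+q^-cancel k = ·-cancel-inverse (1+q^-geom k)

≡⇒≈ : ∀ {f g} → f ≡ g → f ≈ g
≡⇒≈ refl = ≈-refl

q^-≡ : ∀ {a b} → a ≡ b → q^ a ≈ q^ b
q^-≡ refl = ≈-refl

-- The q-Vandermonde sum

PP : ℕ → ℕ → Ser
PP a b = Pₙ a · Pₙ b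

-- By q-Pascal, (1 - q^{K+1}) times the sum for (K+1, d) is the sum for (K, d) plus q^{K+1+d} times the sum for (K, d+1).
q-vandermonde : ∀ K d → Σ[ K ] (λ m k → q^ (m * (m + d)) · (PP m (m + d) · Pₙ k)) ≈ PP K (K + d)
q-vandermonde zero d = pointwise (λ n → at (solve 1 (λ x → con true :* (con true :* x :* con true) := con true :* x) ≈-refl (Pₙ d)) n)
q-vandermonde (suc K) d = 1+q^-cancel K (begin
  1+q^ (suc K) · Σ[ suc K ] term ≈⟨ ≈-sym (Σ-·ˡ (suc K) (1+q^ (suc K)) term) ⟩
  Σ[ suc K ] (λ m k → 1+q^ (suc K) · term m k)
    ≈⟨ Σ-cong (suc K) (λ m k m+k≡ → ·-cong (⊕-cong ≈-refl (q^-≡ (sym m+k≡))) ≈-refl) ⟩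
  Σ[ suc K ] (λ m k → 1+q^ (m + k) · term m k) ≈⟨ Σ-split K (λ m k → 1+q^ (m + k) · term m k) term R inner left right ⟩
  Σ[ K ] (λ m k → term m k ⊕ R m k) ≈⟨ Σ-⊕ K term R ⟩
  Σ[ K ] term ⊕ Σ[ K ] R ≈⟨ ⊕-cong (q-vandermonde K d) (≈-trans (Σ-cong K R≈) (Σ-·ˡ K (q^ (suc K + d)) term⁺)) ⟩
  PP K (K + d) ⊕ q^ (suc K + d) · Σ[ K ] term⁺ ≈⟨ ⊕-cong (·-cong ≈-refl (≈-sym (Pₙ-step (K + d)))) (·-cong ≈-refl (≈-trans (q-vandermonde K (suc d)) (·-cong ≈-refl (≡⇒≈ (cong Pₙ (+-suc K d)))))) ⟩
  Pₙ K · (1+q^ (suc K + d) · Pₙ (suc K + d)) ⊕ q^ (suc K + d) · PP K (suc K + d)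
    ≈⟨ solve 3 (λ x y z → x :* ((con true :+ y) :* z) :+ y :* (x :* z) := x :* z) ≈-refl _ _ _ ⟩
  PP K (suc K + d) ≈⟨ ·-cong (≈-sym (Pₙ-step K)) ≈-refl ⟩
  1+q^ (suc K) · Pₙ (suc K) · Pₙ (suc K + d) ≈⟨ ·-assoc _ _ _ ⟩
  1+q^ (suc K) · PP (suc K) (suc K + d) ∎)
  where
  open ≈R
  term term⁺ R : ℕ → ℕ → Ser
  term m k = q^ (m * (m + d)) · (PP m (m + d) · Pₙ k)
  term⁺ m k = q^ (m * (m + suc d)) · (PP m (m + suc d) · Pₙ k)
  R m k = q^ k · (q^ (suc m * (suc m + d)) · (PP m (suc m + d) · Pₙ k))
  right : ∀ a → 1+q^ (suc a + 0) · term (suc a) 0 ≈ R a 0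
  right a = begin
    1+q^ (suc a + 0) · term (suc a) 0 ≈⟨ ·-cong (⊕-cong ≈-refl (q^-≡ (+-identityʳ (suc a)))) ≈-refl ⟩
    1+q^ (suc a) · term (suc a) 0 ≈⟨ solve 4 (λ u x y z → u :* (x :* (y :* z :* con true)) := con true :* (x :* (u :* y :* z :* con true))) ≈-refl _ _ _ _ ⟩
    𝟙 · (q^ (suc a * (suc a + d)) · (1+q^ (suc a) · Pₙ (suc a) · Pₙ (suc a + d) · 𝟙))
      ≈⟨ ·-cong ≈-refl (·-cong ≈-refl (·-cong (·-cong (Pₙ-step a) ≈-refl) ≈-refl)) ⟩
    R a 0 ∎
  left : ∀ b → 1+q^ (suc b) · term 0 (suc b) ≈ term 0 b
  left b = begin
    1+q^ (suc b) · term 0 (suc b) ≈⟨ solve 4 (λ u x y z → u :* (x :* (y :* z)) := x :* (y :* (u :* z))) ≈-refl _ _ _ (Pₙ (suc b)) ⟩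
    q^ 0 · (PP 0 d · (1+q^ (suc b) · Pₙ (suc b))) ≈⟨ ·-cong ≈-refl (·-cong ≈-refl (Pₙ-step b)) ⟩
    term 0 b ∎
  -- This is 1 - q^(m+k) = (1 - q^k) + q^k (1 - q^m) at m = a + 1 and k = b + 1; each bracket
  -- shortens one of the Pochhammer symbols in the denominator.
  inner : ∀ a b → 1+q^ (suc a + suc b) · term (suc a) (suc b) ≈ term (suc a) b ⊕ R a (suc b)
  inner a b = begin
    1+q^ (suc a + suc b) · term (suc a) (suc b) ≈⟨ ·-cong (⊕-cong ≈-refl (≈-sym (q^-* (suc a) (suc b)))) ≈-refl ⟩
    (𝟙 ⊕ q^ (suc a) · q^ (suc b)) · term (suc a) (suc b)
      ≈⟨ solve 6 (λ x y w p r k → (con true :+ x :* y) :* (w :* (p :* r :* k)) := w :* (p :* r :* ((con true :+ y) :* k)) :+ y :* (w :* ((con true :+ x) :* p :* r :* k))) ≈-refl _ _ _ _ _ _ ⟩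
    q^ (suc a * (suc a + d)) · (PP (suc a) (suc a + d) · (1+q^ (suc b) · Pₙ (suc b)))
      ⊕ q^ (suc b) · (q^ (suc a * (suc a + d)) · (1+q^ (suc a) · Pₙ (suc a) · Pₙ (suc a + d) · Pₙ (suc b)))
      ≈⟨ ⊕-cong (·-cong ≈-refl (·-cong ≈-refl (Pₙ-step b))) (·-cong ≈-refl (·-cong ≈-refl (·-cong (·-cong (Pₙ-step a) ≈-refl) ≈-refl))) ⟩
    term (suc a) b ⊕ R a (suc b) ∎
  exponent : ∀ m k d → k + suc m * (suc m + d) ≡ suc (m + k) + d + m * (m + suc d)
  exponent = solve-∀
  -- The factor q^k left by the q-Pascal split joins q^((m+1)(m+1+d)) in such a way that the excess
  -- over m(m+d+1) is m + k + 1 + d, which is constant along the sum and can be taken out.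
  R≈ : ∀ m k → m + k ≡ K → R m k ≈ q^ (suc K + d) · term⁺ m k
  R≈ m k refl = begin
    R m k ≈⟨ ≈-sym (·-assoc _ _ _) ⟩
    q^ k · q^ (suc m * (suc m + d)) · (PP m (suc m + d) · Pₙ k)
      ≈⟨ ·-cong (≈-trans (q^-* k _) (≈-trans (q^-≡ (exponent m k d)) (≈-sym (q^-* (suc (m + k) + d) _)))) (·-cong (·-cong ≈-refl (≡⇒≈ (cong Pₙ (sym (+-suc m d))))) ≈-refl) ⟩
    q^ (suc (m + k) + d) · q^ (m * (m + suc d)) · (PP m (m + suc d) · Pₙ k) ≈⟨ ·-assoc _ _ _ ⟩
    q^ (suc (m + k) + d) · term⁺ m k ∎

-- A polynomial form of the pentagonal number theorem

-- Generalised pentagonal numbers: pent j = j(3j+1)/2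
pent : ℤ → ℕ
pent (+ zero) = 0
pent (+ suc n) = pent (+ n) + (3 * n + 2)
pent (-[1+ zero ]) = 1
pent (-[1+ suc n ]) = pent -[1+ n ] + (3 * n + 4)

pent-suc : ∀ j → + pent (ℤ.suc j) ≡ + pent j ℤ.+ (+ 3 ℤ.* j ℤ.+ + 2)
pent-suc (+ n) = cong (λ x → + (pent (+ n)) ℤ.+ (x ℤ.+ + 2)) (ℤₚ.pos-* 3 n)
pent-suc -[1+ zero ] = refl
pent-suc -[1+ suc n ] = sym (begin
  + pent -[1+ n ] ℤ.+ + (3 * n + 4) ℤ.+ (+ 3 ℤ.* -[1+ suc n ] ℤ.+ + 2)
    ≡⟨ cong (λ x → + pent -[1+ n ] ℤ.+ (x ℤ.+ + 4) ℤ.+ (+ 3 ℤ.* -[1+ suc n ] ℤ.+ + 2)) (ℤₚ.pos-* 3 n) ⟩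
  + pent -[1+ n ] ℤ.+ (+ 3 ℤ.* + n ℤ.+ + 4) ℤ.+ (+ 3 ℤ.* ℤ.- (+ 2 ℤ.+ + n) ℤ.+ + 2)
    ≡⟨ identity (+ pent -[1+ n ]) (+ n) ⟩
  + pent -[1+ n ] ∎)
  where
  open ≡-Reasoning
  identity : ∀ x n → x ℤ.+ (+ 3 ℤ.* n ℤ.+ + 4) ℤ.+ (+ 3 ℤ.* ℤ.- (+ 2 ℤ.+ n) ℤ.+ + 2) ≡ x
  identity = ℤ-solve-∀

data Residue : Set where
  r0 r1 r2 : Residue

-- A pair (j, r) stands for the integer 3j + r. Carrying quotient and residue as data lets a step in
-- a or b act by `next` or `prev`, without any division in the inductions.
Class : Set
Class = ℤ × Residue

value : Class → ℤ
value (j , r0) = + 3 ℤ.* j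
value (j , r1) = + 3 ℤ.* j ℤ.+ + 1
value (j , r2) = + 3 ℤ.* j ℤ.+ + 2

next prev : Class → Class
next (j , r0) = j , r1
next (j , r1) = j , r2
next (j , r2) = ℤ.suc j , r0
prev (j , r0) = ℤ.pred j , r2
prev (j , r1) = j , r0
prev (j , r2) = j , r1

next-prev : ∀ x → next (prev x) ≡ x
next-prev (j , r0) = cong (_, r0) (ℤₚ.suc-pred j)
next-prev (j , r1) = refl
next-prev (j , r2) = refl

prev-next : ∀ x → prev (next x) ≡ x
prev-next (j , r0) = refl
prev-next (j , r1) = refl
prev-next (j , r2) = cong (_, r2) (ℤₚ.pred-suc j)

value-next : ∀ x → value (next x) ≡ + 1 ℤ.+ value x
value-next (j , r0) = ℤₚ.+-comm (+ 3 ℤ.* j) (+ 1)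
value-next (j , r1) = lemma j
  where
  lemma : ∀ j → + 3 ℤ.* j ℤ.+ + 2 ≡ + 1 ℤ.+ (+ 3 ℤ.* j ℤ.+ + 1)
  lemma = ℤ-solve-∀
value-next (j , r2) = lemma j
  where
  lemma : ∀ j → + 3 ℤ.* (+ 1 ℤ.+ j) ≡ + 1 ℤ.+ (+ 3 ℤ.* j ℤ.+ + 2)
  lemma = ℤ-solve-∀

-- The class of b - a modulo 3
class : ℕ → ℕ → Class
class zero zero = + 0 , r0
class zero (suc b) = next (class zero b)
class (suc a) zero = prev (class a zero)
class (suc a) (suc b) = class a b

class-suc : ∀ a b → class a (suc b) ≡ next (class a b)
class-suc zero b = refl
class-suc (suc a) zero = sym (next-prev (class a zero))
class-suc (suc a) (suc b) = class-suc a b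

class-pred : ∀ a b → class (suc a) b ≡ prev (class a b)
class-pred a zero = refl
class-pred a (suc b) = sym (trans (cong prev (class-suc a b)) (prev-next (class a b)))

value-class : ∀ a b → + a ℤ.+ value (class a b) ≡ + b
value-class zero zero = refl
value-class zero (suc b) = trans (ℤₚ.+-identityˡ _) (trans (value-next (class 0 b)) (cong (λ z → + 1 ℤ.+ z) (trans (sym (ℤₚ.+-identityˡ (value (class 0 b)))) (value-class 0 b))))
value-class (suc a) zero = trans (shuffle (+ a) (value (prev (class a 0))))
  (trans (cong (λ z → + a ℤ.+ z) (trans (sym (value-next (prev (class a 0)))) (cong value (next-prev (class a 0))))) (value-class a 0))
  where
  shuffle : ∀ a v → + 1 ℤ.+ a ℤ.+ v ≡ a ℤ.+ (+ 1 ℤ.+ v)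
  shuffle = ℤ-solve-∀
value-class (suc a) (suc b) = trans (ℤₚ.+-assoc (+ 1) (+ a) (value (class a b))) (cong (λ z → + 1 ℤ.+ z) (value-class a b))

-- α-coefficients of the two Bailey pairs with β_n = 1/(q)_{2n} and β_n = 1/(q)_{2n-1}
W V : Class → Ser
W (j , r0) = q^ (pent j)
W (j , r1) = q^ (pent j)
W (j , r2) = 𝟘
V (j , r0) = 𝟘
V (j , r1) = 𝟘
V (j , r2) = q^ (pent j) ⊕ q^ (pent (ℤ.suc j))

-- In this class b - a is 3j + 2, which is exactly the increment from `pent j` to `pent (j + 1)`.
-- This coincidence drives both Bailey pairs: it cancels the halves in `W-halves` and completes the
-- brackets in `V-inner`.
pent-class : ∀ a b j → class a b ≡ (j , r2) → pent (ℤ.suc j) + a ≡ pent j + b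
pent-class a b j eq = ℤₚ.+-injective (begin
  + pent (ℤ.suc j) ℤ.+ + a ≡⟨ cong (λ z → z ℤ.+ + a) (pent-suc j) ⟩
  + pent j ℤ.+ (+ 3 ℤ.* j ℤ.+ + 2) ℤ.+ + a ≡⟨ shuffle (+ pent j) (+ 3 ℤ.* j ℤ.+ + 2) (+ a) ⟩
  + pent j ℤ.+ (+ a ℤ.+ value (j , r2)) ≡⟨ cong (λ x → + pent j ℤ.+ (+ a ℤ.+ value x)) (sym eq) ⟩
  + pent j ℤ.+ (+ a ℤ.+ value (class a b)) ≡⟨ cong (λ x → + pent j ℤ.+ x) (value-class a b) ⟩
  + pent j ℤ.+ + b ∎)
  where
  open ≡-Reasoning
  shuffle : ∀ p x a → p ℤ.+ x ℤ.+ a ≡ p ℤ.+ (a ℤ.+ x)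
  shuffle = ℤ-solve-∀

pent-class-q^ : ∀ a b j → class a b ≡ (j , r2) → q^ (pent (ℤ.suc j)) · q^ a ≈ q^ (pent j) · q^ b
pent-class-q^ a b j eq = ≈-trans (q^-* (pent (ℤ.suc j)) a) (≈-trans (q^-≡ (pent-class a b j eq)) (≈-sym (q^-* (pent j) b)))

-- The two halves into which q-Pascal splits W (class a b) (1 - q^{a+b}) / ((q)_a (q)_b).
Wˡ Wʳ : Class → ℕ → ℕ → Ser
Wˡ (j , r0) a b = q^ (pent j)
Wˡ (j , r1) a b = 𝟘
Wˡ (j , r2) a b = q^ (pent (ℤ.suc j)) · q^ a
Wʳ (j , r0) a b = 𝟘
Wʳ (j , r1) a b = q^ (pent j)
Wʳ (j , r2) a b = q^ (pent j) · q^ b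

W-halves : ∀ x a b → class a b ≡ x → Wˡ x a b ⊕ Wʳ x a b ≈ W x
W-halves (j , r0) a b eq = ⊕-identityʳ _
W-halves (j , r1) a b eq = pointwise (λ _ → refl)
W-halves (j , r2) a b eq = ≈-trans (⊕-cong (pent-class-q^ a b j eq) ≈-refl) (⊕-self _)

-- With x₁ = q^(a+1) and y₁ = q^(b+1), class r0 uses 1 - x₁y₁ = x₁(1 - y₁) + (1 - x₁) and class r1
-- uses (1 - y₁) + y₁(1 - x₁). With this choice the half that carries an extra power of q always
-- lands in class r2, where it meets its equal.
W-inner : ∀ x a b → 1+q^ (suc a + suc b) · (W x · PP (suc a) (suc b)) ≈ Wˡ (prev x) (suc a) b · PP (suc a) b ⊕ Wʳ (next x) a (suc b) · PP a (suc b)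
W-inner x a b = ≈-trans (·-cong (⊕-cong ≈-refl (≈-sym (q^-* (suc a) (suc b)))) ≈-refl)
  (≈-trans (go x) (⊕-cong (·-cong ≈-refl (·-cong ≈-refl (Pₙ-step b))) (·-cong ≈-refl (·-cong (Pₙ-step a) ≈-refl))))
  where
  x₁ = q^ (suc a)
  y₁ = q^ (suc b)
  A = Pₙ (suc a)
  B = Pₙ (suc b)
  go : ∀ x → (𝟙 ⊕ x₁ · y₁) · (W x · (A · B)) ≈ Wˡ (prev x) (suc a) b · (A · ((𝟙 ⊕ y₁) · B)) ⊕ Wʳ (next x) a (suc b) · ((𝟙 ⊕ x₁) · A · B)
  go (j , r0) rewrite ℤₚ.suc-pred j =
    solve 5 (λ w x y A B → (con true :+ x :* y) :* (w :* (A :* B)) := w :* x :* (A :* ((con true :+ y) :* B)) :+ w :* ((con true :+ x) :* A :* B)) ≈-refl _ x₁ y₁ A B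
  go (j , r1) =
    solve 5 (λ w x y A B → (con true :+ x :* y) :* (w :* (A :* B)) := w :* (A :* ((con true :+ y) :* B)) :+ w :* y :* ((con true :+ x) :* A :* B)) ≈-refl _ x₁ y₁ A B
  go (j , r2) = solve 4 (λ x y A B → (con true :+ x :* y) :* (con false :* (A :* B)) := con false :* (A :* ((con true :+ y) :* B)) :+ con false :* ((con true :+ x) :* A :* B)) ≈-refl x₁ y₁ A B

W-left : ∀ x b → 1+q^ (suc b) · (W (next x) · PP 0 (suc b)) ≈ Wˡ x 0 b · PP 0 b
W-left x b = ≈-trans (go x) (·-cong ≈-refl (·-cong ≈-refl (Pₙ-step b)))
  where
  u = 1+q^ (suc b)
  B = Pₙ (suc b)
  go : ∀ x → u · (W (next x) · (𝟙 · B)) ≈ Wˡ x 0 b · (𝟙 · (u · B))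
  go (j , r0) = solve 3 (λ w u B → u :* (w :* (con true :* B)) := w :* (con true :* (u :* B))) ≈-refl _ u B
  go (j , r1) = solve 2 (λ u B → u :* (con false :* (con true :* B)) := con false :* (con true :* (u :* B))) ≈-refl u B
  go (j , r2) = solve 3 (λ w u B → u :* (w :* (con true :* B)) := w :* con true :* (con true :* (u :* B))) ≈-refl _ u B

W-right : ∀ x a → 1+q^ (suc a) · (W (prev x) · PP (suc a) 0) ≈ Wʳ x a 0 · PP a 0
W-right x a = ≈-trans (go x) (·-cong ≈-refl (·-cong (Pₙ-step a) ≈-refl))
  where
  u = 1+q^ (suc a)
  A = Pₙ (suc a)
  go : ∀ x → u · (W (prev x) · (A · 𝟙)) ≈ Wʳ x a 0 · (u · A · 𝟙)
  go (j , r0) = solve 2 (λ u A → u :* (con false :* (A :* con true)) := con false :* (u :* A :* con true)) ≈-refl u A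
  go (j , r1) = solve 3 (λ w u A → u :* (w :* (A :* con true)) := w :* (u :* A :* con true)) ≈-refl _ u A
  go (j , r2) = solve 3 (λ w u A → u :* (w :* (A :* con true)) := w :* con true :* (u :* A :* con true)) ≈-refl _ u A

-- Multiplied by (q)_N this is Σ_j q^(pent j) [N, ⌊(N-3j)/2⌋] = 1 over 𝔽₂: for each j exactly one of
-- b - a = 3j and b - a = 3j + 1 is compatible with a + b = N. In the inductive step the factor 1 -
-- q^(N+1) is distributed over the terms, and the halves reassemble to the sum for N.
bailey-pair-W : ∀ N → Σ[ N ] (λ a b → W (class a b) · PP a b) ≈ Pₙ N
bailey-pair-W zero = pointwise (λ n → at (solve 0 (con true :* (con true :* con true) := con true) ≈-refl) n)
bailey-pair-W (suc N) = 1+q^-cancel N (begin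
  1+q^ (suc N) · Σ[ suc N ] F ≈⟨ ≈-sym (Σ-·ˡ (suc N) (1+q^ (suc N)) F) ⟩
  Σ[ suc N ] (λ a b → 1+q^ (suc N) · F a b) ≈⟨ Σ-cong (suc N) (λ a b eq → ·-cong (⊕-cong ≈-refl (q^-≡ (sym eq))) ≈-refl) ⟩
  Σ[ suc N ] (λ a b → 1+q^ (a + b) · F a b) ≈⟨ Σ-split N (λ a b → 1+q^ (a + b) · F a b) L R inner left right ⟩
  Σ[ N ] (λ a b → L a b ⊕ R a b)
    ≈⟨ Σ-cong N (λ a b _ → ≈-trans (≈-sym (·-distribʳ (PP a b) _ _)) (·-cong (W-halves (class a b) a b refl) ≈-refl)) ⟩
  Σ[ N ] F ≈⟨ bailey-pair-W N ⟩
  Pₙ N ≈⟨ ≈-sym (Pₙ-step N) ⟩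
  1+q^ (suc N) · Pₙ (suc N) ∎)
  where
  open ≈R
  F L R : ℕ → ℕ → Ser
  F a b = W (class a b) · PP a b
  L a b = Wˡ (class a b) a b · PP a b
  R a b = Wʳ (class a b) a b · PP a b
  inner : ∀ a b → 1+q^ (suc a + suc b) · F (suc a) (suc b) ≈ L (suc a) b ⊕ R a (suc b)
  inner a b rewrite class-suc a b | class-pred a b = W-inner (class a b) a b
  left : ∀ b → 1+q^ (suc b) · F 0 (suc b) ≈ L 0 b
  left b = W-left (class 0 b) b
  right : ∀ a → 1+q^ (suc a + 0) · F (suc a) 0 ≈ R a 0
  right a = ≈-trans (·-cong (⊕-cong ≈-refl (q^-≡ (+-identityʳ (suc a)))) ≈-refl) (W-right (class a 0) a)

Vˡ Vʳ : Class → Ser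
Vˡ (j , r0) = 𝟘
Vˡ (j , r1) = q^ (pent j)
Vˡ (j , r2) = 𝟘
Vʳ (j , r0) = q^ (pent j)
Vʳ (j , r1) = 𝟘
Vʳ (j , r2) = 𝟘

V-halves : ∀ x → Vˡ x ⊕ Vʳ x ≈ W x
V-halves (j , r0) = pointwise (λ _ → refl)
V-halves (j , r1) = ⊕-identityʳ _
V-halves (j , r2) = pointwise (λ _ → refl)

-- Only class r2 has content. There q^(pent j + b + 1) and q^(pent (j+1) + a + 1) coincide, so their
-- sum, which is 0, can be inserted; it turns the two monomials of `V` into multiples of 1 - q^(b+1)
-- and 1 - q^(a+1), which lower b and a.
V-inner : ∀ x a b → class a b ≡ x → V x · PP (suc a) (suc b) ≈ Vˡ (prev x) · PP (suc a) b ⊕ Vʳ (next x) · PP a (suc b)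
V-inner x a b eq = ≈-trans (go x eq) (⊕-cong (·-cong ≈-refl (·-cong ≈-refl (Pₙ-step b))) (·-cong ≈-refl (·-cong (Pₙ-step a) ≈-refl)))
  where
  open ≈R
  x₁ = q^ (suc a)
  y₁ = q^ (suc b)
  A = Pₙ (suc a)
  B = Pₙ (suc b)
  go : ∀ x → class a b ≡ x → V x · (A · B) ≈ Vˡ (prev x) · (A · ((𝟙 ⊕ y₁) · B)) ⊕ Vʳ (next x) · ((𝟙 ⊕ x₁) · A · B)
  go (j , r0) _ = solve 4 (λ x y A B → con false :* (A :* B) := con false :* (A :* ((con true :+ y) :* B)) :+ con false :* ((con true :+ x) :* A :* B)) ≈-refl x₁ y₁ A B
  go (j , r1) _ = solve 4 (λ x y A B → con false :* (A :* B) := con false :* (A :* ((con true :+ y) :* B)) :+ con false :* ((con true :+ x) :* A :* B)) ≈-refl x₁ y₁ A B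
  go (j , r2) eq = begin
    (w ⊕ w′) · (A · B) ≈⟨ solve 5 (λ w w′ z A B → (w :+ w′) :* (A :* B) := (w :+ w′ :+ (z :+ z)) :* (A :* B)) ≈-refl w w′ (w · y₁) A B ⟩
    (w ⊕ w′ ⊕ (w · y₁ ⊕ w · y₁)) · (A · B) ≈⟨ ·-cong (⊕-cong ≈-refl (⊕-cong ≈-refl (≈-sym (pent-class-q^ (suc a) (suc b) j eq)))) ≈-refl ⟩
    (w ⊕ w′ ⊕ (w · y₁ ⊕ w′ · x₁)) · (A · B)
      ≈⟨ solve 6 (λ w w′ x y A B → (w :+ w′ :+ (w :* y :+ w′ :* x)) :* (A :* B) := w :* (A :* ((con true :+ y) :* B)) :+ w′ :* ((con true :+ x) :* A :* B)) ≈-refl w w′ x₁ y₁ A B ⟩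
    w · (A · ((𝟙 ⊕ y₁) · B)) ⊕ w′ · ((𝟙 ⊕ x₁) · A · B) ∎
    where
    w = q^ (pent j)
    w′ = q^ (pent (ℤ.suc j))

V-left : ∀ x b → class 0 b ≡ x → V (next x) · PP 0 (suc b) ≈ Vˡ x · PP 0 b
V-left x b eq = ≈-trans (go x eq) (·-cong ≈-refl (·-cong ≈-refl (Pₙ-step b)))
  where
  B = Pₙ (suc b)
  y = q^ (suc b)
  zeros : 𝟘 · (𝟙 · B) ≈ 𝟘 · (𝟙 · ((𝟙 ⊕ y) · B))
  zeros = solve 2 (λ y B → con false :* (con true :* B) := con false :* (con true :* ((con true :+ y) :* B))) ≈-refl y B
  go : ∀ x → class 0 b ≡ x → V (next x) · (𝟙 · B) ≈ Vˡ x · (𝟙 · ((𝟙 ⊕ y) · B))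
  go (j , r0) _ = zeros
  go (j , r1) eq = ≈-trans
    (·-cong (⊕-cong (≈-refl {q^ (pent j)}) (≈-trans (≈-sym (·-identityʳ (q^ (pent (ℤ.suc j))))) (pent-class-q^ 0 (suc b) j (cong next eq)))) ≈-refl)
    (solve 3 (λ w y B → (w :+ w :* y) :* (con true :* B) := w :* (con true :* ((con true :+ y) :* B))) ≈-refl _ y B)
  go (j , r2) _ = zeros

V-right : ∀ x a → class a 0 ≡ x → V (prev x) · PP (suc a) 0 ≈ Vʳ x · PP a 0
V-right x a eq = ≈-trans (go x eq) (·-cong ≈-refl (·-cong (Pₙ-step a) ≈-refl))
  where
  A = Pₙ (suc a)
  y = q^ (suc a)
  zeros : 𝟘 · (A · 𝟙) ≈ 𝟘 · ((𝟙 ⊕ y) · A · 𝟙)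
  zeros = solve 2 (λ y A → con false :* (A :* con true) := con false :* ((con true :+ y) :* A :* con true)) ≈-refl y A
  go : ∀ x → class a 0 ≡ x → V (prev x) · (A · 𝟙) ≈ Vʳ x · ((𝟙 ⊕ y) · A · 𝟙)
  go (j , r0) eq = ≈-trans
    (·-cong (⊕-cong (≈-trans (≈-sym (·-identityʳ (q^ (pent (ℤ.pred j))))) (≈-sym (pent-class-q^ (suc a) 0 (ℤ.pred j) (cong prev eq)))) ≈-refl) ≈-refl)
    (≈-trans (solve 3 (λ w y A → (w :* y :+ w) :* (A :* con true) := w :* ((con true :+ y) :* A :* con true)) ≈-refl (q^ (pent (ℤ.suc (ℤ.pred j)))) y A)
      (·-cong (q^-≡ (cong pent (ℤₚ.suc-pred j))) ≈-refl))
  go (j , r1) _ = zeros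
  go (j , r2) _ = zeros

-- The halves recombine to `W` on the antidiagonal N, so this pair follows from the first one by a
-- single q-Pascal step.
bailey-pair-V : ∀ N → Σ[ suc N ] (λ a b → V (class a b) · PP a b) ≈ Pₙ N
bailey-pair-V N = begin
  Σ[ suc N ] (λ a b → V (class a b) · PP a b) ≈⟨ Σ-split N (λ a b → V (class a b) · PP a b) L R inner left right ⟩
  Σ[ N ] (λ a b → L a b ⊕ R a b)
    ≈⟨ Σ-cong N (λ a b _ → ≈-trans (≈-sym (·-distribʳ (PP a b) _ _)) (·-cong (V-halves (class a b)) ≈-refl)) ⟩
  Σ[ N ] (λ a b → W (class a b) · PP a b) ≈⟨ bailey-pair-W N ⟩
  Pₙ N ∎
  where
  open ≈R
  L R : ℕ → ℕ → Ser
  L a b = Vˡ (class a b) · PP a b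
  R a b = Vʳ (class a b) · PP a b
  inner : ∀ a b → V (class (suc a) (suc b)) · PP (suc a) (suc b) ≈ L (suc a) b ⊕ R a (suc b)
  inner a b rewrite class-suc a b | class-pred a b = V-inner (class a b) a b refl
  left : ∀ b → V (class 0 (suc b)) · PP 0 (suc b) ≈ L 0 b
  left b = V-left (class 0 b) b refl
  right : ∀ a → V (class (suc a) 0) · PP (suc a) 0 ≈ R a 0
  right a = V-right (class a 0) a refl

-- Sums over lists

false-unless : ∀ {b : Bool} {C : Set} → ¬ C → (b ≡ true → C) → b ≡ false
false-unless {true} ¬c h = contradiction (h refl) ¬c
false-unless {false} ¬c h = refl

∧-true : ∀ {a b} → a ∧ b ≡ true → a ≡ true × b ≡ true
∧-true {true} {true} _ = refl , refl

module _ {A : Set} where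

  ∑ : List A → (A → Bool) → Bool
  ∑ [] f = false
  ∑ (x ∷ xs) f = f x xor ∑ xs f

  ∑-cong : ∀ xs {f g : A → Bool} → (∀ {x} → x ∈ xs → f x ≡ g x) → ∑ xs f ≡ ∑ xs g
  ∑-cong [] h = refl
  ∑-cong (x ∷ xs) h = cong₂ _xor_ (h (here refl)) (∑-cong xs (h ∘ there))

  ∑-xor : ∀ xs (f g : A → Bool) → ∑ xs (λ x → f x xor g x) ≡ ∑ xs f xor ∑ xs g
  ∑-xor [] f g = refl
  ∑-xor (x ∷ xs) f g = trans (cong ((f x xor g x) xor_) (∑-xor xs f g)) (xor-interchange (f x) (g x) _ _)

  ∑-false : ∀ xs {f : A → Bool} → (∀ {x} → x ∈ xs → f x ≡ false) → ∑ xs f ≡ false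
  ∑-false [] h = refl
  ∑-false (x ∷ xs) h = cong₂ _xor_ (h (here refl)) (∑-false xs (h ∘ there))

  ∑-∧ˡ : ∀ xs c (f : A → Bool) → ∑ xs (λ x → c ∧ f x) ≡ c ∧ ∑ xs f
  ∑-∧ˡ xs true f = refl
  ∑-∧ˡ xs false f = ∑-false xs (λ _ → refl)

  ∑-∧ʳ : ∀ xs c (f : A → Bool) → ∑ xs (λ x → f x ∧ c) ≡ ∑ xs f ∧ c
  ∑-∧ʳ xs c f = trans (∑-cong xs (λ {x} _ → ∧-comm (f x) c)) (trans (∑-∧ˡ xs c f) (∧-comm c _))

  ∑-unique : ∀ {xs a} (f : A → Bool) → Unique xs → a ∈ xs → (∀ {x} → x ∈ xs → f x ≡ true → x ≡ a) → ∑ xs f ≡ f a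
  ∑-unique {y ∷ ys} {a} f (y∉ ∷ u) (here refl) h =
    trans (cong (f a xor_) (∑-false ys (λ {x} x∈ → false-unless (λ x≡a → lookup y∉ x∈ (sym x≡a)) (h (there x∈))))) (xor-identityʳ (f a))
  ∑-unique {y ∷ ys} {a} f (y∉ ∷ u) (there a∈) h =
    trans (cong (_xor ∑ ys f) (false-unless (lookup y∉ a∈) (h (here refl)))) (∑-unique f u a∈ (h ∘ there))

  ∑-++ : ∀ xs ys (f : A → Bool) → ∑ (xs ++ ys) f ≡ ∑ xs f xor ∑ ys f
  ∑-++ [] ys f = refl
  ∑-++ (x ∷ xs) ys f = trans (cong (f x xor_) (∑-++ xs ys f)) (sym (xor-assoc (f x) _ _))

module _ {A B : Set} where

  ∑-map : ∀ (h : A → B) xs (f : B → Bool) → ∑ (map h xs) f ≡ ∑ xs (f ∘ h)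
  ∑-map h [] f = refl
  ∑-map h (x ∷ xs) f = cong (f (h x) xor_) (∑-map h xs f)

module _ {A B : Set} where

  ∑-swap : ∀ xs ys (f : A → B → Bool) → ∑ xs (λ x → ∑ ys (f x)) ≡ ∑ ys (λ y → ∑ xs (λ x → f x y))
  ∑-swap [] ys f = sym (∑-false ys (λ _ → refl))
  ∑-swap (x ∷ xs) ys f = trans (cong (∑ ys (f x) xor_) (∑-swap xs ys f)) (sym (∑-xor ys (f x) _))

  ∑-cartesianProduct : ∀ xs ys (f : A × B → Bool) → ∑ (cartesianProduct xs ys) f ≡ ∑ xs (λ x → ∑ ys (λ y → f (x , y)))
  ∑-cartesianProduct [] ys f = refl
  ∑-cartesianProduct (x ∷ xs) ys f =
    trans (∑-++ (map (x ,_) ys) (cartesianProduct xs ys) f) (cong₂ _xor_ (∑-map (x ,_) ys f) (∑-cartesianProduct xs ys f))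

  -- Both sums equal Σ_{x,y} [f x][φ x = y], so only the supports of f and g matter.
  ∑-bijection : DecidableEquality B → ∀ {xs ys} (f : A → Bool) (g : B → Bool) (φ : A → B) (ψ : B → A) → Unique xs → Unique ys →
    (∀ {x} → x ∈ xs → f x ≡ true → φ x ∈ ys × g (φ x) ≡ true × ψ (φ x) ≡ x) →
    (∀ {y} → y ∈ ys → g y ≡ true → ψ y ∈ xs × f (ψ y) ≡ true × φ (ψ y) ≡ y) →
    ∑ xs f ≡ ∑ ys g
  ∑-bijection _≟_ {xs} {ys} f g φ ψ uxs uys to from = begin
    ∑ xs f ≡⟨ ∑-cong xs rows ⟩
    ∑ xs (λ x → ∑ ys (R x)) ≡⟨ ∑-swap xs ys R ⟩
    ∑ ys (λ y → ∑ xs (λ x → R x y)) ≡⟨ ∑-cong ys columns ⟩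
    ∑ ys g ∎
    where
    open ≡-Reasoning
    R : A → B → Bool
    R x y = f x ∧ does (φ x ≟ y)
    R-true : ∀ x y → R x y ≡ true → f x ≡ true × φ x ≡ y
    R-true x y e with φ x ≟ y | ∧-true {f x} e
    ... | yes p | fx , _ = fx , p
    ... | no _ | _ , ()
    true-R : ∀ {x y} → f x ≡ true → φ x ≡ y → R x y ≡ true
    true-R {x} {y} fx p = cong₂ _∧_ fx (dec-true (φ x ≟ y) p)
    rows : ∀ {x} → x ∈ xs → f x ≡ ∑ ys (R x)
    rows {x} x∈ with f x in fx
    ... | false = sym (∑-false ys (λ _ → refl))
    ... | true with to x∈ fx
    ...   | φx∈ , _ , _ = sym (trans (∑-unique (λ y → does (φ x ≟ y)) uys φx∈ (λ {y} _ e → sym (proj₂ (R-true x y (cong₂ _∧_ fx e))))) (dec-true (φ x ≟ φ x) refl))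
    columns : ∀ {y} → y ∈ ys → ∑ xs (λ x → R x y) ≡ g y
    columns {y} y∈ with g y in gy
    ... | false = ∑-false xs (λ {x} x∈ → false-unless (λ ()) (λ e → let fx , p = R-true x y e in
            trans (sym gy) (subst (λ z → g z ≡ true) p (proj₁ (proj₂ (to x∈ fx))))))
    ... | true with from y∈ gy
    ...   | ψy∈ , fψ , φψ = trans (∑-unique (λ x → R x y) uxs ψy∈ (λ {x} x∈ e → let fx , p = R-true x y e in
            trans (sym (proj₂ (proj₂ (to x∈ fx)))) (cong ψ p))) (true-R fψ φψ)

module _ {A : Set} where

  ∑ˢ : List A → (A → Ser) → Ser
  coeff (∑ˢ xs F) n = ∑ xs (λ x → coeff (F x) n)

  ∑ˢ-∷ : ∀ x xs F → ∑ˢ (x ∷ xs) F ≈ F x ⊕ ∑ˢ xs F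
  ∑ˢ-∷ x xs F = pointwise (λ _ → refl)

  ∑ˢ-cong : ∀ xs {F G : A → Ser} → (∀ {x} → x ∈ xs → F x ≈ G x) → ∑ˢ xs F ≈ ∑ˢ xs G
  ∑ˢ-cong xs h = pointwise (λ n → ∑-cong xs (λ x∈ → at (h x∈) n))

  ∑ˢ-cong[] : ∀ xs {F G : A → Ser} {N} → (∀ {x} → x ∈ xs → F x ≈[ N ] G x) → ∑ˢ xs F ≈[ N ] ∑ˢ xs G
  ∑ˢ-cong[] xs h = pointwise≤ (λ p → ∑-cong xs (λ x∈ → at≤ (h x∈) p))

  ∑ˢ-·ˡ : ∀ xs f (F : A → Ser) → ∑ˢ xs (λ x → f · F x) ≈ f · ∑ˢ xs F
  ∑ˢ-·ˡ [] f F = pointwise (λ n → sym (at (·-zeroʳ f) n))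
  ∑ˢ-·ˡ (x ∷ xs) f F = ≈-trans (∑ˢ-∷ x xs (λ x → f · F x)) (≈-trans (⊕-cong ≈-refl (∑ˢ-·ˡ xs f F))
    (≈-trans (≈-sym (·-distribˡ f (F x) (∑ˢ xs F))) (·-cong ≈-refl (≈-sym (∑ˢ-∷ x xs F)))))

  Σ-∑ˢ : ∀ N xs (F : ℕ → ℕ → A → Ser) → Σ[ N ] (λ a b → ∑ˢ xs (F a b)) ≈ ∑ˢ xs (λ x → Σ[ N ] (λ a b → F a b x))
  Σ-∑ˢ N [] F = pointwise (λ n → antidiag-false N)
  Σ-∑ˢ N (x ∷ xs) F = pointwise (λ n → trans (antidiag-xor N (λ a b → coeff (F a b x) n) (λ a b → ∑ xs (λ y → coeff (F a b y) n)))
    (cong (antidiag N (λ a b → coeff (F a b x) n) xor_) (at (Σ-∑ˢ N xs F) n)))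

-- Bailey's lemma

range : ℕ → List ℤ
range zero = + 0 ∷ []
range (suc M) = + suc M ∷ -[1+ M ] ∷ range M

range-bound : ∀ M {r} → r ∈ range M → ∣ r ∣ ≤ M
range-bound zero (here refl) = z≤n
range-bound (suc M) (here refl) = ≤-refl
range-bound (suc M) (there (here refl)) = ≤-refl
range-bound (suc M) (there (there p)) = m≤n⇒m≤1+n (range-bound M p)

range-complete : ∀ M r → ∣ r ∣ ≤ M → r ∈ range M
range-complete zero (+ zero) _ = here refl
range-complete (suc M) r p with m≤n⇒m<n∨m≡n p
... | inj₁ (s≤s q) = there (there (range-complete M r q))
range-complete (suc M) (+ _) p | inj₂ refl = here refl
range-complete (suc M) -[1+ _ ] p | inj₂ refl = there (here refl)

range-unique : ∀ M → Unique (range M)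
range-unique zero = [] ∷ []
range-unique (suc M) = ((λ ()) ∷ away (+ suc M) ≤-refl) ∷ (away -[1+ M ] ≤-refl ∷ range-unique M)
  where
  away : ∀ r → M < ∣ r ∣ → All (r ≢_) (range M)
  away r M<r = tabulate (λ {s} s∈ → λ { refl → <-irrefl refl (≤-trans M<r (range-bound M s∈)) })

∑ˢ-range-extend : ∀ {n} M F → n ≤ M → (∀ r → n < ∣ r ∣ → F r ≈ 𝟘) → ∑ˢ (range M) F ≈ ∑ˢ (range n) F
∑ˢ-range-extend {n} M F n≤M h with m≤n⇒m<n∨m≡n n≤M
... | inj₂ refl = ≈-refl
∑ˢ-range-extend {n} (suc M) F n≤M h | inj₁ (s≤s n≤M′) =
  pointwise (λ k → trans (cong₂ _xor_ (at (h (+ suc M) (s≤s n≤M′)) k) (cong₂ _xor_ (at (h -[1+ M ] (s≤s n≤M′)) k) (at (∑ˢ-range-extend M F n≤M′ h) k))) refl)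

-- 1/(q)_{n-i}, which is 0 for n < i
P∸ : ℕ → ℕ → Ser
P∸ n zero = Pₙ n
P∸ zero (suc i) = 𝟘
P∸ (suc n) (suc i) = P∸ n i

P∸-≤ : ∀ n i → i ≤ n → P∸ n i ≡ Pₙ (n ∸ i)
P∸-≤ n zero _ = refl
P∸-≤ (suc n) (suc i) (s≤s p) = P∸-≤ n i p

P∸-> : ∀ n i → n < i → P∸ n i ≡ 𝟘
P∸-> zero (suc i) _ = refl
P∸-> (suc n) (suc i) (s≤s p) = P∸-> n i p

class-+ : ∀ k a b → class (k + a) (k + b) ≡ class a b
class-+ zero a b = refl
class-+ (suc k) a b = class-+ k a b

-- In a sum over a + b = 2n put a = n - r and b = n + r. Then b - a = 2r, and this is its class;
-- `Σ-even` performs the change of index.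
doubleClass : ℤ → Class
doubleClass (+ i) = class 0 (i + i)
doubleClass -[1+ i ] = class (suc i + suc i) 0

centred : (ℕ → ℕ → Ser) → ℕ → ℤ → Ser
centred F n (+ i) = F (n ∸ i) (n + i)
centred F n -[1+ i ] = F (n + suc i) (n ∸ suc i)

Σ-even : ∀ n (F : ℕ → ℕ → Ser) → Σ[ n + n ] F ≈ ∑ˢ (range n) (centred F n)
Σ-even zero F = pointwise (λ k → sym (xor-identityʳ _))
Σ-even (suc n) F = begin
  Σ[ suc n + suc n ] F ≈⟨ Σ-suc (n + suc n) F ⟩
  F 0 (suc n + suc n) ⊕ Σ[ n + suc n ] (λ a → F (suc a)) ≈⟨ ⊕-cong ≈-refl (≡⇒≈ (cong (λ k → Σ[ k ] (λ a → F (suc a))) (+-suc n n))) ⟩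
  F 0 (suc n + suc n) ⊕ Σ[ suc (n + n) ] (λ a → F (suc a)) ≈⟨ ⊕-cong ≈-refl (Σ-last (n + n) (λ a → F (suc a))) ⟩
  F 0 (suc n + suc n) ⊕ (Σ[ n + n ] (λ a b → F (suc a) (suc b)) ⊕ F (suc (suc (n + n))) 0)
    ≈⟨ ⊕-cong (≡⇒≈ (cong (λ k → F k (suc n + suc n)) (sym (n∸n≡0 n)))) (⊕-cong (≈-trans (Σ-even n (λ a b → F (suc a) (suc b))) (∑ˢ-cong (range n) (λ {r} r∈ → ≡⇒≈ (recentre r (range-bound n r∈)))))
         (≡⇒≈ (cong₂ F (cong suc (sym (+-suc n n))) (sym (n∸n≡0 n))))) ⟩
  centred F (suc n) (+ suc n) ⊕ (∑ˢ (range n) (centred F (suc n)) ⊕ centred F (suc n) -[1+ n ])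
    ≈⟨ ⊕-cong ≈-refl (⊕-comm _ _) ⟩
  centred F (suc n) (+ suc n) ⊕ (centred F (suc n) -[1+ n ] ⊕ ∑ˢ (range n) (centred F (suc n))) ≈⟨ pointwise (λ _ → refl) ⟩
  ∑ˢ (range (suc n)) (centred F (suc n)) ∎
  where
  open ≈R
  recentre : ∀ r → ∣ r ∣ ≤ n → centred (λ a b → F (suc a) (suc b)) n r ≡ centred F (suc n) r
  recentre (+ i) p = cong (λ k → F k (suc (n + i))) (sym (+-∸-assoc 1 p))
  recentre -[1+ i ] p = cong (F (suc (n + suc i))) (sym (+-∸-assoc 1 p))

-- Bailey's lemma relative to 1 with both parameters sent to infinity, in bilateral form: if β_n is
-- the sum of α_r / ((q)_(n-r) (q)_(n+r)) over |r| ≤ n, then Σ q^(n²) β_n = P Σ q^(r²) α_r. Indexing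
-- by all integers r avoids pairing α_r with α_(-r).
module Bailey (Z : Class → Ser) (β : ℕ → Ser)
  (pair : ∀ n → Σ[ n + n ] (λ a b → Z (class a b) · PP a b) ≈ β n) where

  α : ℤ → Ser
  α r = Z (doubleClass r)

  private
    centred-value : ∀ n r → ∣ r ∣ ≤ n → centred (λ a b → Z (class a b) · PP a b) n r ≈ α r · (P∸ n ∣ r ∣ · Pₙ (n + ∣ r ∣))
    centred-value n (+ i) p = ·-cong (≡⇒≈ (cong Z (trans (cong₂ class (sym (+-identityʳ (n ∸ i))) n+i≡) (class-+ (n ∸ i) 0 (i + i)))))
      (·-cong (≡⇒≈ (sym (P∸-≤ n i p))) ≈-refl)
      where
      n+i≡ : n + i ≡ n ∸ i + (i + i)
      n+i≡ = trans (cong (_+ i) (sym (m∸n+n≡m p))) (+-assoc (n ∸ i) i i)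
    centred-value n -[1+ i ] p = ·-cong (≡⇒≈ (cong Z (trans (cong₂ class n+i≡ (sym (+-identityʳ (n ∸ suc i)))) (class-+ (n ∸ suc i) (suc i + suc i) 0))))
      (≈-trans (·-comm _ _) (·-cong (≡⇒≈ (sym (P∸-≤ n (suc i) p))) ≈-refl))
      where
      n+i≡ : n + suc i ≡ n ∸ suc i + (suc i + suc i)
      n+i≡ = trans (cong (_+ suc i) (sym (m∸n+n≡m p))) (+-assoc (n ∸ suc i) (suc i) (suc i))

  -- Since `P∸ n i` is 0 for i > n, the range of r may be enlarged from n to M. The index set then
  -- no longer depends on n, and in `finite` the two summations can be exchanged.
  β-expansion : ∀ {n} M → n ≤ M → β n ≈ ∑ˢ (range M) (λ r → α r · (P∸ n ∣ r ∣ · Pₙ (n + ∣ r ∣)))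
  β-expansion {n} M n≤M = ≈-trans (≈-sym (pair n)) (≈-trans (Σ-even n _)
    (≈-trans (∑ˢ-cong (range n) (λ {r} r∈ → centred-value n r (range-bound n r∈)))
      (≈-sym (∑ˢ-range-extend M _ n≤M (λ r n<r → ≈-trans (·-cong ≈-refl (≈-trans (·-cong (≡⇒≈ (P∸-> n ∣ r ∣ n<r)) ≈-refl) (·-zeroˡ _))) (·-zeroʳ _))))))

  private
    skip : ∀ i K (F : ℕ → ℕ → Ser) → Σ[ i + K ] (λ n k → P∸ n i · F n k) ≈ Σ[ K ] (λ m k → Pₙ m · F (i + m) k)
    skip zero K F = ≈-refl
    skip (suc i) K F = ≈-trans (Σ-suc (i + K) (λ n k → P∸ n (suc i) · F n k))
      (≈-trans (⊕-cong (·-zeroˡ _) (skip i K (λ n → F (suc n)))) (pointwise (λ _ → refl)))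

    square-+ : ∀ i m → (i + m) * (i + m) ≡ i * i + m * (m + (i + i))
    square-+ = solve-∀

    -- The terms with n < i vanish. For n = i + m one has n² = i² + m(m + 2i), so what remains is
    -- the q-Vandermonde sum with d = 2i.
    inner : ∀ M i → i ≤ M → Σ[ M ] (λ n k → P∸ n i · (q^ (n * n) · (Pₙ k · Pₙ (n + i)))) ≈ q^ (i * i) · (P∸ M i · Pₙ (M + i))
    inner M i i≤M = begin
      Σ[ M ] (λ n k → P∸ n i · F n k) ≈⟨ ≡⇒≈ (cong (λ k → Σ[ k ] (λ n k → P∸ n i · F n k)) (sym (m+[n∸m]≡n i≤M))) ⟩
      Σ[ i + K ] (λ n k → P∸ n i · F n k) ≈⟨ skip i K F ⟩
      Σ[ K ] (λ m k → Pₙ m · F (i + m) k) ≈⟨ Σ-cong K (λ m k _ → term m k) ⟩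
      Σ[ K ] (λ m k → q^ (i * i) · (q^ (m * (m + (i + i))) · (PP m (m + (i + i)) · Pₙ k))) ≈⟨ Σ-·ˡ K (q^ (i * i)) _ ⟩
      q^ (i * i) · Σ[ K ] (λ m k → q^ (m * (m + (i + i))) · (PP m (m + (i + i)) · Pₙ k)) ≈⟨ ·-cong ≈-refl (q-vandermonde K (i + i)) ⟩
      q^ (i * i) · PP K (K + (i + i)) ≈⟨ ·-cong ≈-refl (·-cong (≡⇒≈ (sym (P∸-≤ M i i≤M))) (≡⇒≈ (cong Pₙ (trans (sym (+-assoc K i i)) (cong (_+ i) (m∸n+n≡m i≤M)))))) ⟩
      q^ (i * i) · (P∸ M i · Pₙ (M + i)) ∎
      where
      open ≈R
      K = M ∸ i
      F : ℕ → ℕ → Ser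
      F n k = q^ (n * n) · (Pₙ k · Pₙ (n + i))
      i+m+i : ∀ i m → i + m + i ≡ m + (i + i)
      i+m+i = solve-∀
      term : ∀ m k → Pₙ m · F (i + m) k ≈ q^ (i * i) · (q^ (m * (m + (i + i))) · (PP m (m + (i + i)) · Pₙ k))
      term m k = ≈-trans (·-cong ≈-refl (·-cong (≈-trans (q^-≡ (square-+ i m)) (≈-sym (q^-* (i * i) _))) (·-cong ≈-refl (≡⇒≈ (cong Pₙ (i+m+i i m))))))
        (solve 5 (λ p a b k d → p :* (a :* b :* (k :* d)) := a :* (b :* (p :* d :* k))) ≈-refl (Pₙ m) _ _ (Pₙ k) _)

    finite : ∀ M → Σ[ M ] (λ n k → q^ (n * n) · (Pₙ k · β n)) ≈ ∑ˢ (range M) (λ r → α r · (q^ (∣ r ∣ * ∣ r ∣) · (P∸ M ∣ r ∣ · Pₙ (M + ∣ r ∣))))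
    finite M = begin
      Σ[ M ] (λ n k → q^ (n * n) · (Pₙ k · β n))
        ≈⟨ Σ-cong M (λ n k n+k≡M → ≈-trans (·-cong ≈-refl (·-cong ≈-refl (β-expansion M (≤-trans (m≤m+n n k) (≤-reflexive n+k≡M))))) (≈-trans (≈-sym (·-assoc _ _ _)) (≈-sym (∑ˢ-·ˡ (range M) _ _)))) ⟩
      Σ[ M ] (λ n k → ∑ˢ (range M) (λ r → q^ (n * n) · Pₙ k · (α r · (P∸ n ∣ r ∣ · Pₙ (n + ∣ r ∣))))) ≈⟨ Σ-∑ˢ M (range M) _ ⟩
      ∑ˢ (range M) (λ r → Σ[ M ] (λ n k → q^ (n * n) · Pₙ k · (α r · (P∸ n ∣ r ∣ · Pₙ (n + ∣ r ∣)))))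
        ≈⟨ ∑ˢ-cong (range M) (λ {r} r∈ → ≈-trans (Σ-cong M (λ n k _ → solve 5 (λ a k α d s → a :* k :* (α :* (d :* s)) := α :* (d :* (a :* (k :* s)))) ≈-refl (q^ (n * n)) (Pₙ k) (α r) (P∸ n ∣ r ∣) (Pₙ (n + ∣ r ∣)))) (≈-trans (Σ-·ˡ M (α r) _) (·-cong ≈-refl (inner M ∣ r ∣ (range-bound M r∈))))) ⟩
      ∑ˢ (range M) (λ r → α r · (q^ (∣ r ∣ * ∣ r ∣) · (P∸ M ∣ r ∣ · Pₙ (M + ∣ r ∣)))) ∎
      where open ≈R

    n≤n*n : ∀ n → n ≤ n * n
    n≤n*n zero = z≤n
    n≤n*n (suc n) = m≤m*n (suc n) (suc n)

    q^-Pₙ : ∀ a {N M} k → N ≤ a + k → k ≤ M → q^ a · Pₙ M ≈[ N ] q^ a · P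
    q^-Pₙ a {N} {M} k N≤ k≤M = ≈[]-weaken N≤ (q^·-cong[] a (≈[]-sym (≈[]-weaken k≤M (P≈Pₙ M))))

    -- Modulo q^(M+1) the truncated 1/(q)_k with k = M - n can be replaced by P, because it is
    -- multiplied by q^(n²) and n² + k ≥ n + k = M. The same estimate with |r| in place of n serves
    -- in `rhs`.
    lhs : ∀ M → Σ[ M ] (λ n k → q^ (n * n) · (Pₙ k · β n)) ≈[ M ] P · Σ[ M ] (λ n _ → q^ (n * n) · β n)
    lhs M = ≈[]-trans (Σ-cong[] M (λ n k n+k≡M → ≈[]-trans (≈⇒≈[] (≈-sym (·-assoc _ _ _)))
        (≈[]-trans (·-cong[] (q^-Pₙ (n * n) {M} {k} k (≤-trans (≤-reflexive (sym n+k≡M)) (+-monoˡ-≤ k (n≤n*n n))) ≤-refl) ≈[]-refl)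
          (≈⇒≈[] (solve 3 (λ a p b → a :* p :* b := p :* (a :* b)) ≈-refl _ P (β n))))))
      (≈⇒≈[] (Σ-·ˡ M P _))

    rhs : ∀ M → ∑ˢ (range M) (λ r → α r · (q^ (∣ r ∣ * ∣ r ∣) · (P∸ M ∣ r ∣ · Pₙ (M + ∣ r ∣)))) ≈[ M ] (P · P) · ∑ˢ (range M) (λ r → α r · q^ (∣ r ∣ * ∣ r ∣))
    rhs M = ≈[]-trans (∑ˢ-cong[] (range M) (λ {r} r∈ → term r (range-bound M r∈))) (≈⇒≈[] (∑ˢ-·ˡ (range M) (P · P) _))
      where
      term : ∀ r → ∣ r ∣ ≤ M → α r · (q^ (∣ r ∣ * ∣ r ∣) · (P∸ M ∣ r ∣ · Pₙ (M + ∣ r ∣))) ≈[ M ] (P · P) · (α r · q^ (∣ r ∣ * ∣ r ∣))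
      term r r≤M = ≈[]-trans (≈⇒≈[] (·-cong ≈-refl (≈-trans (≈-sym (·-assoc _ _ _)) (·-cong (·-cong ≈-refl (≡⇒≈ (P∸-≤ M ∣ r ∣ r≤M))) ≈-refl))))
        (≈[]-trans (·-cong[] ≈[]-refl (·-cong[] (q^-Pₙ (∣ r ∣ * ∣ r ∣) (M ∸ ∣ r ∣) (≤-trans (≤-reflexive (sym (m+[n∸m]≡n r≤M))) (+-monoˡ-≤ (M ∸ ∣ r ∣) (n≤n*n ∣ r ∣))) ≤-refl)
            (≈[]-sym (≈[]-weaken (m≤m+n M ∣ r ∣) (P≈Pₙ (M + ∣ r ∣))))))
          (≈⇒≈[] (solve 3 (λ a x p → a :* (x :* p :* p) := p :* p :* (a :* x)) ≈-refl (α r) _ P)))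

  bailey-limit : ∀ M → Σ[ M ] (λ n _ → q^ (n * n) · β n) ≈[ M ] P · ∑ˢ (range M) (λ r → α r · q^ (∣ r ∣ * ∣ r ∣))
  bailey-limit M = ≈[]-trans (≈⇒≈[] (≈-sym (undo _))) (≈[]-trans (·-cong[] ≈[]-refl (≈[]-trans (≈[]-sym (lhs M)) (≈[]-trans (≈⇒≈[] (finite M)) (rhs M))))
    (≈⇒≈[] (≈-trans (·-cong ≈-refl (·-assoc _ _ _)) (undo _))))
    where
    undo : ∀ f → E · (P · f) ≈ f
    undo f = ≈-trans (≈-sym (·-assoc E P f)) (≈-trans (·-cong E·P ≈-refl) (·-identityˡ f))

  -- If α_r is divisible by q^{|r|} then letting n → ∞ in the pair itself gives 1 = P Σ α_r.
  pair-limit : (∀ M r f g → ∣ r ∣ ≤ M → f ≈[ M ∸ ∣ r ∣ ] g → α r · f ≈[ M ] α r · g) →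
    ∀ M → β M ≈[ M ] P · P · ∑ˢ (range M) α
  pair-limit div M = ≈[]-trans (≈⇒≈[] (β-expansion M ≤-refl)) (≈[]-trans (∑ˢ-cong[] (range M) (λ {r} r∈ → term r (range-bound M r∈)))
      (≈⇒≈[] (∑ˢ-·ˡ (range M) (P · P) α)))
    where
    term : ∀ r → ∣ r ∣ ≤ M → α r · (P∸ M ∣ r ∣ · Pₙ (M + ∣ r ∣)) ≈[ M ] P · P · α r
    term r r≤M = ≈[]-trans (≈⇒≈[] (·-cong ≈-refl (·-cong (≡⇒≈ (P∸-≤ M ∣ r ∣ r≤M)) ≈-refl)))
      (≈[]-trans (div M r _ _ r≤M (·-cong[] (≈[]-sym (P≈Pₙ (M ∸ ∣ r ∣))) (≈[]-sym (≈[]-weaken (≤-trans (m∸n≤m M ∣ r ∣) (m≤m+n M ∣ r ∣)) (P≈Pₙ (M + ∣ r ∣))))))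
        (≈⇒≈[] (·-comm (α r) (P · P))))

-- Generating functions of weighted sets

≡ᵇ-true : ∀ {m n} → (m ≡ᵇ n) ≡ true → m ≡ n
≡ᵇ-true {m} {n} e = ≡ᵇ⇒≡ m n (subst T (sym e) tt)

true-≡ᵇ : ∀ {m n} → m ≡ n → (m ≡ᵇ n) ≡ true
true-≡ᵇ {zero} refl = refl
true-≡ᵇ {suc m} refl = true-≡ᵇ {m} refl

module _ {A : Set} (_≟_ : DecidableEquality A) where

  -- The colour h is flipped by σ. Hence σ has no fixed point where f is true, and it exchanges the
  -- terms with h true and those with h false, whose sums are therefore equal and cancel.
  ∑-involution : ∀ {xs} (f h : A → Bool) (σ : A → A) → Unique xs →
    (∀ {x} → x ∈ xs → f x ≡ true → σ x ∈ xs × f (σ x) ≡ true × σ (σ x) ≡ x × h (σ x) ≡ not (h x)) →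
    ∑ xs f ≡ false
  ∑-involution {xs} f h σ u inv = begin
    ∑ xs f ≡⟨ ∑-cong xs (λ {x} _ → split (f x) (h x)) ⟩
    ∑ xs (λ x → (f x ∧ h x) xor (f x ∧ not (h x))) ≡⟨ ∑-xor xs _ _ ⟩
    ∑ xs (λ x → f x ∧ h x) xor ∑ xs (λ x → f x ∧ not (h x)) ≡⟨ cong (_xor ∑ xs (λ x → f x ∧ not (h x))) matched ⟩
    ∑ xs (λ x → f x ∧ not (h x)) xor ∑ xs (λ x → f x ∧ not (h x)) ≡⟨ xor-same (∑ xs (λ x → f x ∧ not (h x))) ⟩
    false ∎
    where
    open ≡-Reasoning
    split : ∀ a b → a ≡ (a ∧ b) xor (a ∧ not b)
    split true true = refl
    split true false = refl
    split false b = refl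
    matched : ∑ xs (λ x → f x ∧ h x) ≡ ∑ xs (λ x → f x ∧ not (h x))
    matched = ∑-bijection _≟_ _ _ σ σ u u
      (λ {x} x∈ e → let fx , hx = ∧-true {f x} e ; σ∈ , fσ , σσ , hσ = inv x∈ fx in
        σ∈ , cong₂ _∧_ fσ (trans (cong not (trans hσ (cong not hx))) refl) , σσ)
      (λ {x} x∈ e → let fx , hx = ∧-true {f x} e ; σ∈ , fσ , σσ , hσ = inv x∈ fx in
        σ∈ , cong₂ _∧_ fσ (trans hσ hx) , σσ)

-- A set with finitely many elements of each weight. `upto n` only has to contain everything of
-- weight at most n: repetitions are removed in `support`, and heavier elements are discarded when
-- `θ` compares weights. This keeps the completeness proofs to crude bounds.
record Weighted (A : Set) : Set where
  field
    wt : A → ℕ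
    decEq : DecidableEquality A
    upto : ℕ → List A
    complete : ∀ {n} x → wt x ≤ n → x ∈ upto n

  support : ℕ → List A
  support n = deduplicate decEq (upto n)

  support-unique : ∀ n → Unique (support n)
  support-unique n = deduplicate-! decEq (upto n)

  support-complete : ∀ {n} x → wt x ≤ n → x ∈ support n
  support-complete x p = ∈-deduplicate⁺ decEq (complete x p)

open Weighted

module _ {A : Set} where

  -- Σ_x q^{wt x}
  θ : Weighted A → Ser
  coeff (θ w) n = ∑ (support w n) (λ x → wt w x ≡ᵇ n)

  θ-coeff : ∀ (w : Weighted A) n xs → Unique xs → (∀ x → wt w x ≡ n → x ∈ xs) → coeff (θ w) n ≡ ∑ xs (λ x → wt w x ≡ᵇ n)
  θ-coeff w n xs u c = ∑-bijection (decEq w) _ _ id id (support-unique w n) u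
    (λ {x} _ e → c x (≡ᵇ-true e) , e , refl)
    (λ {x} _ e → support-complete w x (≤-reflexive (≡ᵇ-true e)) , e , refl)

  θ-none : ∀ (w : Weighted A) n → (∀ x → wt w x ≢ n) → coeff (θ w) n ≡ false
  θ-none w n h = ∑-false (support w n) (λ {x} _ → false-unless (h x) ≡ᵇ-true)

  θ-one : ∀ (w : Weighted A) n x → wt w x ≡ n → (∀ y → wt w y ≡ n → y ≡ x) → coeff (θ w) n ≡ true
  θ-one w n x e h = trans (∑-unique _ (support-unique w n) (support-complete w x (≤-reflexive e)) (λ {y} _ ey → h y (≡ᵇ-true ey))) (true-≡ᵇ e)

  affine : ∀ k .{{_ : NonZero k}} → ℕ → Weighted A → Weighted A
  affine k c w = record
    { wt = λ x → k * wt w x + c ; decEq = decEq w ; upto = upto w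
    ; complete = λ x p → complete w x (≤-trans (≤-trans (m≤n*m (wt w x) k) (m≤m+n _ c)) p) }

  θ-vanish : ∀ (w : Weighted A) (h : A → Bool) (σ : A → A) → (∀ x → wt w (σ x) ≡ wt w x) → (∀ x → σ (σ x) ≡ x) →
    (∀ x → h (σ x) ≡ not (h x)) → θ w ≈ 𝟘
  θ-vanish w h σ σ-wt σσ hσ = pointwise (λ n → ∑-involution (decEq w) _ h σ (support-unique w n)
    (λ {x} _ e → support-complete w (σ x) (≤-reflexive (trans (σ-wt x) (≡ᵇ-true e))) , true-≡ᵇ (trans (σ-wt x) (≡ᵇ-true e)) , σσ x , hσ x))

module _ {A B : Set} where

  θ-match : ∀ (w : Weighted A) (w′ : Weighted B) n m (φ : A → B) (ψ : B → A) →
    (∀ x → wt w x ≡ n → wt w′ (φ x) ≡ m × ψ (φ x) ≡ x) →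
    (∀ y → wt w′ y ≡ m → wt w (ψ y) ≡ n × φ (ψ y) ≡ y) →
    coeff (θ w) n ≡ coeff (θ w′) m
  θ-match w w′ n m φ ψ to from = ∑-bijection (decEq w′) _ _ φ ψ (support-unique w n) (support-unique w′ m)
    (λ {x} _ e → let p , q = to x (≡ᵇ-true e) in support-complete w′ (φ x) (≤-reflexive p) , true-≡ᵇ p , q)
    (λ {y} _ e → let p , q = from y (≡ᵇ-true e) in support-complete w (ψ y) (≤-reflexive p) , true-≡ᵇ p , q)

  θ-bijection : ∀ (w : Weighted A) (w′ : Weighted B) (φ : A → B) (ψ : B → A) →
    (∀ x → ψ (φ x) ≡ x) → (∀ y → φ (ψ y) ≡ y) → (∀ x → wt w′ (φ x) ≡ wt w x) → θ w ≈ θ w′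
  θ-bijection w w′ φ ψ ψφ φψ e = pointwise (λ n → θ-match w w′ n n φ ψ
    (λ x p → trans (e x) p , ψφ x) (λ y p → trans (sym (e (ψ y))) (trans (cong (wt w′) (φψ y)) p) , φψ y))

  -- The map φ is only required to have a left inverse, so this restricts a weight to the image of φ
  -- in the coordinates of A. Arithmetic progressions and sublattices are selected in this way.
  pull : DecidableEquality A → (φ : A → B) (ψ : B → A) → (∀ x → ψ (φ x) ≡ x) → Weighted B → Weighted A
  pull _≟′_ φ ψ ψφ w = record
    { wt = wt w ∘ φ ; decEq = _≟′_ ; upto = λ n → map ψ (upto w n)
    ; complete = λ x p → subst (_∈ _) (ψφ x) (∈-map⁺ ψ (complete w (φ x) p)) }

  _⊎ʷ_ : Weighted A → Weighted B → Weighted (A ⊎ B)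
  w ⊎ʷ w′ = record
    { wt = [ wt w , wt w′ ]′ ; decEq = ⊎-≡-dec (decEq w) (decEq w′) ; upto = λ n → map inj₁ (upto w n) ++ map inj₂ (upto w′ n)
    ; complete = λ { (inj₁ x) p → ∈-++⁺ˡ (∈-map⁺ inj₁ (complete w x p)) ; (inj₂ y) p → ∈-++⁺ʳ _ (∈-map⁺ inj₂ (complete w′ y p)) } }

  _×ʷ_ : Weighted A → Weighted B → Weighted (A × B)
  w ×ʷ w′ = record
    { wt = λ (x , y) → wt w x + wt w′ y ; decEq = ×-≡-dec (decEq w) (decEq w′) ; upto = λ n → cartesianProduct (upto w n) (upto w′ n)
    ; complete = λ (x , y) p → ∈-cartesianProduct⁺ (complete w x (≤-trans (m≤m+n _ _) p)) (complete w′ y (≤-trans (m≤n+m _ _) p)) }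

  θ-⊎ : ∀ w w′ → θ (w ⊎ʷ w′) ≈ θ w ⊕ θ w′
  θ-⊎ w w′ = pointwise (λ n → trans (θ-coeff (w ⊎ʷ w′) n (map inj₁ (support w n) ++ map inj₂ (support w′ n))
      (++⁺ (map⁺ inj₁-injective (support-unique w n)) (map⁺ inj₂-injective (support-unique w′ n)) disjoint)
      (λ { (inj₁ x) p → ∈-++⁺ˡ (∈-map⁺ inj₁ (support-complete w x (≤-reflexive p)))
         ; (inj₂ y) p → ∈-++⁺ʳ _ (∈-map⁺ inj₂ (support-complete w′ y (≤-reflexive p))) }))
    (trans (∑-++ (map inj₁ (support w n)) _ _) (cong₂ _xor_ (∑-map inj₁ (support w n) _) (∑-map inj₂ (support w′ n) _))))
    where
    disjoint : ∀ {xs : List A} {ys : List B} {v} → ¬ (v ∈ map inj₁ xs × v ∈ map inj₂ ys)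
    disjoint (p , q) with ∈-map⁻ inj₁ p | ∈-map⁻ inj₂ q
    ... | _ , _ , refl | _ , _ , ()

antidiag-∑ : ∀ {A : Set} N xs (F : A → ℕ → ℕ → Bool) → antidiag N (λ a b → ∑ xs (λ x → F x a b)) ≡ ∑ xs (λ x → antidiag N (F x))
antidiag-∑ N [] F = antidiag-false N
antidiag-∑ N (x ∷ xs) F = trans (antidiag-xor N (F x) _) (cong (antidiag N (F x) xor_) (antidiag-∑ N xs F))

antidiag-δ : ∀ N m n → antidiag N (λ a b → (m ≡ᵇ a) ∧ (n ≡ᵇ b)) ≡ (m + n ≡ᵇ N)
antidiag-δ zero zero n = refl
antidiag-δ zero (suc m) n = refl
antidiag-δ (suc N) zero n = trans (cong ((n ≡ᵇ suc N) xor_) (antidiag-false N)) (xor-identityʳ _)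
antidiag-δ (suc N) (suc m) n = antidiag-δ N m n

θ-× : ∀ {A B : Set} (w : Weighted A) (w′ : Weighted B) → θ w · θ w′ ≈ θ (w ×ʷ w′)
θ-× w w′ = pointwise go
  where
  open ≡-Reasoning
  go : ∀ N → coeff (θ w · θ w′) N ≡ coeff (θ (w ×ʷ w′)) N
  go N = begin
    antidiag N (λ a b → coeff (θ w) a ∧ coeff (θ w′) b)
      ≡⟨ antidiag-cong N (λ a b e → cong₂ _∧_
           (θ-coeff w a xs (support-unique w N) (λ x p → support-complete w x (≤-trans (≤-reflexive p) (≤-trans (m≤m+n a b) (≤-reflexive e)))))
           (θ-coeff w′ b ys (support-unique w′ N) (λ y p → support-complete w′ y (≤-trans (≤-reflexive p) (≤-trans (m≤n+m b a) (≤-reflexive e)))))) ⟩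
    antidiag N (λ a b → ∑ xs (λ x → wt w x ≡ᵇ a) ∧ ∑ ys (λ y → wt w′ y ≡ᵇ b))
      ≡⟨ antidiag-cong N (λ a b _ → trans (sym (∑-∧ʳ xs _ _)) (∑-cong xs (λ _ → sym (∑-∧ˡ ys _ _)))) ⟩
    antidiag N (λ a b → ∑ xs (λ x → ∑ ys (λ y → (wt w x ≡ᵇ a) ∧ (wt w′ y ≡ᵇ b)))) ≡⟨ antidiag-∑ N xs (λ x a b → ∑ ys (λ y → (wt w x ≡ᵇ a) ∧ (wt w′ y ≡ᵇ b))) ⟩
    ∑ xs (λ x → antidiag N (λ a b → ∑ ys (λ y → (wt w x ≡ᵇ a) ∧ (wt w′ y ≡ᵇ b))))
      ≡⟨ ∑-cong xs (λ {x} _ → trans (antidiag-∑ N ys (λ y a b → (wt w x ≡ᵇ a) ∧ (wt w′ y ≡ᵇ b))) (∑-cong ys (λ {y} _ → antidiag-δ N (wt w x) (wt w′ y)))) ⟩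
    ∑ xs (λ x → ∑ ys (λ y → wt w x + wt w′ y ≡ᵇ N)) ≡⟨ sym (∑-cartesianProduct xs ys _) ⟩
    ∑ (cartesianProduct xs ys) (λ p → wt (w ×ʷ w′) p ≡ᵇ N)
      ≡⟨ sym (θ-coeff (w ×ʷ w′) N (cartesianProduct xs ys) (cartesianProduct⁺ (support-unique w N) (support-unique w′ N))
           (λ (x , y) p → ∈-cartesianProduct⁺ (support-complete w x (≤-trans (m≤m+n _ _) (≤-reflexive p))) (support-complete w′ y (≤-trans (m≤n+m _ _) (≤-reflexive p))))) ⟩
    coeff (θ (w ×ʷ w′)) N ∎
    where
    xs = support w N
    ys = support w′ N

θ-affine : ∀ {A : Set} k .{{_ : NonZero k}} c (w : Weighted A) n → coeff (θ (affine k c w)) (k * n + c) ≡ coeff (θ w) n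
θ-affine k c w n = θ-match (affine k c w) w (k * n + c) n id id
  (λ x p → *-cancelˡ-≡ _ _ k (+-cancelʳ-≡ c _ _ p) , refl) (λ x p → cong (λ z → k * z + c) p , refl)

-- Quadratic exponents are compared as 8n + 1 or 4n + 1, where the squares are complete; this
-- removes the scaling afterwards.
θ-affine-injective : ∀ {A B : Set} k .{{_ : NonZero k}} c {w : Weighted A} {w′ : Weighted B} → θ (affine k c w) ≈ θ (affine k c w′) → θ w ≈ θ w′
θ-affine-injective k c {w} {w′} h = pointwise (λ n → trans (sym (θ-affine k c w n)) (trans (at h (k * n + c)) (θ-affine k c w′ n)))

-- Division with remainder in ℤ

quotient-unique : ∀ k {r s} x y → r < k → s < k → + k ℤ.* x ℤ.+ + r ≡ + k ℤ.* y ℤ.+ + s → x ≡ y × r ≡ s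
quotient-unique k {r} {s} x y r<k s<k e = sym y≡x , ℤₚ.+-injective (+ℤ-cancelˡ (+ k ℤ.* x) _ _ (trans e (cong (λ z → + k ℤ.* z ℤ.+ + s) y≡x)))
  where
  open ≡-Reasoning
  shuffle : ∀ k x y r → r ≡ (k ℤ.* x ℤ.+ r) ℤ.- k ℤ.* y ℤ.+ k ℤ.* (y ℤ.- x)
  shuffle = ℤ-solve-∀
  shuffle′ : ∀ k x y r s → k ℤ.* x ℤ.+ r ≡ k ℤ.* y ℤ.+ s → r ℤ.- s ≡ k ℤ.* (y ℤ.- x)
  shuffle′ k x y r s e = trans (cong (ℤ._- s) (shuffle k x y r)) (trans (cong (λ z → z ℤ.- k ℤ.* y ℤ.+ k ℤ.* (y ℤ.- x) ℤ.- s) e) (last k x y s))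
    where
    last : ∀ k x y s → (k ℤ.* y ℤ.+ s) ℤ.- k ℤ.* y ℤ.+ k ℤ.* (y ℤ.- x) ℤ.- s ≡ k ℤ.* (y ℤ.- x)
    last = ℤ-solve-∀
  small : k * ∣ y ℤ.- x ∣ < k
  small = ≤-<-trans (≤-reflexive (trans (sym (ℤₚ.abs-* (+ k) (y ℤ.- x))) (cong ∣_∣ (trans (sym (shuffle′ (+ k) x y (+ r) (+ s) e)) (ℤₚ.[+m]-[+n]≡m⊖n r s)))))
    (≤-<-trans (ℤₚ.∣m⊝n∣≤m⊔n r s) (⊔-pres-<m r<k s<k))
  zero-abs : ∀ n → k * n < k → n ≡ 0
  zero-abs zero _ = refl
  zero-abs (suc n) p = contradiction p (≤⇒≯ (m≤m*n k (suc n)))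
  y≡x : y ≡ x
  y≡x = ℤₚ.i-j≡0⇒i≡j y x (ℤₚ.∣i∣≡0⇒i≡0 (zero-abs _ small))

div-eq : ∀ k .{{_ : NonZero k}} x → x ≡ + k ℤ.* (x /ℕ k) ℤ.+ + (x %ℕ k)
div-eq k x = trans (a≡a%ℕn+[a/ℕn]*n x k) (trans (ℤₚ.+-comm (+ (x %ℕ k)) (x /ℕ k ℤ.* + k)) (cong (λ z → z ℤ.+ + (x %ℕ k)) (ℤₚ.*-comm (x /ℕ k) (+ k))))

/ℕ-unique : ∀ k .{{_ : NonZero k}} {x} y {r} → r < k → x ≡ + k ℤ.* y ℤ.+ + r → x /ℕ k ≡ y
/ℕ-unique k {x} y r<k e = proj₁ (quotient-unique k _ y (n%ℕd<d x k) r<k (trans (sym (div-eq k x)) e))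

-- The pentagonal number theorem

double-pent : ∀ j → + 2 ℤ.* + pent j ≡ j ℤ.* (+ 3 ℤ.* j ℤ.+ + 1)
double-pent (+ zero) = refl
double-pent (+ suc n) = trans (cong (λ z → + 2 ℤ.* z) (pent-suc (+ n))) (trans (ℤₚ.*-distribˡ-+ (+ 2) (+ pent (+ n)) _)
  (trans (cong (λ z → z ℤ.+ + 2 ℤ.* (+ 3 ℤ.* + n ℤ.+ + 2)) (double-pent (+ n))) (identity (+ n))))
  where
  identity : ∀ n → n ℤ.* (+ 3 ℤ.* n ℤ.+ + 1) ℤ.+ + 2 ℤ.* (+ 3 ℤ.* n ℤ.+ + 2) ≡ (+ 1 ℤ.+ n) ℤ.* (+ 3 ℤ.* (+ 1 ℤ.+ n) ℤ.+ + 1)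
  identity = ℤ-solve-∀
double-pent -[1+ zero ] = refl
double-pent -[1+ suc n ] = trans (trans (expand (+ pent -[1+ suc n ]) (+ n))
    (cong (λ z → + 2 ℤ.* z ℤ.- + 2 ℤ.* (+ 3 ℤ.* ℤ.- (+ 2 ℤ.+ + n) ℤ.+ + 2)) (sym (pent-suc -[1+ suc n ]))))
  (trans (cong (λ z → z ℤ.- + 2 ℤ.* (+ 3 ℤ.* ℤ.- (+ 2 ℤ.+ + n) ℤ.+ + 2)) (double-pent -[1+ n ])) (identity (+ n)))
  where
  expand : ∀ p n → + 2 ℤ.* p ≡ + 2 ℤ.* (p ℤ.+ (+ 3 ℤ.* ℤ.- (+ 2 ℤ.+ n) ℤ.+ + 2)) ℤ.- + 2 ℤ.* (+ 3 ℤ.* ℤ.- (+ 2 ℤ.+ n) ℤ.+ + 2)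
  expand = ℤ-solve-∀
  identity : ∀ n → ℤ.- (+ 1 ℤ.+ n) ℤ.* (+ 3 ℤ.* ℤ.- (+ 1 ℤ.+ n) ℤ.+ + 1) ℤ.- + 2 ℤ.* (+ 3 ℤ.* ℤ.- (+ 2 ℤ.+ n) ℤ.+ + 2) ≡ ℤ.- (+ 2 ℤ.+ n) ℤ.* (+ 3 ℤ.* ℤ.- (+ 2 ℤ.+ n) ℤ.+ + 1)
  identity = ℤ-solve-∀

∣j∣≤pent : ∀ j → ∣ j ∣ ≤ pent j
∣j∣≤pent (+ zero) = z≤n
∣j∣≤pent (+ suc n) = ≤-trans (≤-reflexive (+-comm 1 n)) (+-mono-≤ (∣j∣≤pent (+ n)) (≤-trans (s≤s z≤n) (m≤n+m 2 (3 * n))))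
∣j∣≤pent -[1+ zero ] = ≤-refl
∣j∣≤pent -[1+ suc n ] = ≤-trans (≤-reflexive (+-comm 1 (suc n))) (+-mono-≤ (∣j∣≤pent -[1+ n ]) (≤-trans (s≤s z≤n) (m≤n+m 4 (3 * n))))

pentagonal : Weighted ℤ
pentagonal = record { wt = pent ; decEq = ℤₚ._≟_ ; upto = range ; complete = λ {n} j p → range-complete n j (≤-trans (∣j∣≤pent j) p) }

remainder : Residue → ℕ
remainder r0 = 0
remainder r1 = 1
remainder r2 = 2

remainder<3 : ∀ r → remainder r < 3
remainder<3 r0 = s≤s z≤n
remainder<3 r1 = s≤s (s≤s z≤n)
remainder<3 r2 = s≤s (s≤s (s≤s z≤n))

remainder-injective : ∀ {r s} → remainder r ≡ remainder s → r ≡ s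
remainder-injective {r0} {r0} _ = refl
remainder-injective {r1} {r1} _ = refl
remainder-injective {r2} {r2} _ = refl

value-eq : ∀ x → value x ≡ + 3 ℤ.* proj₁ x ℤ.+ + remainder (proj₂ x)
value-eq (j , r0) = sym (ℤₚ.+-identityʳ _)
value-eq (j , r1) = refl
value-eq (j , r2) = refl

value-injective : ∀ {x y} → value x ≡ value y → x ≡ y
value-injective {x@(j , r)} {y@(k , s)} e with quotient-unique 3 j k (remainder<3 r) (remainder<3 s) (trans (sym (value-eq x)) (trans e (value-eq y)))
... | refl , r≡s = cong (j ,_) (remainder-injective r≡s)

value-doubleClass : ∀ r → value (doubleClass r) ≡ + 2 ℤ.* r
value-doubleClass (+ i) = trans (sym (ℤₚ.+-identityˡ _)) (trans (value-class 0 (i + i)) (trans (cong +_ (two i)) (ℤₚ.pos-* 2 i)))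
  where
  two : ∀ i → i + i ≡ 2 * i
  two = solve-∀
value-doubleClass -[1+ i ] = trans (isolate (+ suc i) _) (trans (cong (λ z → z ℤ.- + suc i ℤ.- + suc i) (value-class (suc i + suc i) 0)) (twice (+ suc i)))
  where
  isolate : ∀ a v → v ≡ (a ℤ.+ a) ℤ.+ v ℤ.- a ℤ.- a
  isolate = ℤ-solve-∀
  twice : ∀ a → + 0 ℤ.- a ℤ.- a ≡ + 2 ℤ.* ℤ.- a
  twice = ℤ-solve-∀

doubleClass-unique : ∀ r x → value x ≡ + 2 ℤ.* r → doubleClass r ≡ x
doubleClass-unique r x e = value-injective (trans (value-doubleClass r) (sym e))

2pent-abs : ∀ j → 2 * pent j ≡ ∣ j ∣ * ∣ + 3 ℤ.* j ℤ.+ + 1 ∣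
2pent-abs j = trans (sym (ℤₚ.abs-* (+ 2) (+ pent j))) (trans (cong ∣_∣ (double-pent j)) (ℤₚ.abs-* j _))

-- Twice the claim is |3j + 1| ≤ |j| |3j + 1|. It could fail only for j = 0, where 3j + 1 = 1 is not
-- of the form 2r. With `r≤pent₀` this shows that q^|r| divides α_r, as `pair-limit` demands.
r≤pent₁ : ∀ j r → + 3 ℤ.* j ℤ.+ + 1 ≡ + 2 ℤ.* r → ∣ r ∣ ≤ pent j
r≤pent₁ j r e = *-cancelˡ-≤ 2 (go j refl)
  where
  2r : ∣ + 3 ℤ.* j ℤ.+ + 1 ∣ ≡ 2 * ∣ r ∣
  2r = trans (cong ∣_∣ e) (ℤₚ.abs-* (+ 2) r)
  go : ∀ i → i ≡ j → 2 * ∣ r ∣ ≤ 2 * pent j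
  go (+ zero) refl = contradiction (sym 2r) (even≢odd ∣ r ∣ 0)
  go (+ suc n) refl = ≤-trans (≤-reflexive (sym 2r)) (≤-trans (m≤n*m _ (suc n)) (≤-reflexive (sym (2pent-abs j))))
  go -[1+ n ] refl = ≤-trans (≤-reflexive (sym 2r)) (≤-trans (m≤n*m _ (suc n)) (≤-reflexive (sym (2pent-abs j))))

r≤pent₀ : ∀ j r → + 3 ℤ.* j ≡ + 2 ℤ.* r → ∣ r ∣ ≤ pent j
r≤pent₀ j r e = *-cancelˡ-≤ 2 (go j refl)
  where
  2r : 3 * ∣ j ∣ ≡ 2 * ∣ r ∣
  2r = trans (sym (ℤₚ.abs-* (+ 3) j)) (trans (cong ∣_∣ e) (ℤₚ.abs-* (+ 2) r))
  large : ∀ i → i ≡ j → 3 ≤ ∣ + 3 ℤ.* j ℤ.+ + 1 ∣ → 2 * ∣ r ∣ ≤ 2 * pent j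
  large i refl p = ≤-trans (≤-reflexive (trans (sym 2r) (*-comm 3 ∣ j ∣))) (≤-trans (*-monoʳ-≤ ∣ j ∣ p) (≤-reflexive (sym (2pent-abs j))))
  go : ∀ i → i ≡ j → 2 * ∣ r ∣ ≤ 2 * pent j
  go (+ zero) refl = ≤-reflexive (sym 2r)
  go (+ suc n) refl = large j refl (≤-trans (≤-trans (s≤s (s≤s (s≤s z≤n))) (m≤m+n (3 + 3 * n) 1)) (≤-reflexive (cong (_+ 1) (sym (*-suc 3 n)))))
  -- For j = -1 the factor |3j + 1| = 2 is too small for the estimate in `large`, but then 3j = -3
  -- is odd and cannot equal 2r.
  go -[1+ zero ] refl = contradiction (sym 2r) (even≢odd ∣ r ∣ 1)
  go -[1+ suc n ] refl = large j refl (subst (λ z → 3 ≤ ∣ z ∣) (sym (trans (negate (+ n)) (cong (λ z → ℤ.- (z ℤ.+ + 5)) (sym (ℤₚ.pos-* 3 n)))))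
      (≤-trans (s≤s (s≤s (s≤s z≤n))) (≤-trans (m≤n+m 5 (3 * n)) (≤-reflexive (sym (ℤₚ.∣-i∣≡∣i∣ (+ (3 * n + 5))))))))
    where
    negate : ∀ n → + 3 ℤ.* ℤ.- (+ 2 ℤ.+ n) ℤ.+ + 1 ≡ ℤ.- (+ 3 ℤ.* n ℤ.+ + 5)
    negate = ℤ-solve-∀

module BW = Bailey W (λ n → Pₙ (n + n)) (λ n → bailey-pair-W (n + n))

W-divisible : ∀ M r f g → ∣ r ∣ ≤ M → f ≈[ M ∸ ∣ r ∣ ] g → BW.α r · f ≈[ M ] BW.α r · g
W-divisible M r f g r≤M h with doubleClass r | value-doubleClass r
... | (j , r0) | e = monomial (r≤pent₀ j r e)
  where
  monomial : ∀ {a} → ∣ r ∣ ≤ a → q^ a · f ≈[ M ] q^ a · g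
  monomial {a} p = ≈[]-weaken (≤-trans (≤-reflexive (sym (m+[n∸m]≡n r≤M))) (+-monoˡ-≤ (M ∸ ∣ r ∣) p)) (q^·-cong[] a h)
... | (j , r1) | e = monomial (r≤pent₁ j r e)
  where
  monomial : ∀ {a} → ∣ r ∣ ≤ a → q^ a · f ≈[ M ] q^ a · g
  monomial {a} p = ≈[]-weaken (≤-trans (≤-reflexive (sym (m+[n∸m]≡n r≤M))) (+-monoˡ-≤ (M ∸ ∣ r ∣) p)) (q^·-cong[] a h)
... | (j , r2) | _ = ≈⇒≈[] (≈-trans (·-zeroˡ f) (≈-sym (·-zeroˡ g)))

-- As n grows, the pair with β_n = 1/(q)_(2n) tends to P = P² Σ α_r; multiplication by E² and E P =
-- 1 leaves E = Σ α_r.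
E-expansion : ∀ M → E ≈[ M ] ∑ˢ (range M) BW.α
E-expansion M = ≈[]-trans (≈⇒≈[] (≈-sym (undo₁ E·P)))
  (≈[]-trans (·-cong[] {E · E} ≈[]-refl (≈[]-trans (≈[]-trans (P≈Pₙ M) (≈[]-sym (∏-≤ geom-unital (m≤m+n M M)))) (BW.pair-limit W-divisible M)))
    (≈⇒≈[] (undo₂ E·P)))
  where
  undo₁ : E · P ≈ 𝟙 → E · E · P ≈ E
  undo₁ h = ≈-trans (·-assoc E E P) (≈-trans (·-cong ≈-refl h) (·-identityʳ E))
  undo₂ : ∀ {f} → E · P ≈ 𝟙 → E · E · (P · P · f) ≈ f
  undo₂ {f} h = ≈-trans (solve 3 (λ e p f → e :* e :* (p :* p :* f) := (e :* p) :* ((e :* p) :* f)) ≈-refl E P f)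
    (≈-trans (·-cong h (·-cong h ≈-refl)) (≈-trans (·-identityˡ _) (·-identityˡ f)))

range-θ : ∀ {B : Set} (w : Weighted B) {M} N (f : ℤ → Bool) (φ : ℤ → B) (ψ : B → ℤ) →
  (∀ r → f r ≡ true → wt w (φ r) ≡ M × ψ (φ r) ≡ r) →
  (∀ y → wt w y ≡ M → ∣ ψ y ∣ ≤ N × f (ψ y) ≡ true × φ (ψ y) ≡ y) →
  ∑ (range N) f ≡ coeff (θ w) M
range-θ w {M} N f φ ψ to from = ∑-bijection (decEq w) f _ φ ψ (range-unique N) (support-unique w M)
  (λ {r} _ e → let p , q = to r e in support-complete w (φ r) (≤-reflexive p) , true-≡ᵇ p , q)
  (λ {y} _ e → let p , q , s = from y (≡ᵇ-true e) in range-complete N (ψ y) p , q , s)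

-- For every j exactly one of 3j and 3j + 1 is even. Its half is r = ⌊(3j + 1)/2⌋, and these r are
-- precisely the indices with α_r different from 0, so that `halve` reindexes the sum over r by j.
pentagonal-theorem : E ≈ θ pentagonal
pentagonal-theorem = pointwise (λ M → trans (at≤ (E-expansion M) ≤-refl) (range-θ pentagonal {M} M _ (proj₁ ∘ doubleClass) halve (to M) (from M)))
  where
  halve : ℤ → ℤ
  halve j = (+ 3 ℤ.* j ℤ.+ + 1) /ℕ 2
  to : ∀ M r → coeff (W (doubleClass r)) M ≡ true → pent (proj₁ (doubleClass r)) ≡ M × halve (proj₁ (doubleClass r)) ≡ r
  to M r e with doubleClass r | value-doubleClass r
  ... | (j , r0) | v = sym (≡ᵇ-true e) , /ℕ-unique 2 r {1} (s≤s (s≤s z≤n)) (cong (λ z → z ℤ.+ + 1) v)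
  ... | (j , r1) | v = sym (≡ᵇ-true e) , /ℕ-unique 2 r {0} (s≤s z≤n) (trans v (sym (ℤₚ.+-identityʳ _)))
  from : ∀ M j → pent j ≡ M → ∣ halve j ∣ ≤ M × coeff (W (doubleClass (halve j))) M ≡ true × proj₁ (doubleClass (halve j)) ≡ j
  from M j refl = go (remainder-cases ((+ 3 ℤ.* j ℤ.+ + 1) %ℕ 2) (n%ℕd<d (+ 3 ℤ.* j ℤ.+ + 1) 2) (div-eq 2 (+ 3 ℤ.* j ℤ.+ + 1)))
    where
    remainder-cases : ∀ s → s < 2 → + 3 ℤ.* j ℤ.+ + 1 ≡ + 2 ℤ.* halve j ℤ.+ + s →
      (+ 3 ℤ.* j ≡ + 2 ℤ.* halve j) ⊎ (+ 3 ℤ.* j ℤ.+ + 1 ≡ + 2 ℤ.* halve j)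
    remainder-cases 0 _ e = inj₂ (trans e (ℤₚ.+-identityʳ _))
    remainder-cases 1 _ e = inj₁ (trans (undo (+ 3 ℤ.* j)) (trans (cong (λ z → z ℤ.- + 1) e) (sym (undo (+ 2 ℤ.* halve j)))))
      where
      undo : ∀ x → x ≡ x ℤ.+ + 1 ℤ.- + 1
      undo = ℤ-solve-∀
    remainder-cases (suc (suc s)) (s≤s (s≤s ()))
    go : (+ 3 ℤ.* j ≡ + 2 ℤ.* halve j) ⊎ (+ 3 ℤ.* j ℤ.+ + 1 ≡ + 2 ℤ.* halve j) →
      ∣ halve j ∣ ≤ pent j × coeff (W (doubleClass (halve j))) (pent j) ≡ true × proj₁ (doubleClass (halve j)) ≡ j
    go (inj₁ e) = r≤pent₀ j (halve j) e , trans (cong (λ x → coeff (W x) (pent j)) (doubleClass-unique (halve j) (j , r0) e)) (true-≡ᵇ {pent j} refl) , cong proj₁ (doubleClass-unique (halve j) (j , r0) e)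
    go (inj₂ e) = r≤pent₁ j (halve j) e , trans (cong (λ x → coeff (W x) (pent j)) (doubleClass-unique (halve j) (j , r1) e)) (true-≡ᵇ {pent j} refl) , cong proj₁ (doubleClass-unique (halve j) (j , r1) e)

-- The two Rogers identities modulo 2

sq : ℤ → ℕ
sq x = ∣ x ∣ * ∣ x ∣

sq-ℤ : ∀ x → + sq x ≡ x ℤ.* x
sq-ℤ (+ n) = ℤₚ.pos-* n n
sq-ℤ -[1+ n ] = refl

∣x∣≤sq : ∀ x → ∣ x ∣ ≤ sq x
∣x∣≤sq x with ∣ x ∣
... | zero = z≤n
... | suc n = m≤m*n (suc n) (suc n)

heavier : ∀ {A : Set} (w : Weighted A) (v : A → ℕ) → Weighted A
heavier w v = record { wt = λ x → wt w x + v x ; decEq = decEq w ; upto = upto w ; complete = λ x p → complete w x (≤-trans (m≤m+n _ (v x)) p) }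

pent-even pent-odd : Weighted ℤ
pent-even = pull ℤₚ._≟_ (λ k → + 2 ℤ.* k) (_/ℕ 2) (λ k → /ℕ-unique 2 {+ 2 ℤ.* k} k {0} (s≤s z≤n) (sym (ℤₚ.+-identityʳ _))) pentagonal
pent-odd = pull ℤₚ._≟_ (λ k → + 2 ℤ.* k ℤ.+ + 1) (_/ℕ 2) (λ k → /ℕ-unique 2 k {1} (s≤s (s≤s z≤n)) refl) pentagonal

-- Exponents 15k²+k, 15k²+19k+6, 15k²+7k+1, 15k²+13k+3, in the form in which they leave the Bailey pairs
A₀ A₁ B₀ B₁ : Weighted ℤ
A₀ = heavier pent-even (λ k → sq (+ 3 ℤ.* k ℤ.+ + 0))
A₁ = heavier pent-odd (λ k → sq (+ 3 ℤ.* k ℤ.+ + 2))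
B₀ = heavier pent-even (λ k → sq (+ 3 ℤ.* k ℤ.+ + 1))
B₁ = heavier pent-odd (λ k → sq (+ 3 ℤ.* k ℤ.+ + 1))

doubleClass-0 : ∀ k → doubleClass (+ 3 ℤ.* k ℤ.+ + 0) ≡ (+ 2 ℤ.* k , r0)
doubleClass-0 k = doubleClass-unique _ _ (identity k)
  where
  identity : ∀ k → + 3 ℤ.* (+ 2 ℤ.* k) ≡ + 2 ℤ.* (+ 3 ℤ.* k ℤ.+ + 0)
  identity = ℤ-solve-∀

doubleClass-1 : ∀ k → doubleClass (+ 3 ℤ.* k ℤ.+ + 1) ≡ (+ 2 ℤ.* k , r2)
doubleClass-1 k = doubleClass-unique _ _ (identity k)
  where
  identity : ∀ k → + 3 ℤ.* (+ 2 ℤ.* k) ℤ.+ + 2 ≡ + 2 ℤ.* (+ 3 ℤ.* k ℤ.+ + 1)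
  identity = ℤ-solve-∀

doubleClass-2 : ∀ k → doubleClass (+ 3 ℤ.* k ℤ.+ + 2) ≡ (+ 2 ℤ.* k ℤ.+ + 1 , r1)
doubleClass-2 k = doubleClass-unique _ _ (identity k)
  where
  identity : ∀ k → + 3 ℤ.* (+ 2 ℤ.* k ℤ.+ + 1) ℤ.+ + 1 ≡ + 2 ℤ.* (+ 3 ℤ.* k ℤ.+ + 2)
  identity = ℤ-solve-∀

-- Only r = 3k + ρ contributes, with exponent ε k + r². Such an r lies in `range N` as soon as its
-- exponent is at most N, because |r| ≤ r²; hence the truncated sum agrees with the full theta
-- series up to q^N.
range-progression : ∀ (X : Class → Ser) ρ (ε : ℤ → ℕ) (w : Weighted ℤ) → ρ < 3 →
  (∀ k → wt w k ≡ ε k + sq (+ 3 ℤ.* k ℤ.+ + ρ)) →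
  (∀ k → X (doubleClass (+ 3 ℤ.* k ℤ.+ + ρ)) ≡ q^ (ε k)) →
  (∀ k σ → σ < 3 → σ ≢ ρ → X (doubleClass (+ 3 ℤ.* k ℤ.+ + σ)) ≡ 𝟘) →
  ∀ N → ∑ˢ (range N) (λ r → X (doubleClass r) · q^ (sq r)) ≈[ N ] θ w
range-progression X ρ ε w ρ<3 w≡ on off N = pointwise≤ (λ {M} M≤N → range-θ w N _ (_/ℕ 3) (λ k → + 3 ℤ.* k ℤ.+ + ρ) (to M) (from M≤N))
  where
  on-coeff : ∀ k M → coeff (X (doubleClass (+ 3 ℤ.* k ℤ.+ + ρ)) · q^ (sq (+ 3 ℤ.* k ℤ.+ + ρ))) M ≡ (M ≡ᵇ wt w k)
  on-coeff k M = trans (at (≈-trans (·-cong (≡⇒≈ (on k)) ≈-refl) (q^-* (ε k) _)) M) (cong (M ≡ᵇ_) (sym (w≡ k)))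
  to : ∀ M r → coeff (X (doubleClass r) · q^ (sq r)) M ≡ true → wt w (r /ℕ 3) ≡ M × + 3 ℤ.* (r /ℕ 3) ℤ.+ + ρ ≡ r
  to M r e with (r %ℕ 3) ≟ ρ | div-eq 3 r
  ... | yes refl | r≡ = sym (≡ᵇ-true (trans (sym (on-coeff (r /ℕ 3) M)) (subst (λ r → coeff (X (doubleClass r) · q^ (sq r)) M ≡ true) r≡ e))) , sym r≡
  ... | no ≢ρ | r≡ with trans (sym e) (trans (cong (λ s → coeff (X (doubleClass s) · q^ (sq r)) M) r≡)
          (at (≈-trans (·-cong (≡⇒≈ (off (r /ℕ 3) (r %ℕ 3) (n%ℕd<d r 3) ≢ρ)) (≈-refl {q^ (sq r)})) (·-zeroˡ (q^ (sq r)))) M))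
  ...   | ()
  from : ∀ {M} → M ≤ N → ∀ k → wt w k ≡ M → ∣ + 3 ℤ.* k ℤ.+ + ρ ∣ ≤ N ×
    coeff (X (doubleClass (+ 3 ℤ.* k ℤ.+ + ρ)) · q^ (sq (+ 3 ℤ.* k ℤ.+ + ρ))) M ≡ true × (+ 3 ℤ.* k ℤ.+ + ρ) /ℕ 3 ≡ k
  from {M} M≤N k e = ≤-trans (∣x∣≤sq (+ 3 ℤ.* k ℤ.+ + ρ)) (≤-trans (≤-trans (m≤n+m _ (ε k)) (≤-reflexive (trans (sym (w≡ k)) e))) M≤N) ,
    trans (on-coeff k M) (true-≡ᵇ (sym e)) , /ℕ-unique 3 k ρ<3 refl

W₀ W₁ V₀ V₁ : Class → Ser
W₀ (j , r0) = q^ (pent j)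
W₀ (j , r1) = 𝟘
W₀ (j , r2) = 𝟘
W₁ (j , r0) = 𝟘
W₁ (j , r1) = q^ (pent j)
W₁ (j , r2) = 𝟘
V₀ (j , r0) = 𝟘
V₀ (j , r1) = 𝟘
V₀ (j , r2) = q^ (pent j)
V₁ (j , r0) = 𝟘
V₁ (j , r1) = 𝟘
-- Written as j + 1 and not as `ℤ.suc j`, so that at j = 2k the exponent is literally the weight of
-- k in `pent-odd`.
V₁ (j , r2) = q^ (pent (j ℤ.+ + 1))

W-split : ∀ x → W x ≈ W₀ x ⊕ W₁ x
W-split (j , r0) = ≈-sym (⊕-identityʳ _)
W-split (j , r1) = pointwise (λ _ → refl)
W-split (j , r2) = pointwise (λ _ → refl)

V-split : ∀ x → V x ≈ V₀ x ⊕ V₁ x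
V-split (j , r0) = pointwise (λ _ → refl)
V-split (j , r1) = pointwise (λ _ → refl)
V-split (j , r2) = ⊕-cong ≈-refl (q^-≡ (cong pent (ℤₚ.+-comm (+ 1) j)))

range-sum-split : ∀ {X X₀ X₁ : Class → Ser} {w₀ w₁ : Weighted ℤ} → (∀ x → X x ≈ X₀ x ⊕ X₁ x) → ∀ N →
  ∑ˢ (range N) (λ r → X₀ (doubleClass r) · q^ (sq r)) ≈[ N ] θ w₀ →
  ∑ˢ (range N) (λ r → X₁ (doubleClass r) · q^ (sq r)) ≈[ N ] θ w₁ →
  ∑ˢ (range N) (λ r → X (doubleClass r) · q^ (sq r)) ≈[ N ] θ (w₀ ⊎ʷ w₁)
range-sum-split {X} {X₀} {X₁} {w₀} {w₁} s N h₀ h₁ =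
  ≈[]-trans (≈⇒≈[] (≈-trans (∑ˢ-cong (range N) (λ {r} _ → ≈-trans (·-cong (s (doubleClass r)) ≈-refl) (·-distribʳ (q^ (sq r)) _ _)))
      (pointwise (λ n → ∑-xor (range N) (λ r → coeff (X₀ (doubleClass r) · q^ (sq r)) n) _))))
    (≈[]-trans (⊕-cong[] h₀ h₁) (≈⇒≈[] (≈-sym (θ-⊎ w₀ w₁))))

-- For r = 3k + 1 the class of 2r is r2, where `W` vanishes. The other two residues give the
-- exponents pent (2k) + (3k)² and pent (2k+1) + (3k+2)².
rogers-A : ∀ M → coeff (Σ[ M ] (λ n _ → q^ (n * n) · Pₙ (n + n))) M ≡ coeff (P · θ (A₀ ⊎ʷ A₁)) M
rogers-A M = at≤ (≈[]-trans (BW.bailey-limit M) (·-cong[] ≈[]-refl (range-sum-split W-split M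
    (range-progression W₀ 0 _ A₀ (s≤s z≤n) (λ _ → refl) (λ k → cong W₀ (doubleClass-0 k)) off₀ M)
    (range-progression W₁ 2 _ A₁ (s≤s (s≤s (s≤s z≤n))) (λ _ → refl) (λ k → cong W₁ (doubleClass-2 k)) off₁ M)))) ≤-refl
  where
  off₀ : ∀ k σ → σ < 3 → σ ≢ 0 → W₀ (doubleClass (+ 3 ℤ.* k ℤ.+ + σ)) ≡ 𝟘
  off₀ k 0 _ ne = contradiction refl ne
  off₀ k 1 _ _ = cong W₀ (doubleClass-1 k)
  off₀ k 2 _ _ = cong W₀ (doubleClass-2 k)
  off₀ k (suc (suc (suc _))) (s≤s (s≤s (s≤s ()))) _
  off₁ : ∀ k σ → σ < 3 → σ ≢ 2 → W₁ (doubleClass (+ 3 ℤ.* k ℤ.+ + σ)) ≡ 𝟘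
  off₁ k 0 _ _ = cong W₁ (doubleClass-0 k)
  off₁ k 1 _ _ = cong W₁ (doubleClass-1 k)
  off₁ k 2 _ ne = contradiction refl ne
  off₁ k (suc (suc (suc _))) (s≤s (s≤s (s≤s ()))) _

-- The value at n = 0 is the convention 1/(q)_(-1) = 0; it agrees with the pair because `V` vanishes
-- on the class of 0.
β-V : ℕ → Ser
β-V zero = 𝟘
β-V (suc n) = Pₙ (suc (n + n))

pair-V : ∀ n → Σ[ n + n ] (λ a b → V (class a b) · PP a b) ≈ β-V n
pair-V zero = pointwise (λ n → at (·-zeroˡ (PP 0 0)) n)
pair-V (suc n) = ≈-trans (bailey-pair-V (n + suc n)) (≡⇒≈ (cong Pₙ (+-suc n n)))

module BV = Bailey V β-V pair-V

-- Here only r = 3k + 1 survives, and the two monomials of `V` in that class produce the two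
-- families `B₀` and `B₁`.
rogers-B : ∀ M → coeff (Σ[ M ] (λ n _ → q^ (n * n) · β-V n)) M ≡ coeff (P · θ (B₀ ⊎ʷ B₁)) M
rogers-B M = at≤ (≈[]-trans (BV.bailey-limit M) (·-cong[] ≈[]-refl (range-sum-split V-split M
    (range-progression V₀ 1 _ B₀ (s≤s (s≤s z≤n)) (λ _ → refl) (λ k → cong V₀ (doubleClass-1 k)) off₀ M)
    (range-progression V₁ 1 _ B₁ (s≤s (s≤s z≤n)) (λ _ → refl) (λ k → cong V₁ (doubleClass-1 k)) off₁ M)))) ≤-refl
  where
  off₀ : ∀ k σ → σ < 3 → σ ≢ 1 → V₀ (doubleClass (+ 3 ℤ.* k ℤ.+ + σ)) ≡ 𝟘
  off₀ k 0 _ _ = cong V₀ (doubleClass-0 k)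
  off₀ k 1 _ ne = contradiction refl ne
  off₀ k 2 _ _ = cong V₀ (doubleClass-2 k)
  off₀ k (suc (suc (suc _))) (s≤s (s≤s (s≤s ()))) _
  off₁ : ∀ k σ → σ < 3 → σ ≢ 1 → V₁ (doubleClass (+ 3 ℤ.* k ℤ.+ + σ)) ≡ 𝟘
  off₁ k 0 _ _ = cong V₁ (doubleClass-0 k)
  off₁ k 1 _ ne = contradiction refl ne
  off₁ k 2 _ _ = cong V₁ (doubleClass-2 k)
  off₁ k (suc (suc (suc _))) (s≤s (s≤s (s≤s ()))) _

-- 5-dissection of (q²;q²)_∞ = Σ q^{m(3m+1)} along m = 5k + ρ

ℕ-quotient-unique : ∀ k {r s} x y → r < k → s < k → k * x + r ≡ k * y + s → x ≡ y × r ≡ s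
ℕ-quotient-unique k {r} {s} x y r<k s<k e = ℤₚ.+-injective (proj₁ unique) , proj₂ unique
  where
  unique = quotient-unique k (+ x) (+ y) r<k s<k
    (trans (cong (λ z → z ℤ.+ + r) (sym (ℤₚ.pos-* k x))) (trans (cong +_ e) (cong (λ z → z ℤ.+ + s) (ℤₚ.pos-* k y))))

2pent : ℤ → ℕ
2pent m = 2 * pent m + 0

2pent-ℤ : ∀ m → + 2pent m ≡ m ℤ.* (+ 3 ℤ.* m ℤ.+ + 1)
2pent-ℤ m = trans (cong +_ (+-identityʳ (2 * pent m))) (trans (ℤₚ.pos-* 2 (pent m)) (double-pent m))

private
  -- Doubling removes the division by 2 in pent.
  by-doubling : ∀ {a b} → + 2 ℤ.* + a ≡ + 2 ℤ.* + b → a ≡ b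
  by-doubling {a} {b} e = ℤₚ.+-injective (ℤₚ.*-cancelˡ-≡ (+ 2) (+ a) (+ b) e)

  5×[pent+sq] : ∀ j x → + 2 ℤ.* + (5 * (pent j + sq x)) ≡ + 5 ℤ.* (j ℤ.* (+ 3 ℤ.* j ℤ.+ + 1)) ℤ.+ + 10 ℤ.* (x ℤ.* x)
  5×[pent+sq] j x = trans (cong (λ z → + 2 ℤ.* z) (ℤₚ.pos-* 5 (pent j + sq x))) (trans (expand (+ pent j) (+ sq x))
    (cong₂ (λ a b → + 5 ℤ.* a ℤ.+ + 10 ℤ.* b) (double-pent j) (sq-ℤ x)))
    where
    expand : ∀ p s → + 2 ℤ.* (+ 5 ℤ.* (p ℤ.+ s)) ≡ + 5 ℤ.* (+ 2 ℤ.* p) ℤ.+ + 10 ℤ.* s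
    expand = ℤ-solve-∀

-- For m = 5k the exponent m(3m+1) is 5(15k² + k), and 15k² + k = pent (2k) + (3k)² is the exponent
-- that left the Bailey pair. This agreement, and its analogues for m = 5k + 3, 5k + 1, 5k + 2, is
-- what ties E² P₅ to the mock theta functions.
2pent-0 : ∀ k → 2pent (+ 5 ℤ.* k ℤ.+ + 0) ≡ 5 * wt A₀ k
2pent-0 k = by-doubling (trans (cong (λ z → + 2 ℤ.* z) (2pent-ℤ (+ 5 ℤ.* k ℤ.+ + 0))) (trans (identity k) (sym (5×[pent+sq] (+ 2 ℤ.* k) (+ 3 ℤ.* k ℤ.+ + 0)))))
  where
  identity : ∀ k → + 2 ℤ.* ((+ 5 ℤ.* k ℤ.+ + 0) ℤ.* (+ 3 ℤ.* (+ 5 ℤ.* k ℤ.+ + 0) ℤ.+ + 1)) ≡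
    + 5 ℤ.* ((+ 2 ℤ.* k) ℤ.* (+ 3 ℤ.* (+ 2 ℤ.* k) ℤ.+ + 1)) ℤ.+ + 10 ℤ.* ((+ 3 ℤ.* k ℤ.+ + 0) ℤ.* (+ 3 ℤ.* k ℤ.+ + 0))
  identity = ℤ-solve-∀

2pent-3 : ∀ k → 2pent (+ 5 ℤ.* k ℤ.+ + 3) ≡ 5 * wt A₁ k
2pent-3 k = by-doubling (trans (cong (λ z → + 2 ℤ.* z) (2pent-ℤ (+ 5 ℤ.* k ℤ.+ + 3))) (trans (identity k) (sym (5×[pent+sq] (+ 2 ℤ.* k ℤ.+ + 1) (+ 3 ℤ.* k ℤ.+ + 2)))))
  where
  identity : ∀ k → + 2 ℤ.* ((+ 5 ℤ.* k ℤ.+ + 3) ℤ.* (+ 3 ℤ.* (+ 5 ℤ.* k ℤ.+ + 3) ℤ.+ + 1)) ≡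
    + 5 ℤ.* ((+ 2 ℤ.* k ℤ.+ + 1) ℤ.* (+ 3 ℤ.* (+ 2 ℤ.* k ℤ.+ + 1) ℤ.+ + 1)) ℤ.+ + 10 ℤ.* ((+ 3 ℤ.* k ℤ.+ + 2) ℤ.* (+ 3 ℤ.* k ℤ.+ + 2))
  identity = ℤ-solve-∀

-- For m = 5k + 1 and m = 5k + 2 the exponent is 4 modulo 5. Adding 1 makes it divisible by 5; this
-- is why the component of residue 4 is matched with coefficient n + 1 in `2×pentagonal-4`.
2pent-1 : ∀ k → suc (2pent (+ 5 ℤ.* k ℤ.+ + 1)) ≡ 5 * wt B₀ k
2pent-1 k = by-doubling (trans (cong (λ z → + 2 ℤ.* (+ 1 ℤ.+ z)) (2pent-ℤ (+ 5 ℤ.* k ℤ.+ + 1))) (trans (identity k) (sym (5×[pent+sq] (+ 2 ℤ.* k) (+ 3 ℤ.* k ℤ.+ + 1)))))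
  where
  identity : ∀ k → + 2 ℤ.* (+ 1 ℤ.+ (+ 5 ℤ.* k ℤ.+ + 1) ℤ.* (+ 3 ℤ.* (+ 5 ℤ.* k ℤ.+ + 1) ℤ.+ + 1)) ≡
    + 5 ℤ.* ((+ 2 ℤ.* k) ℤ.* (+ 3 ℤ.* (+ 2 ℤ.* k) ℤ.+ + 1)) ℤ.+ + 10 ℤ.* ((+ 3 ℤ.* k ℤ.+ + 1) ℤ.* (+ 3 ℤ.* k ℤ.+ + 1))
  identity = ℤ-solve-∀

2pent-2 : ∀ k → suc (2pent (+ 5 ℤ.* k ℤ.+ + 2)) ≡ 5 * wt B₁ k
2pent-2 k = by-doubling (trans (cong (λ z → + 2 ℤ.* (+ 1 ℤ.+ z)) (2pent-ℤ (+ 5 ℤ.* k ℤ.+ + 2))) (trans (identity k) (sym (5×[pent+sq] (+ 2 ℤ.* k ℤ.+ + 1) (+ 3 ℤ.* k ℤ.+ + 1)))))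
  where
  identity : ∀ k → + 2 ℤ.* (+ 1 ℤ.+ (+ 5 ℤ.* k ℤ.+ + 2) ℤ.* (+ 3 ℤ.* (+ 5 ℤ.* k ℤ.+ + 2) ℤ.+ + 1)) ≡
    + 5 ℤ.* ((+ 2 ℤ.* k ℤ.+ + 1) ℤ.* (+ 3 ℤ.* (+ 2 ℤ.* k ℤ.+ + 1) ℤ.+ + 1)) ℤ.+ + 10 ℤ.* ((+ 3 ℤ.* k ℤ.+ + 1) ℤ.* (+ 3 ℤ.* k ℤ.+ + 1))
  identity = ℤ-solve-∀

reflect : ℤ → ℤ
reflect k = ℤ.- k ℤ.- + 1

reflect-involutive : ∀ k → reflect (reflect k) ≡ k
reflect-involutive = identity
  where
  identity : ∀ k → ℤ.- (ℤ.- k ℤ.- + 1) ℤ.- + 1 ≡ k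
  identity = ℤ-solve-∀

-- Here 5k + 4 = -(5k' + 1) with k' = `reflect k`, so m(3m+1) = 25 k'(3k'+1) + 2: this class
-- reproduces the pentagonal numbers themselves, and its component of E² is again an Euler product.
2pent-4 : ∀ k → 2pent (+ 5 ℤ.* k ℤ.+ + 4) ≡ 5 * (10 * pent (reflect k) + 0) + 2
2pent-4 k = ℤₚ.+-injective (trans (2pent-ℤ (+ 5 ℤ.* k ℤ.+ + 4)) (trans (identity k) (sym
    (trans (cong (λ z → z ℤ.+ + 2) (trans (ℤₚ.pos-* 5 (10 * p + 0)) (cong (λ z → + 5 ℤ.* (z ℤ.+ + 0)) (ℤₚ.pos-* 10 p))))
      (trans (expand (+ p)) (cong (λ z → + 25 ℤ.* z ℤ.+ + 2) (double-pent (reflect k))))))))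
  where
  p = pent (reflect k)
  expand : ∀ p → + 5 ℤ.* (+ 10 ℤ.* p ℤ.+ + 0) ℤ.+ + 2 ≡ + 25 ℤ.* (+ 2 ℤ.* p) ℤ.+ + 2
  expand = ℤ-solve-∀
  identity : ∀ k → (+ 5 ℤ.* k ℤ.+ + 4) ℤ.* (+ 3 ℤ.* (+ 5 ℤ.* k ℤ.+ + 4) ℤ.+ + 1) ≡
    + 25 ℤ.* ((ℤ.- k ℤ.- + 1) ℤ.* (+ 3 ℤ.* (ℤ.- k ℤ.- + 1) ℤ.+ + 1)) ℤ.+ + 2
  identity = ℤ-solve-∀

private
  <5 : ∀ c {p : T (c <ᵇ 5)} → c < 5
  <5 c {p} = <ᵇ⇒< c 5 p

  clash : ∀ a b {c d} → c < 5 → d < 5 → c ≢ d → ∀ {C : Set} → 5 * a + c ≡ 5 * b + d → C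
  clash a b c<5 d<5 c≢d e = contradiction (proj₂ (ℕ-quotient-unique 5 a b c<5 d<5 e)) c≢d

  data Mod5 : ℤ → Set where
    mod5 : ∀ k ρ → ρ < 5 → Mod5 (+ 5 ℤ.* k ℤ.+ + ρ)

  mod5-view : ∀ m → Mod5 m
  mod5-view m = subst Mod5 (sym (div-eq 5 m)) (mod5 (m /ℕ 5) (m %ℕ 5) (n%ℕd<d m 5))

  data Section5 (k : ℤ) : ℕ → Set where
    sec-A₀ : 2pent (+ 5 ℤ.* k ℤ.+ + 0) ≡ 5 * wt A₀ k + 0 → Section5 k 0
    sec-B₀ : suc (2pent (+ 5 ℤ.* k ℤ.+ + 1)) ≡ 5 * wt B₀ k + 0 → Section5 k 1
    sec-B₁ : suc (2pent (+ 5 ℤ.* k ℤ.+ + 2)) ≡ 5 * wt B₁ k + 0 → Section5 k 2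
    sec-A₁ : 2pent (+ 5 ℤ.* k ℤ.+ + 3) ≡ 5 * wt A₁ k + 0 → Section5 k 3
    sec-E : 2pent (+ 5 ℤ.* k ℤ.+ + 4) ≡ 5 * (10 * pent (reflect k) + 0) + 2 → Section5 k 4

  section5 : ∀ k ρ → ρ < 5 → Section5 k ρ
  section5 k 0 _ = sec-A₀ (trans (2pent-0 k) (sym (+-identityʳ _)))
  section5 k 1 _ = sec-B₀ (trans (2pent-1 k) (sym (+-identityʳ _)))
  section5 k 2 _ = sec-B₁ (trans (2pent-2 k) (sym (+-identityʳ _)))
  section5 k 3 _ = sec-A₁ (trans (2pent-3 k) (sym (+-identityʳ _)))
  section5 k 4 _ = sec-E (2pent-4 k)
  section5 k (suc (suc (suc (suc (suc _))))) (s≤s (s≤s (s≤s (s≤s (s≤s ())))))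

  5k+ρ/5 : ∀ k ρ → ρ < 5 → (+ 5 ℤ.* k ℤ.+ + ρ) /ℕ 5 ≡ k
  5k+ρ/5 k ρ ρ<5 = /ℕ-unique 5 k ρ<5 refl

  5k+ρ%5 : ∀ k ρ → ρ < 5 → (+ 5 ℤ.* k ℤ.+ + ρ) %ℕ 5 ≡ ρ
  5k+ρ%5 k ρ ρ<5 = proj₂ (quotient-unique 5 ((+ 5 ℤ.* k ℤ.+ + ρ) /ℕ 5) k (n%ℕd<d (+ 5 ℤ.* k ℤ.+ + ρ) 5) ρ<5 (sym (div-eq 5 (+ 5 ℤ.* k ℤ.+ + ρ))))

  residue5 : ∀ {A : Set} (g : ℕ → ℤ → A) k ρ → ρ < 5 → g ((+ 5 ℤ.* k ℤ.+ + ρ) %ℕ 5) ((+ 5 ℤ.* k ℤ.+ + ρ) /ℕ 5) ≡ g ρ k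
  residue5 g k ρ ρ<5 = cong₂ g (5k+ρ%5 k ρ ρ<5) (5k+ρ/5 k ρ ρ<5)

  suc-5n : ∀ {a n} c → a ≡ 5 * n + c → suc a ≡ 5 * n + suc c
  suc-5n {n = n} c e = trans (cong suc e) (sym (+-suc (5 * n) c))

  choose : ℕ → ℕ → ℤ → ℤ ⊎ ℤ
  choose ρ σ k with σ ≟ ρ
  ... | yes _ = inj₁ k
  ... | no _ = inj₂ k

2×pentagonal : Weighted ℤ
2×pentagonal = affine 2 0 pentagonal

-- The numbers m(3m+1) for m = 0, 1, 2, 3, 4 are 0, 4, 4, 0, 2 modulo 5. The conditions on c leave
-- the residues 1 and 3, which do not occur.
2×pentagonal-none : ∀ n c → c < 4 → c ≢ 0 → c ≢ 2 → coeff (θ 2×pentagonal) (5 * n + c) ≡ false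
2×pentagonal-none n c c<4 c≢0 c≢2 = θ-none 2×pentagonal (5 * n + c) (λ m → go m (mod5-view m))
  where
  c<5 : c < 5
  c<5 = ≤-trans c<4 (n≤1+n 4)
  go : ∀ m → Mod5 m → 2pent m ≢ 5 * n + c
  go _ (mod5 k ρ ρ<5) e with section5 k ρ ρ<5
  ... | sec-A₀ h = clash n (wt A₀ k) c<5 (<5 0) c≢0 (trans (sym e) h)
  ... | sec-B₀ h = clash n (wt B₀ k) {suc c} (s≤s c<4) (<5 0) (λ ()) (trans (sym (suc-5n {n = n} c e)) h)
  ... | sec-B₁ h = clash n (wt B₁ k) {suc c} (s≤s c<4) (<5 0) (λ ()) (trans (sym (suc-5n {n = n} c e)) h)
  ... | sec-A₁ h = clash n (wt A₁ k) c<5 (<5 0) c≢0 (trans (sym e) h)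
  ... | sec-E h = clash n (10 * pent (reflect k) + 0) c<5 (<5 2) c≢2 (trans (sym e) h)

2×pentagonal-2 : ∀ n → coeff (θ 2×pentagonal) (5 * n + 2) ≡ coeff (θ (affine 10 0 pentagonal)) n
2×pentagonal-2 n = θ-match 2×pentagonal (affine 10 0 pentagonal) (5 * n + 2) n (λ m → reflect (m /ℕ 5)) (λ k → + 5 ℤ.* reflect k ℤ.+ + 4)
  (λ m → to m (mod5-view m)) from
  where
  Goal : ℤ → ℤ → Set
  Goal m k = 10 * pent (reflect k) + 0 ≡ n × + 5 ℤ.* reflect (reflect k) ℤ.+ + 4 ≡ m
  to : ∀ m → Mod5 m → 2pent m ≡ 5 * n + 2 → Goal m (m /ℕ 5)
  to _ (mod5 k ρ ρ<5) e = subst (Goal (+ 5 ℤ.* k ℤ.+ + ρ)) (sym (5k+ρ/5 k ρ ρ<5)) (goal (section5 k ρ ρ<5) e)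
    where
    goal : ∀ {ρ} → Section5 k ρ → 2pent (+ 5 ℤ.* k ℤ.+ + ρ) ≡ 5 * n + 2 → Goal (+ 5 ℤ.* k ℤ.+ + ρ) k
    goal (sec-A₀ h) e = clash n (wt A₀ k) {2} (<5 2) (<5 0) (λ ()) (trans (sym e) h)
    goal (sec-B₀ h) e = clash n (wt B₀ k) {3} (<5 3) (<5 0) (λ ()) (trans (sym (suc-5n {n = n} 2 e)) h)
    goal (sec-B₁ h) e = clash n (wt B₁ k) {3} (<5 3) (<5 0) (λ ()) (trans (sym (suc-5n {n = n} 2 e)) h)
    goal (sec-A₁ h) e = clash n (wt A₁ k) {2} (<5 2) (<5 0) (λ ()) (trans (sym e) h)
    goal (sec-E h) e = proj₁ (ℕ-quotient-unique 5 _ n (<5 2) (<5 2) (trans (sym h) e)) , cong (λ z → + 5 ℤ.* z ℤ.+ + 4) (reflect-involutive k)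
  from : ∀ k → 10 * pent k + 0 ≡ n → 2pent (+ 5 ℤ.* reflect k ℤ.+ + 4) ≡ 5 * n + 2 × reflect ((+ 5 ℤ.* reflect k ℤ.+ + 4) /ℕ 5) ≡ k
  from k e = trans (2pent-4 (reflect k)) (cong (λ z → 5 * z + 2) (trans (cong (λ z → 10 * pent z + 0) (reflect-involutive k)) e)) ,
    trans (cong reflect (5k+ρ/5 (reflect k) 4 (<5 4))) (reflect-involutive k)

2×pentagonal-0 : ∀ n → coeff (θ 2×pentagonal) (5 * n + 0) ≡ coeff (θ (A₀ ⊎ʷ A₁)) n
2×pentagonal-0 n = θ-match 2×pentagonal (A₀ ⊎ʷ A₁) (5 * n + 0) n φ ψ (λ m → to m (mod5-view m)) from
  where
  φ : ℤ → ℤ ⊎ ℤ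
  φ m = choose 0 (m %ℕ 5) (m /ℕ 5)
  ψ : ℤ ⊎ ℤ → ℤ
  ψ (inj₁ k) = + 5 ℤ.* k ℤ.+ + 0
  ψ (inj₂ k) = + 5 ℤ.* k ℤ.+ + 3
  Goal : ℤ → ℤ ⊎ ℤ → Set
  Goal m y = wt (A₀ ⊎ʷ A₁) y ≡ n × ψ y ≡ m
  to : ∀ m → Mod5 m → 2pent m ≡ 5 * n + 0 → Goal m (φ m)
  to _ (mod5 k ρ ρ<5) e = subst (Goal (+ 5 ℤ.* k ℤ.+ + ρ)) (sym (residue5 (choose 0) k ρ ρ<5)) (goal (section5 k ρ ρ<5) e)
    where
    goal : ∀ {ρ} → Section5 k ρ → 2pent (+ 5 ℤ.* k ℤ.+ + ρ) ≡ 5 * n + 0 → Goal (+ 5 ℤ.* k ℤ.+ + ρ) (choose 0 ρ k)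
    goal (sec-A₀ h) e = proj₁ (ℕ-quotient-unique 5 _ n (<5 0) (<5 0) (trans (sym h) e)) , refl
    goal (sec-B₀ h) e = clash n (wt B₀ k) {1} (<5 1) (<5 0) (λ ()) (trans (sym (suc-5n {n = n} 0 e)) h)
    goal (sec-B₁ h) e = clash n (wt B₁ k) {1} (<5 1) (<5 0) (λ ()) (trans (sym (suc-5n {n = n} 0 e)) h)
    goal (sec-A₁ h) e = proj₁ (ℕ-quotient-unique 5 _ n (<5 0) (<5 0) (trans (sym h) e)) , refl
    goal (sec-E h) e = clash n (10 * pent (reflect k) + 0) {0} (<5 0) (<5 2) (λ ()) (trans (sym e) h)
  from : ∀ y → wt (A₀ ⊎ʷ A₁) y ≡ n → 2pent (ψ y) ≡ 5 * n + 0 × φ (ψ y) ≡ y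
  from (inj₁ k) refl = trans (2pent-0 k) (sym (+-identityʳ _)) , residue5 (choose 0) k 0 (<5 0)
  from (inj₂ k) refl = trans (2pent-3 k) (sym (+-identityʳ _)) , residue5 (choose 0) k 3 (<5 3)

2×pentagonal-4 : ∀ n → coeff (θ 2×pentagonal) (5 * n + 4) ≡ coeff (θ (B₀ ⊎ʷ B₁)) (suc n)
2×pentagonal-4 n = θ-match 2×pentagonal (B₀ ⊎ʷ B₁) (5 * n + 4) (suc n) φ ψ (λ m → to m (mod5-view m)) from
  where
  φ : ℤ → ℤ ⊎ ℤ
  φ m = choose 1 (m %ℕ 5) (m /ℕ 5)
  ψ : ℤ ⊎ ℤ → ℤ
  ψ (inj₁ k) = + 5 ℤ.* k ℤ.+ + 1
  ψ (inj₂ k) = + 5 ℤ.* k ℤ.+ + 2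
  5[n+1] : 5 * n + 5 ≡ 5 * suc n + 0
  5[n+1] = trans (+-comm (5 * n) 5) (trans (sym (*-suc 5 n)) (sym (+-identityʳ _)))
  Goal : ℤ → ℤ ⊎ ℤ → Set
  Goal m y = wt (B₀ ⊎ʷ B₁) y ≡ suc n × ψ y ≡ m
  to : ∀ m → Mod5 m → 2pent m ≡ 5 * n + 4 → Goal m (φ m)
  to _ (mod5 k ρ ρ<5) e = subst (Goal (+ 5 ℤ.* k ℤ.+ + ρ)) (sym (residue5 (choose 1) k ρ ρ<5)) (goal (section5 k ρ ρ<5) e)
    where
    goal : ∀ {ρ} → Section5 k ρ → 2pent (+ 5 ℤ.* k ℤ.+ + ρ) ≡ 5 * n + 4 → Goal (+ 5 ℤ.* k ℤ.+ + ρ) (choose 1 ρ k)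
    goal (sec-A₀ h) e = clash n (wt A₀ k) {4} (<5 4) (<5 0) (λ ()) (trans (sym e) h)
    goal (sec-B₀ h) e = proj₁ (ℕ-quotient-unique 5 _ (suc n) (<5 0) (<5 0) (trans (sym h) (trans (suc-5n {n = n} 4 e) 5[n+1]))) , refl
    goal (sec-B₁ h) e = proj₁ (ℕ-quotient-unique 5 _ (suc n) (<5 0) (<5 0) (trans (sym h) (trans (suc-5n {n = n} 4 e) 5[n+1]))) , refl
    goal (sec-A₁ h) e = clash n (wt A₁ k) {4} (<5 4) (<5 0) (λ ()) (trans (sym e) h)
    goal (sec-E h) e = clash n (10 * pent (reflect k) + 0) {4} (<5 4) (<5 2) (λ ()) (trans (sym e) h)
  back : ∀ m w → suc m ≡ 5 * w → w ≡ suc n → m ≡ 5 * n + 4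
  back m w e refl = suc-injective (trans e (trans (sym (+-identityʳ _)) (trans (sym 5[n+1]) (+-suc (5 * n) 4))))
  from : ∀ y → wt (B₀ ⊎ʷ B₁) y ≡ suc n → 2pent (ψ y) ≡ 5 * n + 4 × φ (ψ y) ≡ y
  from (inj₁ k) e = back _ _ (2pent-1 k) e , residue5 (choose 1) k 1 (<5 1)
  from (inj₂ k) e = back _ _ (2pent-2 k) e , residue5 (choose 1) k 2 (<5 2)

-- Binary quadratic forms

ℤ²-≟ : DecidableEquality (ℤ × ℤ)
ℤ²-≟ = ×-≡-dec ℤₚ._≟_ ℤₚ._≟_

Q : ∀ a b .{{_ : NonZero a}} .{{_ : NonZero b}} → Weighted (ℤ × ℤ)
Q a b = record
  { wt = λ (u , v) → a * sq u + b * sq v ; decEq = ℤ²-≟ ; upto = λ n → cartesianProduct (range n) (range n)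
  ; complete = λ {n} (u , v) p → ∈-cartesianProduct⁺
      (range-complete n u (≤-trans (∣x∣≤sq u) (≤-trans (m≤n*m (sq u) a) (≤-trans (m≤m+n _ _) p))))
      (range-complete n v (≤-trans (∣x∣≤sq v) (≤-trans (m≤n*m (sq v) b) (≤-trans (m≤n+m _ (a * sq u)) p)))) }

Q-ℤ : ∀ a b .{{_ : NonZero a}} .{{_ : NonZero b}} u v → + wt (Q a b) (u , v) ≡ + a ℤ.* (u ℤ.* u) ℤ.+ + b ℤ.* (v ℤ.* v)
Q-ℤ a b u v = cong₂ ℤ._+_ (trans (ℤₚ.pos-* a (sq u)) (cong (λ z → + a ℤ.* z) (sq-ℤ u))) (trans (ℤₚ.pos-* b (sq v)) (cong (λ z → + b ℤ.* z) (sq-ℤ v)))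

module _ {A : Set} (k : ℕ) (w : Weighted A) (μ : Fin k → A → A) (δ : A → A) (ρ : A → Fin k)
  (δμ : ∀ r x → δ (μ r x) ≡ x) (ρμ : ∀ r x → ρ (μ r x) ≡ r) (μρδ : ∀ x → μ (ρ x) (δ x) ≡ x) where

  residueClass : Fin k → Weighted A
  residueClass r = pull (decEq w) (μ r) δ (δμ r) w

  θ-residues : θ w ≈ ∑ˢ (allFin k) (λ r → θ (residueClass r))
  θ-residues = pointwise (λ n → trans (∑-bijection (×-≡-dec _≟ᶠ_ (decEq w)) _ (λ (r , x) → wt w (μ r x) ≡ᵇ n) (λ x → ρ x , δ x) (λ (r , x) → μ r x)
      (support-unique w n) (cartesianProduct⁺ (allFin⁺ k) (support-unique′ n))
      (λ {x} _ e → let e′ = trans (cong (λ y → wt w y ≡ᵇ n) (μρδ x)) e in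
        ∈-cartesianProduct⁺ (∈-allFin (ρ x)) (support-complete (residueClass (ρ x)) (δ x) (≤-reflexive (≡ᵇ-true e′))) , e′ , μρδ x)
      (λ {(r , x)} _ e → support-complete w (μ r x) (≤-reflexive (≡ᵇ-true e)) , e , cong₂ _,_ (ρμ r x) (δμ r x)))
    (∑-cartesianProduct (allFin k) (lists n) _))
    where
    lists : ℕ → List A
    lists n = deduplicate (decEq w) (map δ (upto w n))
    support-unique′ : ∀ n → Unique (lists n)
    support-unique′ n = deduplicate-! (decEq w) _

module _ (k : ℕ) .{{_ : NonZero k}} where

  residue : ℤ → Fin k
  residue x = fromℕ< (n%ℕd<d x k)

  residue-eq : ∀ x → + k ℤ.* (x /ℕ k) ℤ.+ + toℕ (residue x) ≡ x
  residue-eq x = trans (cong (λ r → + k ℤ.* (x /ℕ k) ℤ.+ + r) (toℕ-fromℕ< (n%ℕd<d x k))) (sym (div-eq k x))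

  residue-quotient : ∀ (r : Fin k) x → (+ k ℤ.* x ℤ.+ + toℕ r) /ℕ k ≡ x
  residue-quotient r x = /ℕ-unique k x (toℕ<n r) refl

  residue-unique : ∀ (r : Fin k) x → residue (+ k ℤ.* x ℤ.+ + toℕ r) ≡ r
  residue-unique r x = toℕ-injective (proj₂ (quotient-unique k _ x (toℕ<n (residue (+ k ℤ.* x ℤ.+ + toℕ r))) (toℕ<n r) (residue-eq (+ k ℤ.* x ℤ.+ + toℕ r))))

  module _ (w : Weighted (ℤ × ℤ)) where

    private
      μ₁ μ₂ : Fin k → ℤ × ℤ → ℤ × ℤ
      μ₁ r (x , y) = + k ℤ.* x ℤ.+ + toℕ r , y
      μ₂ r (x , y) = x , + k ℤ.* y ℤ.+ + toℕ r
      δ₁ δ₂ : ℤ × ℤ → ℤ × ℤ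
      δ₁ (x , y) = x /ℕ k , y
      δ₂ (x , y) = x , y /ℕ k

    residueClass₁ residueClass₂ : Fin k → Weighted (ℤ × ℤ)
    residueClass₁ = residueClass k w μ₁ δ₁ (λ (x , y) → residue x) (λ r (x , y) → cong (_, y) (residue-quotient r x)) (λ r (x , y) → residue-unique r x) (λ (x , y) → cong (_, y) (residue-eq x))
    residueClass₂ = residueClass k w μ₂ δ₂ (λ (x , y) → residue y) (λ r (x , y) → cong (x ,_) (residue-quotient r y)) (λ r (x , y) → residue-unique r y) (λ (x , y) → cong (x ,_) (residue-eq y))

    θ-residues₁ : θ w ≈ ∑ˢ (allFin k) (λ r → θ (residueClass₁ r))
    θ-residues₁ = θ-residues k w μ₁ δ₁ (λ (x , y) → residue x) (λ r (x , y) → cong (_, y) (residue-quotient r x)) (λ r (x , y) → residue-unique r x) (λ (x , y) → cong (_, y) (residue-eq x))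

    θ-residues₂ : θ w ≈ ∑ˢ (allFin k) (λ r → θ (residueClass₂ r))
    θ-residues₂ = θ-residues k w μ₂ δ₂ (λ (x , y) → residue y) (λ r (x , y) → cong (x ,_) (residue-quotient r y)) (λ r (x , y) → residue-unique r y) (λ (x , y) → cong (x ,_) (residue-eq y))

nonNegative : ℤ → Bool
nonNegative (+ _) = true
nonNegative -[1+ _ ] = false

-- This supplies the colour required by `θ-vanish`: for v ↦ w - v with w = 2h + 1 odd, d = h - v
-- goes to -d - 1, so the sign of d tells on which side of the half-integer w/2 the point v lies.
nonNegative-reflect : ∀ d → nonNegative (reflect d) ≡ not (nonNegative d)
nonNegative-reflect (+ zero) = refl
nonNegative-reflect (+ suc n) = refl
nonNegative-reflect -[1+ n ] = refl

-- The binary form s² - 2c sv + 6c v² = (s - cv)² + (6c - c²) v²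
module Form (c k : ℕ) .{{_ : NonZero k}} (c²+k : + c ℤ.* + c ℤ.+ + k ≡ + 6 ℤ.* + c) where

  -- Pulling back the diagonal form along (s, v) ↦ (s - cv, v) makes positive definiteness, and with
  -- it the finiteness demanded by `Weighted`, immediate.
  form : Weighted (ℤ × ℤ)
  form = pull ℤ²-≟ (λ (s , v) → s ℤ.- + c ℤ.* v , v) (λ (u , v) → u ℤ.+ + c ℤ.* v , v) (λ (s , v) → cong (_, v) (undo s (+ c ℤ.* v))) (Q 1 k)
    where
    undo : ∀ s x → s ℤ.- x ℤ.+ x ≡ s
    undo = ℤ-solve-∀

  polynomial : ℤ → ℤ → ℤ
  polynomial s v = s ℤ.* s ℤ.- + 2 ℤ.* + c ℤ.* s ℤ.* v ℤ.+ + 6 ℤ.* + c ℤ.* (v ℤ.* v)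

  form-ℤ : ∀ s v → + wt form (s , v) ≡ polynomial s v
  form-ℤ s v = trans (Q-ℤ 1 k (s ℤ.- + c ℤ.* v) v) (trans (expand s v (+ c) (+ k)) (cong (λ z → s ℤ.* s ℤ.- + 2 ℤ.* + c ℤ.* s ℤ.* v ℤ.+ z ℤ.* (v ℤ.* v)) c²+k))
    where
    expand : ∀ s v c k → + 1 ℤ.* ((s ℤ.- c ℤ.* v) ℤ.* (s ℤ.- c ℤ.* v)) ℤ.+ k ℤ.* (v ℤ.* v) ≡ s ℤ.* s ℤ.- + 2 ℤ.* c ℤ.* s ℤ.* v ℤ.+ (c ℤ.* c ℤ.+ k) ℤ.* (v ℤ.* v)
    expand = ℤ-solve-∀

  form-≡ : ∀ s v s′ v′ → polynomial s v ≡ polynomial s′ v′ → wt form (s , v) ≡ wt form (s′ , v′)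
  form-≡ s v s′ v′ e = ℤₚ.+-injective (trans (form-ℤ s v) (trans e (sym (form-ℤ s′ v′))))

  progression : ∀ a .{{_ : NonZero a}} b → b < a → Weighted (ℤ × ℤ)
  progression a b b<a = pull ℤ²-≟ (λ (t , v) → + a ℤ.* t ℤ.+ + b , v) (λ (s , v) → s /ℕ a , v) (λ (t , v) → cong (_, v) (/ℕ-unique a t b<a refl)) form

  private
    1<4 : 1 < 4
    1<4 = s≤s (s≤s z≤n)
    1<6 : 1 < 6
    1<6 = s≤s (s≤s z≤n)

  X Y : Weighted (ℤ × ℤ)
  X = progression 6 1 1<6
  Y = progression 4 1 1<4

  -- For s = 3w with w = 4t+3 odd, v ↦ w - v is an automorphism of the form without fixed points.
  s≡9-vanishes : θ (residueClass₁ 3 Y (suc (suc zero))) ≈ 𝟘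
  s≡9-vanishes = θ-vanish (residueClass₁ 3 Y (suc (suc zero))) (λ (t , v) → nonNegative (+ 2 ℤ.* t ℤ.+ + 1 ℤ.- v)) (λ (t , v) → t , + 4 ℤ.* t ℤ.+ + 3 ℤ.- v)
    (λ (t , v) → form-≡ (+ 4 ℤ.* (+ 3 ℤ.* t ℤ.+ + 2) ℤ.+ + 1) (+ 4 ℤ.* t ℤ.+ + 3 ℤ.- v) (+ 4 ℤ.* (+ 3 ℤ.* t ℤ.+ + 2) ℤ.+ + 1) v (identity (+ c) t v))
    (λ (t , v) → cong (t ,_) (undo (+ 4 ℤ.* t ℤ.+ + 3) v))
    (λ (t , v) → trans (cong nonNegative (reflected t v)) (nonNegative-reflect (+ 2 ℤ.* t ℤ.+ + 1 ℤ.- v)))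
    where
    undo : ∀ w v → w ℤ.- (w ℤ.- v) ≡ v
    undo = ℤ-solve-∀
    reflected : ∀ t v → + 2 ℤ.* t ℤ.+ + 1 ℤ.- (+ 4 ℤ.* t ℤ.+ + 3 ℤ.- v) ≡ ℤ.- (+ 2 ℤ.* t ℤ.+ + 1 ℤ.- v) ℤ.- + 1
    reflected = ℤ-solve-∀
    identity : ∀ c t v → let s = + 4 ℤ.* (+ 3 ℤ.* t ℤ.+ + 2) ℤ.+ + 1 ; v′ = + 4 ℤ.* t ℤ.+ + 3 ℤ.- v in
      s ℤ.* s ℤ.- + 2 ℤ.* c ℤ.* s ℤ.* v′ ℤ.+ + 6 ℤ.* c ℤ.* (v′ ℤ.* v′) ≡ s ℤ.* s ℤ.- + 2 ℤ.* c ℤ.* s ℤ.* v ℤ.+ + 6 ℤ.* c ℤ.* (v ℤ.* v)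
    identity = ℤ-solve-∀

  s≡1-matches : θ (residueClass₁ 2 X zero) ≈ θ (residueClass₁ 3 Y zero)
  s≡1-matches = θ-bijection _ _ id id (λ _ → refl) (λ _ → refl) (λ (t , v) → form-≡ (+ 4 ℤ.* (+ 3 ℤ.* t ℤ.+ + 0) ℤ.+ + 1) v (+ 6 ℤ.* (+ 2 ℤ.* t ℤ.+ + 0) ℤ.+ + 1) v (identity (+ c) t v))
    where
    identity : ∀ c t v → let s = + 4 ℤ.* (+ 3 ℤ.* t ℤ.+ + 0) ℤ.+ + 1 ; s′ = + 6 ℤ.* (+ 2 ℤ.* t ℤ.+ + 0) ℤ.+ + 1 in
      s ℤ.* s ℤ.- + 2 ℤ.* c ℤ.* s ℤ.* v ℤ.+ + 6 ℤ.* c ℤ.* (v ℤ.* v) ≡ s′ ℤ.* s′ ℤ.- + 2 ℤ.* c ℤ.* s′ ℤ.* v ℤ.+ + 6 ℤ.* c ℤ.* (v ℤ.* v)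
    identity = ℤ-solve-∀

  s≡7-matches : θ (residueClass₁ 2 X (suc zero)) ≈ θ (residueClass₁ 3 Y (suc zero))
  s≡7-matches = θ-bijection _ _ negate negate negate-involutive negate-involutive (λ (t , v) → form-≡ (+ 4 ℤ.* (+ 3 ℤ.* reflect t ℤ.+ + 1) ℤ.+ + 1) (ℤ.- v) (+ 6 ℤ.* (+ 2 ℤ.* t ℤ.+ + 1) ℤ.+ + 1) v (identity (+ c) t v))
    where
    negate : ℤ × ℤ → ℤ × ℤ
    negate (t , v) = reflect t , ℤ.- v
    negate-involutive : ∀ x → negate (negate x) ≡ x
    negate-involutive (t , v) = cong₂ _,_ (reflect-involutive t) (ℤₚ.neg-involutive v)
    identity : ∀ c t v → let s = + 4 ℤ.* (+ 3 ℤ.* (ℤ.- t ℤ.- + 1) ℤ.+ + 1) ℤ.+ + 1 ; v′ = ℤ.- v ; s′ = + 6 ℤ.* (+ 2 ℤ.* t ℤ.+ + 1) ℤ.+ + 1 in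
      s ℤ.* s ℤ.- + 2 ℤ.* c ℤ.* s ℤ.* v′ ℤ.+ + 6 ℤ.* c ℤ.* (v′ ℤ.* v′) ≡ s′ ℤ.* s′ ℤ.- + 2 ℤ.* c ℤ.* s′ ℤ.* v ℤ.+ + 6 ℤ.* c ℤ.* (v ℤ.* v)
    identity = ℤ-solve-∀

  -- Modulo 12, s = 1 mod 6 consists of the classes 1 and 7, and s = 1 mod 4 of 1, 5 and 9. Class 1
  -- is common, (s, v) ↦ (-s, -v) carries 7 to 5, and class 9 contributes nothing. The gain is that
  -- the condition modulo 4 is suited to reflections in the axes.
  θX≈θY : θ X ≈ θ Y
  θX≈θY = begin
    θ X ≈⟨ θ-residues₁ 2 X ⟩
    ∑ˢ (allFin 2) (λ r → θ (residueClass₁ 2 X r)) ≈⟨ pointwise (λ n → cong₂ _xor_ (at s≡1-matches n) (cong₂ _xor_ (at s≡7-matches n) (sym (trans (xor-identityʳ _) (at s≡9-vanishes n))))) ⟩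
    ∑ˢ (allFin 3) (λ r → θ (residueClass₁ 3 Y r)) ≈⟨ ≈-sym (θ-residues₁ 3 Y) ⟩
    θ Y ∎
    where open ≈R

-- Keeping u = 4t+1-2y and replacing y by -y is an involution, which leaves only the terms with y = 0.
module Fold (a b : ℕ) .{{_ : NonZero a}} .{{_ : NonZero b}} where

  folded : Weighted (ℤ × ℤ)
  folded = pull ℤ²-≟ (λ (t , y) → + 4 ℤ.* t ℤ.+ + 1 ℤ.- + 2 ℤ.* y , y) (λ (u , y) → (u ℤ.+ + 2 ℤ.* y) /ℕ 4 , y)
    (λ (t , y) → cong (_, y) (/ℕ-unique 4 t {1} (s≤s (s≤s z≤n)) (undo (+ 4 ℤ.* t ℤ.+ + 1) (+ 2 ℤ.* y)))) (Q a b)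
    where
    undo : ∀ s x → s ℤ.- x ℤ.+ x ≡ s
    undo = ℤ-solve-∀

  private
    ℤℕ-≟ : DecidableEquality (ℤ × ℕ)
    ℤℕ-≟ = ×-≡-dec ℤₚ._≟_ _≟_

  axis : Weighted ℤ
  axis = pull ℤₚ._≟_ (λ t → t , + 0) proj₁ (λ _ → refl) folded

  private
    above below : Weighted (ℤ × ℕ)
    above = pull ℤℕ-≟ (λ (t , m) → t , + suc m) (λ (t , y) → t , ∣ y ∣ ∸ 1) (λ _ → refl) folded
    below = pull ℤℕ-≟ (λ (t , m) → t , -[1+ m ]) (λ (t , y) → t , ∣ y ∣ ∸ 1) (λ _ → refl) folded

    above≈below : θ above ≈ θ below
    above≈below = θ-bijection above below (λ (t , m) → t ℤ.- + suc m , m) (λ (t , m) → t ℤ.+ + suc m , m)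
      (λ (t , m) → cong (_, m) (undo t (+ suc m))) (λ (t , m) → cong (_, m) (undo′ t (+ suc m)))
      (λ (t , m) → ℤₚ.+-injective (trans (Q-ℤ a b (+ 4 ℤ.* (t ℤ.- + suc m) ℤ.+ + 1 ℤ.- + 2 ℤ.* -[1+ m ]) -[1+ m ]) (trans (identity (+ a) (+ b) t (+ suc m)) (sym (Q-ℤ a b (+ 4 ℤ.* t ℤ.+ + 1 ℤ.- + 2 ℤ.* + suc m) (+ suc m))))))
      where
      undo : ∀ t y → t ℤ.- y ℤ.+ y ≡ t
      undo = ℤ-solve-∀
      undo′ : ∀ t y → t ℤ.+ y ℤ.- y ≡ t
      undo′ = ℤ-solve-∀
      identity : ∀ a b t y → let u = + 4 ℤ.* (t ℤ.- y) ℤ.+ + 1 ℤ.- + 2 ℤ.* ℤ.- y ; u′ = + 4 ℤ.* t ℤ.+ + 1 ℤ.- + 2 ℤ.* y in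
        a ℤ.* (u ℤ.* u) ℤ.+ b ℤ.* (ℤ.- y ℤ.* ℤ.- y) ≡ a ℤ.* (u′ ℤ.* u′) ℤ.+ b ℤ.* (y ℤ.* y)
      identity = ℤ-solve-∀

    unfold : ℤ × ℤ → ℤ ⊎ ((ℤ × ℕ) ⊎ (ℤ × ℕ))
    unfold (t , + zero) = inj₁ t
    unfold (t , + suc m) = inj₂ (inj₁ (t , m))
    unfold (t , -[1+ m ]) = inj₂ (inj₂ (t , m))

    refold : ℤ ⊎ ((ℤ × ℕ) ⊎ (ℤ × ℕ)) → ℤ × ℤ
    refold (inj₁ t) = t , + 0
    refold (inj₂ (inj₁ (t , m))) = t , + suc m
    refold (inj₂ (inj₂ (t , m))) = t , -[1+ m ]

  fold : θ folded ≈ θ axis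
  fold = begin
    θ folded ≈⟨ θ-bijection folded (axis ⊎ʷ (above ⊎ʷ below)) unfold refold
      (λ { (t , + zero) → refl ; (t , + suc m) → refl ; (t , -[1+ m ]) → refl })
      (λ { (inj₁ t) → refl ; (inj₂ (inj₁ _)) → refl ; (inj₂ (inj₂ _)) → refl })
      (λ { (t , + zero) → refl ; (t , + suc m) → refl ; (t , -[1+ m ]) → refl }) ⟩
    θ (axis ⊎ʷ (above ⊎ʷ below)) ≈⟨ ≈-trans (θ-⊎ axis _) (⊕-cong ≈-refl (≈-trans (θ-⊎ above below) (⊕-cong above≈below ≈-refl))) ⟩
    θ axis ⊕ (θ below ⊕ θ below) ≈⟨ solve 2 (λ x y → x :+ (y :+ y) := x) ≈-refl (θ axis) (θ below) ⟩
    θ axis ∎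
    where open ≈R

-- Triangular numbers and the key identity

even-or-odd : ∀ n → (∃ λ m → n ≡ 2 * m) ⊎ (∃ λ m → n ≡ suc (2 * m))
even-or-odd zero = inj₁ (0 , refl)
even-or-odd (suc n) with even-or-odd n
... | inj₁ (m , e) = inj₂ (m , cong suc e)
... | inj₂ (m , e) = inj₁ (suc m , trans (cong suc e) (sym (double-suc m)))

θ-square : ∀ {A : Set} (w : Weighted A) → θ w · θ w ≈ θ (affine 2 0 w)
θ-square w = pointwise (λ n → go n (even-or-odd n))
  where
  go : ∀ n → (∃ λ m → n ≡ 2 * m) ⊎ (∃ λ m → n ≡ suc (2 * m)) → coeff (θ w · θ w) n ≡ coeff (θ (affine 2 0 w)) n
  go _ (inj₁ (m , refl)) = trans (square-even (θ w) m) (trans (sym (θ-affine 2 0 w m)) (cong (coeff (θ (affine 2 0 w))) (+-identityʳ (2 * m))))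
  go _ (inj₂ (m , refl)) = trans (square-odd (θ w) m) (sym (θ-none (affine 2 0 w) _ (λ x e → even≢odd (wt w x) m (trans (sym (+-identityʳ _)) e))))

-- t(2t+1), which runs through the triangular numbers as t runs through ℤ
tri : ℤ → ℕ
tri (+ n) = n * (2 * n + 1)
tri -[1+ n ] = suc n * (2 * n + 1)

tri-ℤ : ∀ t → + tri t ≡ t ℤ.* (+ 2 ℤ.* t ℤ.+ + 1)
tri-ℤ (+ n) = trans (ℤₚ.pos-* n (2 * n + 1)) (cong (λ z → + n ℤ.* (z ℤ.+ + 1)) (ℤₚ.pos-* 2 n))
tri-ℤ -[1+ n ] = trans (ℤₚ.pos-* (suc n) (2 * n + 1)) (trans (cong (λ z → + suc n ℤ.* (z ℤ.+ + 1)) (ℤₚ.pos-* 2 n)) (identity (+ n)))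
  where
  identity : ∀ n → (+ 1 ℤ.+ n) ℤ.* (+ 2 ℤ.* n ℤ.+ + 1) ≡ ℤ.- (+ 1 ℤ.+ n) ℤ.* (+ 2 ℤ.* ℤ.- (+ 1 ℤ.+ n) ℤ.+ + 1)
  identity = ℤ-solve-∀

∣t∣≤tri : ∀ t → ∣ t ∣ ≤ tri t
∣t∣≤tri (+ n) = subst (λ k → n ≤ n * k) (+-comm 1 (2 * n)) (m≤m*n n (suc (2 * n)))
∣t∣≤tri -[1+ n ] = subst (λ k → suc n ≤ suc n * k) (+-comm 1 (2 * n)) (m≤m*n (suc n) (suc (2 * n)))

triangular : Weighted ℤ
triangular = record { wt = tri ; decEq = ℤₚ._≟_ ; upto = range ; complete = λ {n} t p → range-complete n t (≤-trans (∣t∣≤tri t) p) }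

affine-ℤ : ∀ k c x → + (k * x + c) ≡ + k ℤ.* + x ℤ.+ + c
affine-ℤ k c x = cong (λ z → z ℤ.+ + c) (ℤₚ.pos-* k x)

private
  axis-ℤ : ∀ a b .{{_ : NonZero a}} .{{_ : NonZero b}} t → + wt (Fold.axis a b) t ≡ + a ℤ.* (+ 8 ℤ.* + tri t ℤ.+ + 1)
  axis-ℤ a b t = trans (Q-ℤ a b (+ 4 ℤ.* t ℤ.+ + 1 ℤ.- + 2 ℤ.* + 0) (+ 0)) (trans (identity (+ a) (+ b) t) (cong (λ z → + a ℤ.* (+ 8 ℤ.* z ℤ.+ + 1)) (sym (tri-ℤ t))))
    where
    identity : ∀ a b t → let u = + 4 ℤ.* t ℤ.+ + 1 ℤ.- + 2 ℤ.* + 0 in a ℤ.* (u ℤ.* u) ℤ.+ b ℤ.* (+ 0 ℤ.* + 0) ≡ a ℤ.* (+ 8 ℤ.* (t ℤ.* (+ 2 ℤ.* t ℤ.+ + 1)) ℤ.+ + 1)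
    identity = ℤ-solve-∀

  swap-sub : ∀ m n → n ℤ.- (n ℤ.- m) ≡ m
  swap-sub = ℤ-solve-∀

  shear : ℤ × ℤ → ℤ × ℤ
  shear (m , n) = n , n ℤ.- m

  unshear : ℤ × ℤ → ℤ × ℤ
  unshear (n , v) = n ℤ.- v , n

-- Origin of the constants: 24 pent m + 1 = (6m+1)², and with s = 6n + 1, v = n - m one has 6m + 1 =
-- s - 6v. For l = 2 and l = 5 the sum (6m+1)² + l(6n+1)² equals (l+1)(s² - 2csv + 6cv²) with c =
-- 6/(l+1), that is c = 2 for E · E² and c = 1 for E · E₅. Then k = 6c - c² is 8 and 5.
module F₂ = Form 2 8 refl
module F₁ = Form 1 5 refl

-- 8 (pent m + 2 pent n) + 1 is the form with c = 2 at s = 6n + 1, v = n - m.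
E³≈triangular : E · (E · E) ≈ θ triangular
E³≈triangular = begin
  E · (E · E) ≈⟨ ·-cong pentagonal-theorem E·E≈ ⟩
  θ pentagonal · θ 2×pentagonal ≈⟨ θ-× pentagonal 2×pentagonal ⟩
  θ (pentagonal ×ʷ 2×pentagonal) ≈⟨ θ-affine-injective 8 1 {pentagonal ×ʷ 2×pentagonal} {triangular} scaled ⟩
  θ triangular ∎
  where
  open ≈R
  E·E≈ : E · E ≈ θ 2×pentagonal
  E·E≈ = ≈-trans (·-cong pentagonal-theorem pentagonal-theorem) (θ-square pentagonal)
  shear-wt : ∀ x → wt F₂.X (shear x) ≡ wt (affine 8 1 (pentagonal ×ʷ 2×pentagonal)) x
  shear-wt (m , n) = ℤₚ.+-injective (trans (F₂.form-ℤ (+ 6 ℤ.* n ℤ.+ + 1) (n ℤ.- m)) (trans (identity m n) (sym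
      (trans (affine-ℤ 8 1 (pent m + 2pent n)) (trans (expand (+ pent m) (+ 2pent n)) (cong₂ (λ x y → + 4 ℤ.* x ℤ.+ + 8 ℤ.* y ℤ.+ + 1) (double-pent m) (2pent-ℤ n)))))))
    where
    expand : ∀ p r → + 8 ℤ.* (p ℤ.+ r) ℤ.+ + 1 ≡ + 4 ℤ.* (+ 2 ℤ.* p) ℤ.+ + 8 ℤ.* r ℤ.+ + 1
    expand = ℤ-solve-∀
    identity : ∀ m n → let s = + 6 ℤ.* n ℤ.+ + 1 ; v = n ℤ.- m in
      s ℤ.* s ℤ.- + 2 ℤ.* + 2 ℤ.* s ℤ.* v ℤ.+ + 6 ℤ.* + 2 ℤ.* (v ℤ.* v) ≡ + 4 ℤ.* (m ℤ.* (+ 3 ℤ.* m ℤ.+ + 1)) ℤ.+ + 8 ℤ.* (n ℤ.* (+ 3 ℤ.* n ℤ.+ + 1)) ℤ.+ + 1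
    identity = ℤ-solve-∀
  scaled : θ (affine 8 1 (pentagonal ×ʷ 2×pentagonal)) ≈ θ (affine 8 1 triangular)
  scaled = begin
    θ (affine 8 1 (pentagonal ×ʷ 2×pentagonal)) ≈⟨ θ-bijection (affine 8 1 (pentagonal ×ʷ 2×pentagonal)) F₂.X shear unshear (λ (m , n) → cong (_, n) (swap-sub m n)) (λ (n , v) → cong (n ,_) (swap-sub v n)) shear-wt ⟩
    θ F₂.X ≈⟨ F₂.θX≈θY ⟩
    θ F₂.Y ≈⟨ θ-bijection F₂.Y (Fold.folded 1 8) id id (λ _ → refl) (λ _ → refl) (λ _ → refl) ⟩
    θ (Fold.folded 1 8) ≈⟨ Fold.fold 1 8 ⟩
    θ (Fold.axis 1 8) ≈⟨ θ-bijection (Fold.axis 1 8) (affine 8 1 triangular) id id (λ _ → refl) (λ _ → refl)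
      (λ t → ℤₚ.+-injective (trans (affine-ℤ 8 1 (tri t)) (sym (trans (axis-ℤ 1 8 t) (ℤₚ.*-identityˡ _))))) ⟩
    θ (affine 8 1 triangular) ∎

5×pentagonal : Weighted ℤ
5×pentagonal = affine 5 0 pentagonal

-- 4 (pent m + 5 pent n) + 1 is the form with c = 1 at s = 6n + 1, v = n - m.
E·5×pentagonal≈triangular : E · θ 5×pentagonal ≈ θ (affine 2 0 triangular) ⊕ θ (affine 10 1 triangular)
E·5×pentagonal≈triangular = begin
  E · θ 5×pentagonal ≈⟨ ·-cong pentagonal-theorem ≈-refl ⟩
  θ pentagonal · θ 5×pentagonal ≈⟨ θ-× pentagonal 5×pentagonal ⟩
  θ (pentagonal ×ʷ 5×pentagonal) ≈⟨ θ-affine-injective 4 1 {pentagonal ×ʷ 5×pentagonal} {affine 2 0 triangular ⊎ʷ affine 10 1 triangular} scaled ⟩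
  θ (affine 2 0 triangular ⊎ʷ affine 10 1 triangular) ≈⟨ θ-⊎ _ _ ⟩
  θ (affine 2 0 triangular) ⊕ θ (affine 10 1 triangular) ∎
  where
  open ≈R
  shear-wt : ∀ x → wt F₁.X (shear x) ≡ wt (affine 4 1 (pentagonal ×ʷ 5×pentagonal)) x
  shear-wt (m , n) = ℤₚ.+-injective (trans (F₁.form-ℤ (+ 6 ℤ.* n ℤ.+ + 1) (n ℤ.- m)) (trans (identity m n) (sym
      (trans (affine-ℤ 4 1 (pent m + (5 * pent n + 0))) (trans (cong (λ z → + 4 ℤ.* (+ pent m ℤ.+ z) ℤ.+ + 1) (affine-ℤ 5 0 (pent n)))
        (trans (expand (+ pent m) (+ pent n)) (cong₂ (λ x y → + 2 ℤ.* x ℤ.+ + 10 ℤ.* y ℤ.+ + 1) (double-pent m) (double-pent n))))))))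
    where
    expand : ∀ p r → + 4 ℤ.* (p ℤ.+ (+ 5 ℤ.* r ℤ.+ + 0)) ℤ.+ + 1 ≡ + 2 ℤ.* (+ 2 ℤ.* p) ℤ.+ + 10 ℤ.* (+ 2 ℤ.* r) ℤ.+ + 1
    expand = ℤ-solve-∀
    identity : ∀ m n → let s = + 6 ℤ.* n ℤ.+ + 1 ; v = n ℤ.- m in
      s ℤ.* s ℤ.- + 2 ℤ.* + 1 ℤ.* s ℤ.* v ℤ.+ + 6 ℤ.* + 1 ℤ.* (v ℤ.* v) ≡ + 2 ℤ.* (m ℤ.* (+ 3 ℤ.* m ℤ.+ + 1)) ℤ.+ + 10 ℤ.* (n ℤ.* (+ 3 ℤ.* n ℤ.+ + 1)) ℤ.+ + 1
    identity = ℤ-solve-∀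
  -- With v = 2y the form (s - v)² + 5v² becomes u² + 20y² with u = 4t + 1 - 2y, which is the shape
  -- treated by `Fold`.
  v-even : θ (residueClass₂ 2 F₁.Y zero) ≈ θ (Fold.folded 1 20)
  v-even = θ-bijection _ (Fold.folded 1 20) id id (λ _ → refl) (λ _ → refl)
    (λ (t , y) → ℤₚ.+-injective (trans (Q-ℤ 1 20 (+ 4 ℤ.* t ℤ.+ + 1 ℤ.- + 2 ℤ.* y) y) (trans (identity t y) (sym (F₁.form-ℤ (+ 4 ℤ.* t ℤ.+ + 1) (+ 2 ℤ.* y ℤ.+ + 0))))))
    where
    identity : ∀ t y → let u = + 4 ℤ.* t ℤ.+ + 1 ℤ.- + 2 ℤ.* y ; s = + 4 ℤ.* t ℤ.+ + 1 ; v = + 2 ℤ.* y ℤ.+ + 0 in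
      + 1 ℤ.* (u ℤ.* u) ℤ.+ + 20 ℤ.* (y ℤ.* y) ≡ s ℤ.* s ℤ.- + 2 ℤ.* + 1 ℤ.* s ℤ.* v ℤ.+ + 6 ℤ.* + 1 ℤ.* (v ℤ.* v)
    identity = ℤ-solve-∀
  -- Here s - v = 2z with z = 2t - y, so that the roles of the two squares are exchanged.
  v-odd : θ (residueClass₂ 2 F₁.Y (suc zero)) ≈ θ (Fold.folded 5 4)
  v-odd = θ-bijection _ (Fold.folded 5 4) flip flip flip-involutive flip-involutive
    (λ (t , y) → ℤₚ.+-injective (trans (Q-ℤ 5 4 (+ 4 ℤ.* t ℤ.+ + 1 ℤ.- + 2 ℤ.* (+ 2 ℤ.* t ℤ.- y)) (+ 2 ℤ.* t ℤ.- y)) (trans (identity t y) (sym (F₁.form-ℤ (+ 4 ℤ.* t ℤ.+ + 1) (+ 2 ℤ.* y ℤ.+ + 1))))))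
    where
    flip : ℤ × ℤ → ℤ × ℤ
    flip (t , y) = t , + 2 ℤ.* t ℤ.- y
    flip-involutive : ∀ x → flip (flip x) ≡ x
    flip-involutive (t , y) = cong (t ,_) (swap-sub y (+ 2 ℤ.* t))
    identity : ∀ t y → let z = + 2 ℤ.* t ℤ.- y ; u = + 4 ℤ.* t ℤ.+ + 1 ℤ.- + 2 ℤ.* z ; s = + 4 ℤ.* t ℤ.+ + 1 ; v = + 2 ℤ.* y ℤ.+ + 1 in
      + 5 ℤ.* (u ℤ.* u) ℤ.+ + 4 ℤ.* (z ℤ.* z) ≡ s ℤ.* s ℤ.- + 2 ℤ.* + 1 ℤ.* s ℤ.* v ℤ.+ + 6 ℤ.* + 1 ℤ.* (v ℤ.* v)
    identity = ℤ-solve-∀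
  -- The surviving points have values (4t+1)² and 5(4t+1)², where (4t+1)² = 8 tri t + 1. Read as 4x
  -- + 1 they give x = 2 tri t and x = 10 tri t + 1, the exponents of E⁶ and q E₅⁶.
  axes : ∀ y → wt (affine 4 1 (affine 2 0 triangular ⊎ʷ affine 10 1 triangular)) y ≡ wt (Fold.axis 1 20 ⊎ʷ Fold.axis 5 4) y
  axes (inj₁ t) = ℤₚ.+-injective (trans (trans (affine-ℤ 4 1 (2 * tri t + 0)) (cong (λ z → + 4 ℤ.* z ℤ.+ + 1) (affine-ℤ 2 0 (tri t)))) (trans (identity (+ tri t)) (sym (axis-ℤ 1 20 t))))
    where
    identity : ∀ x → + 4 ℤ.* (+ 2 ℤ.* x ℤ.+ + 0) ℤ.+ + 1 ≡ + 1 ℤ.* (+ 8 ℤ.* x ℤ.+ + 1)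
    identity = ℤ-solve-∀
  axes (inj₂ t) = ℤₚ.+-injective (trans (trans (affine-ℤ 4 1 (10 * tri t + 1)) (cong (λ z → + 4 ℤ.* z ℤ.+ + 1) (affine-ℤ 10 1 (tri t)))) (trans (identity (+ tri t)) (sym (axis-ℤ 5 4 t))))
    where
    identity : ∀ x → + 4 ℤ.* (+ 10 ℤ.* x ℤ.+ + 1) ℤ.+ + 1 ≡ + 5 ℤ.* (+ 8 ℤ.* x ℤ.+ + 1)
    identity = ℤ-solve-∀
  scaled : θ (affine 4 1 (pentagonal ×ʷ 5×pentagonal)) ≈ θ (affine 4 1 (affine 2 0 triangular ⊎ʷ affine 10 1 triangular))
  scaled = begin
    θ (affine 4 1 (pentagonal ×ʷ 5×pentagonal)) ≈⟨ θ-bijection (affine 4 1 (pentagonal ×ʷ 5×pentagonal)) F₁.X shear unshear (λ (m , n) → cong (_, n) (swap-sub m n)) (λ (n , v) → cong (n ,_) (swap-sub v n)) shear-wt ⟩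
    θ F₁.X ≈⟨ F₁.θX≈θY ⟩
    θ F₁.Y ≈⟨ θ-residues₂ 2 F₁.Y ⟩
    ∑ˢ (allFin 2) (λ r → θ (residueClass₂ 2 F₁.Y r)) ≈⟨ pointwise (λ n → cong₂ _xor_ (at v-even n) (trans (xor-identityʳ _) (at v-odd n))) ⟩
    θ (Fold.folded 1 20) ⊕ θ (Fold.folded 5 4) ≈⟨ ⊕-cong (Fold.fold 1 20) (Fold.fold 5 4) ⟩
    θ (Fold.axis 1 20) ⊕ θ (Fold.axis 5 4) ≈⟨ ≈-sym (θ-⊎ (Fold.axis 1 20) (Fold.axis 5 4)) ⟩
    θ (Fold.axis 1 20 ⊎ʷ Fold.axis 5 4) ≈⟨ θ-bijection (Fold.axis 1 20 ⊎ʷ Fold.axis 5 4) (affine 4 1 (affine 2 0 triangular ⊎ʷ affine 10 1 triangular)) id id (λ _ → refl) (λ _ → refl) axes ⟩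
    θ (affine 4 1 (affine 2 0 triangular ⊎ʷ affine 10 1 triangular)) ∎

-- The substitution of q^k for q and sections

-- f(q^k)
dil : ∀ k .{{_ : NonZero k}} → Ser → Ser
coeff (dil k f) n = (n % k ≡ᵇ 0) ∧ coeff f (n / k)

section : ℕ → ℕ → Ser → Ser
coeff (section k r f) n = coeff f (k * n + r)

constant-coeff-0 : ∀ c → coeff (constant c) 0 ≡ c
constant-coeff-0 true = refl
constant-coeff-0 false = refl

constant-coeff-suc : ∀ c n → coeff (constant c) (suc n) ≡ false
constant-coeff-suc true n = refl
constant-coeff-suc false n = refl

constant·-at : ∀ c f n → coeff (constant c · f) n ≡ c ∧ coeff f n
constant·-at true f n = at (·-identityˡ f) n
constant·-at false f n = at (·-zeroˡ f) n

module _ (k : ℕ) .{{k≢0 : NonZero k}} where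

  dil-unfold : ∀ f → dil k f ≈ constant (coeff f 0) ⊕ q^ k · dil k (tail f)
  dil-unfold f = pointwise go
    where
    low : ∀ n → n < k → (n ≡ᵇ 0) ∧ coeff f 0 ≡ coeff (constant (coeff f 0)) n
    low zero _ = sym (constant-coeff-0 (coeff f 0))
    low (suc n) _ = sym (constant-coeff-suc (coeff f 0) n)
    high : ∀ m → coeff (dil k f) (k + m) ≡ coeff (constant (coeff f 0)) (k + m) xor coeff (q^ k · dil k (tail f)) (k + m)
    high m = trans (cong₂ (λ r d → (r ≡ᵇ 0) ∧ coeff f d) (trans (cong (_% k) (+-comm k m)) ([m+n]%n≡m%n m k))
        (trans (+-distrib-/-∣ˡ {k} m {k} ∣-refl) (cong (_+ m / k) (n/n≡1 k))))
      (sym (trans (cong₂ _xor_ (vanish (k + m) (≤-trans (>-nonZero⁻¹ k) (m≤m+n k m))) (q^·-at-+ k (dil k (tail f)) m)) refl))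
      where
      vanish : ∀ n → 0 < n → coeff (constant (coeff f 0)) n ≡ false
      vanish (suc n) _ = constant-coeff-suc (coeff f 0) n
    go : ∀ n → coeff (dil k f) n ≡ coeff (constant (coeff f 0)) n xor coeff (q^ k · dil k (tail f)) n
    go n with n <? k
    ... | yes n<k = trans (cong₂ (λ r d → (r ≡ᵇ 0) ∧ coeff f d) (m<n⇒m%n≡m n<k) (m<n⇒m/n≡0 n<k))
          (trans (low n n<k) (sym (trans (cong (coeff (constant (coeff f 0)) n xor_) (q^·-at-< k (dil k (tail f)) n<k)) (xor-identityʳ _))))
    ... | no n≮k = subst (λ n → coeff (dil k f) n ≡ coeff (constant (coeff f 0)) n xor coeff (q^ k · dil k (tail f)) n) (m+[n∸m]≡n (≮⇒≥ n≮k)) (high (n ∸ k))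

  -- Multiplication by a series in q^k does not mix the residue classes of exponents modulo k. The
  -- induction peels off the constant term of g; what remains is q^k times a product of the same
  -- kind.
  section-dil : ∀ f g r → r < k → section k r (f · dil k g) ≈ section k r f · g
  section-dil f g r r<k = pointwise (λ n → go n g)
    where
    open ≡-Reasoning
    expand : ∀ g n → coeff (f · dil k g) n ≡ (coeff g 0 ∧ coeff f n) xor coeff (q^ k · (f · dil k (tail g))) n
    expand g n = trans (at (≈-trans (·-cong ≈-refl (dil-unfold g))
        (solve 4 (λ f c x d → f :* (c :+ x :* d) := c :* f :+ x :* (f :* d)) ≈-refl f (constant (coeff g 0)) (q^ k) (dil k (tail g)))) n)
      (cong (_xor coeff (q^ k · (f · dil k (tail g))) n) (constant·-at (coeff g 0) f n))
    go : ∀ n g → coeff (f · dil k g) (k * n + r) ≡ coeff (section k r f · g) n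
    go zero g = begin
      coeff (f · dil k g) (k * 0 + r) ≡⟨ expand g (k * 0 + r) ⟩
      (coeff g 0 ∧ coeff f (k * 0 + r)) xor coeff (q^ k · (f · dil k (tail g))) (k * 0 + r)
        ≡⟨ cong ((coeff g 0 ∧ coeff f (k * 0 + r)) xor_) (q^·-at-< k (f · dil k (tail g)) (subst (_< k) (cong (_+ r) (sym (*-zeroʳ k))) r<k)) ⟩
      (coeff g 0 ∧ coeff f (k * 0 + r)) xor false ≡⟨ xor-identityʳ _ ⟩
      coeff g 0 ∧ coeff f (k * 0 + r) ≡⟨ ∧-comm (coeff g 0) _ ⟩
      coeff f (k * 0 + r) ∧ coeff g 0 ∎
    go (suc n) g = begin
      coeff (f · dil k g) (k * suc n + r) ≡⟨ expand g (k * suc n + r) ⟩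
      (coeff g 0 ∧ coeff f (k * suc n + r)) xor coeff (q^ k · (f · dil k (tail g))) (k * suc n + r)
        ≡⟨ cong ((coeff g 0 ∧ coeff f (k * suc n + r)) xor_) (trans (cong (coeff (q^ k · (f · dil k (tail g)))) (trans (cong (_+ r) (*-suc k n)) (+-assoc k (k * n) r)))
             (trans (q^·-at-+ k (f · dil k (tail g)) (k * n + r)) (trans (go n (tail g)) (at (·-comm (section k r f) (tail g)) n)))) ⟩
      (coeff g 0 ∧ coeff f (k * suc n + r)) xor coeff (tail g · section k r f) n ≡⟨ at (·-comm g (section k r f)) (suc n) ⟩
      coeff (section k r f · g) (suc n) ∎

  private
    div-mod : ∀ n → k * (n / k) + n % k ≡ n
    div-mod n = trans (+-comm (k * (n / k)) (n % k)) (trans (cong (λ x → n % k + x) (*-comm k (n / k))) (sym (m≡m%n+[m/n]*n n k)))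

    at-kn+r : ∀ {f g} → (∀ r → r < k → section k r f ≈ section k r g) → f ≈ g
    at-kn+r {f} {g} h = pointwise (λ n → subst (λ n → coeff f n ≡ coeff g n) (div-mod n) (at (h (n % k) (m%n<n n k)) (n / k)))

  section-cong : ∀ {f g} r → f ≈ g → section k r f ≈ section k r g
  section-cong r h = pointwise (λ n → at h (k * n + r))

  section-𝟙 : ∀ r → r < k → section k r 𝟙 ≈ constant (r ≡ᵇ 0)
  section-𝟙 zero _ = pointwise go
    where
    go : ∀ n → (k * n + 0 ≡ᵇ 0) ≡ (n ≡ᵇ 0)
    go zero = cong (λ x → x + 0 ≡ᵇ 0) (*-zeroʳ k)
    go (suc n) = positive (k * suc n + 0) (≤-trans (>-nonZero⁻¹ k) (≤-trans (≤-trans (m≤m+n k (k * n)) (≤-reflexive (sym (*-suc k n)))) (m≤m+n _ 0)))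
      where
      positive : ∀ m → 0 < m → (m ≡ᵇ 0) ≡ false
      positive (suc m) _ = refl
  section-𝟙 (suc r) _ = pointwise (λ n → cong (_≡ᵇ 0) (+-suc (k * n) r))

  section-of-dil : ∀ r → r < k → ∀ f → section k r (dil k f) ≈ constant (r ≡ᵇ 0) · f
  section-of-dil r r<k f = ≈-trans (section-cong r (≈-sym (·-identityˡ (dil k f)))) (≈-trans (section-dil 𝟙 f r r<k) (·-cong (section-𝟙 r r<k) ≈-refl))

  dil-at : ∀ f n → coeff (dil k f) (k * n + 0) ≡ coeff f n
  dil-at f n = trans (at (section-of-dil 0 (>-nonZero⁻¹ k) f) n) (at (·-identityˡ f) n)

  dil-none : ∀ f n r → suc r < k → coeff (dil k f) (k * n + suc r) ≡ false
  dil-none f n r r<k = trans (at (section-of-dil (suc r) r<k f) n) (at (·-zeroˡ f) n)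

  -- Compared class by class: by `section-dil` both sides have the component f · g for r = 0 and 0
  -- for every other r.
  dil-· : ∀ f g → dil k (f · g) ≈ dil k f · dil k g
  dil-· f g = at-kn+r (λ r r<k → ≈-trans (section-of-dil r r<k (f · g)) (≈-trans (≈-sym (·-assoc _ f g))
    (≈-trans (·-cong (≈-sym (section-of-dil r r<k f)) ≈-refl) (≈-sym (section-dil (dil k f) g r r<k)))))

  dil-⊕ : ∀ f g → dil k (f ⊕ g) ≈ dil k f ⊕ dil k g
  dil-⊕ f g = pointwise (λ n → ∧-distribˡ-xor (n % k ≡ᵇ 0) (coeff f (n / k)) (coeff g (n / k)))

  dil-cong : ∀ {f g} → f ≈ g → dil k f ≈ dil k g
  dil-cong h = pointwise (λ n → cong ((n % k ≡ᵇ 0) ∧_) (at h (n / k)))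

  dil-cong[] : ∀ {f g N} → f ≈[ N ] g → dil k f ≈[ N ] dil k g
  dil-cong[] h = pointwise≤ (λ {n} n≤N → cong ((n % k ≡ᵇ 0) ∧_) (at≤ h (≤-trans (m/n≤m n k) n≤N)))

  private
    tail-q^ : ∀ j → tail (q^ (suc j)) ≈ q^ j
    tail-q^ j = pointwise (λ _ → refl)

  dil-q^ : ∀ j → dil k (q^ j) ≈ q^ (k * j)
  dil-q^ zero = ≈-trans (at-kn+r (λ r r<k → ≈-trans (section-of-dil r r<k 𝟙) (≈-trans (·-identityʳ _) (≈-sym (section-𝟙 r r<k))))) (q^-≡ (sym (*-zeroʳ k)))
  dil-q^ (suc j) = ≈-trans (dil-unfold (q^ (suc j))) (≈-trans (pointwise (λ _ → refl)) (≈-trans (·-cong ≈-refl (≈-trans (dil-cong (tail-q^ j)) (dil-q^ j))) (≈-trans (q^-* k (k * j)) (q^-≡ (sym (*-suc k j))))))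

  dil-1+q^ : ∀ j → dil k (1+q^ j) ≈ 1+q^ (k * j)
  dil-1+q^ j = ≈-trans (dil-⊕ 𝟙 (q^ j)) (⊕-cong (≈-trans (dil-q^ 0) (q^-≡ (*-zeroʳ k))) (dil-q^ j))

  private
    N<k[N+1] : ∀ N → N < k * suc N
    N<k[N+1] N = m≤n*m (suc N) k

  1+q^-dil-unital : Unital (λ j → 1+q^ (k * j))
  1+q^-dil-unital N = q^-unit N (k * suc N) (N<k[N+1] N)

  geom-dil-unital : Unital (λ j → geom₂ (k * j))
  geom-dil-unital N = geom-unit N (k * suc N) (N<k[N+1] N)

  ∏∞-dil : ∏∞ (λ j → 1+q^ (k * j)) ≈ dil k E
  ∏∞-dil = ≈[]⇒≈ (λ N → ≈[]-trans (∏∞-≈ 1+q^-dil-unital N) (≈[]-trans (≈⇒≈[] (≈-sym (finite N))) (dil-cong[] (≈[]-sym (E≈Eₙ N)))))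
    where
    finite : ∀ N → dil k (Eₙ N) ≈ ∏ (λ j → 1+q^ (k * j)) N
    finite zero = ≈-trans (dil-q^ 0) (q^-≡ (*-zeroʳ k))
    finite (suc N) = ≈-trans (dil-· (Eₙ N) (1+q^ (suc N))) (·-cong (finite N) (dil-1+q^ (suc N)))

  dil-E·P : dil k E · dil k P ≈ 𝟙
  dil-E·P = ≈-trans (≈-sym (dil-· E P)) (≈-trans (dil-cong E·P) (≈-trans (dil-q^ 0) (q^-≡ (*-zeroʳ k))))

  -- Both sides are inverse to `dil k E`, the left one factor by factor; uniqueness of inverses
  -- replaces a computation with dilated geometric series.
  ∏∞-geom-dil : ∏∞ (λ j → geom₂ (k * j)) ≈ dil k P
  ∏∞-geom-dil = ·-cancel-inverse dil-E·P (≈-trans (·-cong (≈-sym ∏∞-dil) ≈-refl)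
    (≈-trans (≈-sym (∏∞-· 1+q^-dil-unital geom-dil-unital)) (≈-trans (∏∞-cong inverse) (≈-trans ∏∞-one (≈-sym dil-E·P)))))
    where
    pos-inverse : ∀ m → 0 < m → 1+q^ m · geom₂ m ≈ 𝟙
    pos-inverse (suc m) _ = 1+q^-geom m
    inverse : ∀ j → 1+q^ (k * suc j) · geom₂ (k * suc j) ≈ 𝟙
    inverse j = pos-inverse (k * suc j) (≤-<-trans z≤n (N<k[N+1] j))

  θ-dil : ∀ {A : Set} (w : Weighted A) → θ (affine k 0 w) ≈ dil k (θ w)
  θ-dil w = at-kn+r go
    where
    go : ∀ r → r < k → section k r (θ (affine k 0 w)) ≈ section k r (dil k (θ w))
    go zero _ = pointwise (λ n → trans (θ-affine k 0 w n) (sym (dil-at (θ w) n)))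
    go (suc r) r<k = pointwise (λ n → trans (θ-none (affine k 0 w) (k * n + suc r) (λ x e → contradiction (proj₂ (ℕ-quotient-unique k (wt w x) n (>-nonZero⁻¹ k) r<k e)) (λ ())))
      (sym (dil-none (θ w) n r r<k)))

-- 2-dissection: in characteristic 2 the squares are the even series.
module _ {h A B : Ser} (split : h ≈ A · A ⊕ q^ 1 · (B · B)) where

  dissect-even : ∀ n → coeff h (2 * n) ≡ coeff A n
  dissect-even n = trans (at split (2 * n)) (trans (cong₂ _xor_ (square-even A n) (odd-part n)) (xor-identityʳ _))
    where
    odd-part : ∀ n → coeff (q^ 1 · (B · B)) (2 * n) ≡ false
    odd-part zero = refl
    odd-part (suc n) = trans (cong (coeff (q^ 1 · (B · B))) (double-suc n)) (trans (q^·-at-+ 1 (B · B) (suc (2 * n))) (square-odd B n))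

  dissect-odd : ∀ n → coeff h (suc (2 * n)) ≡ coeff B n
  dissect-odd n = trans (at split (suc (2 * n))) (cong₂ _xor_ (square-odd A n) (trans (q^·-at-+ 1 (B · B) (2 * n)) (square-even B n)))

-- Dissection of G

E₅ P₅ : Ser
E₅ = dil 5 E
P₅ = dil 5 P

E₅·P₅ : E₅ · P₅ ≈ 𝟙
E₅·P₅ = dil-E·P 5

E³ E₅³ : Ser
E³ = E · (E · E)
E₅³ = E₅ · (E₅ · E₅)

dil-E³ : dil 5 E³ ≈ E₅³
dil-E³ = ≈-trans (dil-· 5 E (E · E)) (·-cong ≈-refl (dil-· 5 E E))

θ-10 : ∀ {A : Set} (w : Weighted A) → θ (affine 10 0 w) ≈ dil 5 (θ w) · dil 5 (θ w)
θ-10 w = ≈-sym (≈-trans (·-cong (≈-sym (θ-dil 5 w)) (≈-sym (θ-dil 5 w))) (≈-trans (θ-square (affine 5 0 w))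
  (θ-bijection (affine 2 0 (affine 5 0 w)) (affine 10 0 w) id id (λ _ → refl) (λ _ → refl) (λ x → identity (wt w x)))))
  where
  identity : ∀ x → 10 * x + 0 ≡ 2 * (5 * x + 0) + 0
  identity = solve-∀

θ-10-1 : ∀ {A : Set} (w : Weighted A) → θ (affine 10 1 w) ≈ q^ 1 · θ (affine 10 0 w)
θ-10-1 w = pointwise go
  where
  suc-form : ∀ x → 10 * x + 1 ≡ suc (10 * x + 0)
  suc-form x = +-suc (10 * x) 0
  go : ∀ n → coeff (θ (affine 10 1 w)) n ≡ coeff (q^ 1 · θ (affine 10 0 w)) n
  go zero = θ-none (affine 10 1 w) 0 (λ x e → contradiction (trans (sym (suc-form (wt w x))) e) (λ ()))
  go (suc n) = trans (θ-match (affine 10 1 w) (affine 10 0 w) (suc n) n id id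
      (λ x e → suc-injective (trans (sym (suc-form (wt w x))) e) , refl) (λ x e → trans (suc-form (wt w x)) (cong suc e) , refl))
    (sym (q^·-at-+ 1 (θ (affine 10 0 w)) n))

E·E₅-split : E · E₅ ≈ E³ · E³ ⊕ q^ 1 · (E₅³ · E₅³)
E·E₅-split = begin
  E · E₅ ≈⟨ ·-cong ≈-refl (≈-trans (dil-cong 5 pentagonal-theorem) (≈-sym (θ-dil 5 pentagonal))) ⟩
  E · θ 5×pentagonal ≈⟨ E·5×pentagonal≈triangular ⟩
  θ (affine 2 0 triangular) ⊕ θ (affine 10 1 triangular)
    ≈⟨ ⊕-cong (≈-sym (θ-square triangular)) (≈-trans (θ-10-1 triangular) (·-cong ≈-refl (θ-10 triangular))) ⟩
  θ triangular · θ triangular ⊕ q^ 1 · (dil 5 (θ triangular) · dil 5 (θ triangular))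
    ≈⟨ ⊕-cong (·-cong (≈-sym E³≈triangular) (≈-sym E³≈triangular)) (·-cong ≈-refl (·-cong to-E₅³ to-E₅³)) ⟩
  E³ · E³ ⊕ q^ 1 · (E₅³ · E₅³) ∎
  where
  open ≈R
  to-E₅³ : dil 5 (θ triangular) ≈ E₅³
  to-E₅³ = ≈-trans (dil-cong 5 (≈-sym E³≈triangular)) dil-E³

G C : Ser
G = E³ · (P₅ · (P₅ · P₅))
C = E · E · P₅

-- Multiply E·E₅-split by E² P₅⁴.
G-split : G ≈ (C · C) · (C · C) ⊕ q^ 1 · ((E · E₅) · (E · E₅))
G-split = begin
  E³ · (P₅ · (P₅ · P₅)) ≈⟨ ≈-trans (≈-sym (·-identityʳ _)) (·-cong ≈-refl (≈-sym E₅·P₅)) ⟩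
  E³ · (P₅ · (P₅ · P₅)) · (E₅ · P₅) ≈⟨ solve 3 (λ e f p → e :* (e :* e) :* (p :* (p :* p)) :* (f :* p) := e :* f :* (e :* e :* (p :* p :* (p :* p)))) ≈-refl E E₅ P₅ ⟩
  E · E₅ · (E · E · (P₅ · P₅ · (P₅ · P₅))) ≈⟨ ·-cong E·E₅-split ≈-refl ⟩
  (E³ · E³ ⊕ q^ 1 · (E₅³ · E₅³)) · (E · E · (P₅ · P₅ · (P₅ · P₅)))
    ≈⟨ solve 4 (λ e f p x → (e :* (e :* e) :* (e :* (e :* e)) :+ x :* (f :* (f :* f) :* (f :* (f :* f)))) :* (e :* e :* (p :* p :* (p :* p)))
         := (e :* e :* p :* (e :* e :* p)) :* (e :* e :* p :* (e :* e :* p)) :+ x :* ((e :* f) :* (e :* f)) :* ((f :* p :* (f :* p)) :* (f :* p :* (f :* p)))) ≈-refl E E₅ P₅ (q^ 1) ⟩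
  (C · C) · (C · C) ⊕ q^ 1 · ((E · E₅) · (E · E₅)) · ((E₅ · P₅ · (E₅ · P₅)) · (E₅ · P₅ · (E₅ · P₅)))
    ≈⟨ ⊕-cong ≈-refl (≈-trans (·-cong ≈-refl unit) (·-identityʳ _)) ⟩
  (C · C) · (C · C) ⊕ q^ 1 · ((E · E₅) · (E · E₅)) ∎
  where
  open ≈R
  unit : (E₅ · P₅ · (E₅ · P₅)) · (E₅ · P₅ · (E₅ · P₅)) ≈ 𝟙
  unit = ≈-trans (·-cong square square) (·-identityˡ 𝟙)
    where
    square : E₅ · P₅ · (E₅ · P₅) ≈ 𝟙
    square = ≈-trans (·-cong E₅·P₅ E₅·P₅) (·-identityˡ 𝟙)

-- In C = E² P₅ the factor P₅ is a series in q⁵, so it passes through the section and becomes P;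
-- what is dissected is E² = Σ q^(m(3m+1)).
C-section : ∀ r n → r < 5 → coeff C (5 * n + r) ≡ coeff (section 5 r (θ 2×pentagonal) · P) n
C-section r n r<5 = trans (at (section-dil 5 (E · E) P r r<5) n)
  (at (·-cong (section-cong 5 {E · E} {θ 2×pentagonal} r (≈-trans (·-cong pentagonal-theorem pentagonal-theorem) (θ-square pentagonal))) (≈-refl {P})) n)

-- Reduction of integer series modulo 2

odd : ℕ → Bool
odd zero = false
odd (suc n) = not (odd n)

odd-+ : ∀ m n → odd (m + n) ≡ odd m xor odd n
odd-+ zero n = refl
odd-+ (suc m) n = trans (cong not (odd-+ m n)) (not-distribˡ-xor (odd m) (odd n))

odd-* : ∀ m n → odd (m * n) ≡ odd m ∧ odd n
odd-* zero n = refl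
odd-* (suc m) n = trans (odd-+ n (m * n)) (trans (cong (odd n xor_) (odd-* m n)) (lemma (odd m) (odd n)))
  where
  lemma : ∀ a b → b xor (a ∧ b) ≡ not a ∧ b
  lemma true true = refl
  lemma true false = refl
  lemma false b = xor-identityʳ b

par : ℤ → Bool
par x = odd ∣ x ∣

par-⊖ : ∀ m n → par (m ⊖ n) ≡ odd m xor odd n
par-⊖ m zero = sym (xor-identityʳ (odd m))
par-⊖ zero (suc n) = refl
par-⊖ (suc m) (suc n) = trans (cong par (ℤₚ.[1+m]⊖[1+n]≡m⊖n m n)) (trans (par-⊖ m n) (sym (xor-annihilates-not (odd m) (odd n))))

par-+ : ∀ x y → par (x ℤ.+ y) ≡ par x xor par y
par-+ (+ m) (+ n) = odd-+ m n
par-+ (+ m) -[1+ n ] = par-⊖ m (suc n)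
par-+ -[1+ m ] (+ n) = trans (par-⊖ n (suc m)) (xor-comm (odd n) (odd (suc m)))
par-+ -[1+ m ] -[1+ n ] = trans (cong odd (cong suc (sym (+-suc m n)))) (odd-+ (suc m) (suc n))

par-* : ∀ x y → par (x ℤ.* y) ≡ par x ∧ par y
par-* x y = trans (cong odd (ℤₚ.abs-* x y)) (odd-* ∣ x ∣ ∣ y ∣)

par-neg : ∀ x → par (ℤ.- x) ≡ par x
par-neg x = cong odd (ℤₚ.∣-i∣≡∣i∣ x)

par-sgn : ∀ n → par (sgn n) ≡ true
par-sgn zero = refl
par-sgn (suc n) = trans (par-* (ℤ.- + 1) (sgn n)) (par-sgn n)

even⇒2∣ : ∀ n → odd n ≡ false → 2 ∣ℕ n
even⇒2∣ n e with even-or-odd n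
... | inj₁ (m , refl) = divides m (*-comm 2 m)
... | inj₂ (m , refl) = contradiction (trans (sym e) (cong not (odd-* 2 m))) (λ ())

2∣⇒even : ∀ n → 2 ∣ℕ n → odd n ≡ false
2∣⇒even n (divides m refl) = trans (odd-* m 2) (∧-zeroʳ (odd m))

par-difference : ∀ a b → par (a ℤ.- b) ≡ par a xor par b
par-difference a b = trans (par-+ a (ℤ.- b)) (cong (par a xor_) (par-neg b))

par⇒≡₂ : ∀ a b → par a ≡ par b → a ≡₂ b
par⇒≡₂ a b e = even⇒2∣ _ (trans (par-difference a b) (trans (cong (_xor par b) e) (xor-same (par b))))

≡₂⇒par : ∀ a b → a ≡₂ b → par a ≡ par b
≡₂⇒par a b d = xor≡false⇒≡ (trans (sym (par-difference a b)) (2∣⇒even _ d))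

mod2 : Series → Ser
coeff (mod2 s) n = par (s n)

par-sumTo : ∀ m f → par (sumTo m f) ≡ antidiag m (λ a _ → par (f a))
par-sumTo zero f = refl
par-sumTo (suc m) f = trans (par-+ (sumTo m f) (f (suc m))) (trans (cong (_xor par (f (suc m))) (par-sumTo m f)) (sym (antidiag-last m (λ a _ → par (f a)))))

mod2-⊗ : ∀ f g → mod2 (f ⊗ g) ≈ mod2 f · mod2 g
mod2-⊗ f g = pointwise (λ m → trans (par-sumTo m _) (antidiag-cong m (λ a b a+b≡m →
  trans (par-* (f a) (g (m ∸ a))) (cong (λ k → par (f a) ∧ par (g k)) (trans (cong (_∸ a) (sym a+b≡m)) (m+n∸m≡n a b))))))

mod2-one : mod2 one ≈ 𝟙
mod2-one = pointwise (λ { zero → refl ; (suc n) → refl })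

mod2-pow : ∀ s e → mod2 (pow s e) ≈ pow₂ (mod2 s) e
mod2-pow s zero = mod2-one
mod2-pow s (suc e) = ≈-trans (mod2-⊗ s (pow s e)) (·-cong ≈-refl (mod2-pow s e))

mod2-prodUpTo : ∀ t N → mod2 (prodUpTo t N) ≈ ∏ (λ k → mod2 (t k)) N
mod2-prodUpTo t zero = mod2-one
mod2-prodUpTo t (suc N) = ≈-trans (mod2-⊗ (prodUpTo t N) (t (suc N))) (·-cong (mod2-prodUpTo t N) ≈-refl)

mod2-infProd : ∀ t → mod2 (infProd t) ≈ ∏∞ (λ k → mod2 (t k))
mod2-infProd t = pointwise (λ n → at (mod2-prodUpTo t n) n)

mod2-oneMinus : ∀ k → 0 < k → mod2 (oneMinus k) ≈ 1+q^ k
mod2-oneMinus (suc k) _ = pointwise go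
  where
  go : ∀ n → par (oneMinus (suc k) n) ≡ coeff (1+q^ (suc k)) n
  go zero = refl
  go (suc n) with n ≡ᵇ k
  ... | true = refl
  ... | false = refl

par-if : ∀ b x → par (if b then x else + 0) ≡ b ∧ par x
par-if true x = refl
par-if false x = refl

mod2-geom : ∀ k → mod2 (geom k) ≈ geom₂ k
mod2-geom k = pointwise (λ n → trans (par-if (does (k ∣? n)) (+ 1)) (∧-identityʳ _))

-- The signs are odd numbers, so 1/(1 + q^k) and 1/(1 - q^k) agree modulo 2. This turns the
-- denominators (-q;q)_N of the mock theta functions into (q;q)_N.
mod2-altGeom : ∀ k → mod2 (altGeom (suc k)) ≈ geom₂ (suc k)
mod2-altGeom k = pointwise (λ n → trans (par-if (does (suc k ∣? n)) (sgn (n / suc k))) (trans (cong (does (suc k ∣? n) ∧_) (par-sgn (n / suc k))) (∧-identityʳ _)))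

mod2-shift : ∀ a s n → par (shift a s n) ≡ coeff (q^ a · mod2 s) n
mod2-shift a s n with a ≤ᵇ n in eq
... | true = sym (trans (cong (coeff (q^ a · mod2 s)) (sym (m+[n∸m]≡n (≤ᵇ⇒≤ a n (subst T (sym eq) tt))))) (q^·-at-+ a (mod2 s) (n ∸ a)))
... | false = sym (q^·-at-< a (mod2 s) (≰⇒> (λ a≤n → subst T eq (≤⇒≤ᵇ a≤n))))

mod2-invMinusPoch : ∀ N → mod2 (invMinusPoch N) ≈ Pₙ N
mod2-invMinusPoch N = ≈-trans (mod2-prodUpTo altGeom N) (∏-cong N mod2-altGeom)

module _ (d : ℕ) .{{_ : NonZero d}} (e : ℕ) where

  mod2-eulerPow : mod2 (eulerPow d e) ≈ pow₂ (∏∞ (λ k → 1+q^ (d * k))) e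
  mod2-eulerPow = ≈-trans (mod2-infProd _) (≈-trans (∏∞-cong (λ k → ≈-trans (mod2-pow (oneMinus (d * suc k)) e) (pow₂-cong e (mod2-oneMinus (d * suc k) (≤-trans (s≤s z≤n) (m≤n*m (suc k) d))))))
    (∏∞-pow (1+q^-dil-unital d) e))

  mod2-invEulerPow : mod2 (invEulerPow d e) ≈ pow₂ (∏∞ (λ k → geom₂ (d * k))) e
  mod2-invEulerPow = ≈-trans (mod2-infProd _) (≈-trans (∏∞-cong (λ k → ≈-trans (mod2-pow (geom (d * suc k)) e) (pow₂-cong e (mod2-geom (d * suc k)))))
    (∏∞-pow (geom-dil-unital d) e))

dil-1-E : ∏∞ (λ k → 1+q^ (1 * k)) ≈ E
dil-1-E = ∏∞-cong (λ k → ⊕-cong ≈-refl (q^-≡ (*-identityˡ (suc k))))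

dil-1-P : ∏∞ (λ k → geom₂ (1 * k)) ≈ P
dil-1-P = ∏∞-cong (λ k → ≡⇒≈ (cong geom₂ (*-identityˡ (suc k))))

-- Over 𝔽₂ one has 1 + q^(2i) = (1 + q^i)², factor by factor. The cases d = 1 and d = 5 express the
-- products of level 2 and 10 through E and E₅.
∏∞-double : ∀ d .{{_ : NonZero d}} → ∏∞ (λ k → 1+q^ ((d + d) * k)) ≈ ∏∞ (λ k → 1+q^ (d * k)) · ∏∞ (λ k → 1+q^ (d * k))
∏∞-double d = ≈-trans (∏∞-cong (λ k → ≈-trans (⊕-cong ≈-refl (≈-trans (q^-≡ (*-distribʳ-+ (suc k) d d)) (≈-sym (q^-* (d * suc k) (d * suc k)))))
    (solve 1 (λ x → con true :+ x :* x := (con true :+ x) :* (con true :+ x)) ≈-refl (q^ (d * suc k)))))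
  (∏∞-· (1+q^-dil-unital d) (1+q^-dil-unital d))

dil-10-E : dil 10 E ≈ E₅ · E₅
dil-10-E = ≈-trans (≈-sym (∏∞-dil 10)) (≈-trans (∏∞-double 5) (·-cong (∏∞-dil 5) (∏∞-dil 5)))

dil-10-P : dil 10 P ≈ P₅ · P₅
dil-10-P = ·-cancel-inverse (dil-E·P 10) (≈-trans (dil-E·P 10) (≈-sym (≈-trans (·-cong dil-10-E ≈-refl)
  (≈-trans (solve 2 (λ e p → e :* e :* (p :* p) := e :* p :* (e :* p)) ≈-refl E₅ P₅) (≈-trans (·-cong E₅·P₅ E₅·P₅) (·-identityˡ 𝟙))))))

mod2-F5 : mod2 F5 ≈ G · G
mod2-F5 = ≈-trans (mod2-⊗ (eulerPow 1 6) (invEulerPow 5 6))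
  (≈-trans (·-cong (≈-trans (mod2-eulerPow 1 6) (pow₂-cong 6 dil-1-E)) (≈-trans (mod2-invEulerPow 5 6) (pow₂-cong 6 (∏∞-geom-dil 5))))
    (solve 2 (λ e p → (e :* (e :* (e :* (e :* (e :* (e :* con true)))))) :* (p :* (p :* (p :* (p :* (p :* (p :* con true))))))
       := (e :* (e :* e) :* (p :* (p :* p))) :* (e :* (e :* e) :* (p :* (p :* p)))) ≈-refl E P₅))

-- Modulo 2 the eta quotient is E² E₅⁵ P P₅¹⁰ = E P₅⁵ = (E E₅) P₅⁶. The key identity turns this into
-- (E⁶ + q E₅⁶) P₅⁶ = G² + q.
mod2-F10 : mod2 F10 ≈ G · G ⊕ q^ 1
mod2-F10 = begin
  mod2 F10 ≈⟨ ≈-trans (mod2-⊗ _ (invEulerPow 10 5)) (·-cong (≈-trans (mod2-⊗ _ (invEulerPow 1 1)) (·-cong (mod2-⊗ (eulerPow 2 1) (eulerPow 5 5)) ≈-refl)) ≈-refl) ⟩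
  mod2 (eulerPow 2 1) · mod2 (eulerPow 5 5) · mod2 (invEulerPow 1 1) · mod2 (invEulerPow 10 5)
    ≈⟨ ·-cong (·-cong (·-cong (≈-trans (mod2-eulerPow 2 1) (pow₂-cong 1 (≈-trans (∏∞-double 1) (·-cong dil-1-E dil-1-E))))
         (≈-trans (mod2-eulerPow 5 5) (pow₂-cong 5 (∏∞-dil 5)))) (≈-trans (mod2-invEulerPow 1 1) (pow₂-cong 1 dil-1-P)))
         (≈-trans (mod2-invEulerPow 10 5) (pow₂-cong 5 (≈-trans (∏∞-geom-dil 10) dil-10-P))) ⟩
  pow₂ (E · E) 1 · pow₂ E₅ 5 · pow₂ P 1 · pow₂ (P₅ · P₅) 5
    ≈⟨ solve 4 (λ e p f r → (e :* e :* con true) :* (f :* (f :* (f :* (f :* (f :* con true))))) :* (p :* con true) :* (r :* r :* (r :* r :* (r :* r :* (r :* r :* (r :* r :* con true)))))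
         := (e :* p) :* ((f :* r) :* (f :* r) :* (f :* r) :* (f :* r)) :* ((e :* f) :* (r :* r :* r :* r :* r :* r))) ≈-refl E P E₅ P₅ ⟩
  (E · P) · (E₅ · P₅ · (E₅ · P₅) · (E₅ · P₅) · (E₅ · P₅)) · ((E · E₅) · P₅⁶) ≈⟨ ·-cong (·-cong E·P (·-cong (·-cong (·-cong E₅·P₅ E₅·P₅) E₅·P₅) E₅·P₅)) (·-cong E·E₅-split ≈-refl) ⟩
  𝟙 · (𝟙 · 𝟙 · 𝟙 · 𝟙) · ((E³ · E³ ⊕ q^ 1 · (E₅³ · E₅³)) · P₅⁶)
    ≈⟨ solve 4 (λ e f r x → con true :* (con true :* con true :* con true :* con true) :* ((e :* (e :* e) :* (e :* (e :* e)) :+ x :* (f :* (f :* f) :* (f :* (f :* f)))) :* (r :* r :* r :* r :* r :* r))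
         := (e :* (e :* e) :* (r :* (r :* r))) :* (e :* (e :* e) :* (r :* (r :* r))) :+ x :* ((f :* r) :* (f :* r) :* (f :* r) :* (f :* r) :* (f :* r) :* (f :* r))) ≈-refl E E₅ P₅ (q^ 1) ⟩
  G · G ⊕ q^ 1 · (E₅ · P₅ · (E₅ · P₅) · (E₅ · P₅) · (E₅ · P₅) · (E₅ · P₅) · (E₅ · P₅))
    ≈⟨ ⊕-cong ≈-refl (·-cong ≈-refl (·-cong (·-cong (·-cong (·-cong (·-cong E₅·P₅ E₅·P₅) E₅·P₅) E₅·P₅) E₅·P₅) E₅·P₅)) ⟩
  G · G ⊕ q^ 1 · (𝟙 · 𝟙 · 𝟙 · 𝟙 · 𝟙 · 𝟙)
    ≈⟨ solve 2 (λ g x → g :+ x :* (con true :* con true :* con true :* con true :* con true :* con true) := g :+ x) ≈-refl (G · G) (q^ 1) ⟩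
  G · G ⊕ q^ 1 ∎
  where
  open ≈R
  P₅⁶ = P₅ · P₅ · P₅ · P₅ · P₅ · P₅

par-X10 : ∀ M → par (X10 M) ≡ coeff (P · θ (A₀ ⊎ʷ A₁)) M
par-X10 M = trans (par-sumTo M _) (trans (antidiag-cong M (λ n b _ → term n)) (rogers-A M))
  where
  term : ∀ n → par (sgn n ℤ.* shift (n * n) (invMinusPoch (2 * n)) M) ≡ coeff (q^ (n * n) · Pₙ (n + n)) M
  term n = trans (par-* (sgn n) _) (trans (cong (_∧ par (shift (n * n) (invMinusPoch (2 * n)) M)) (par-sgn n))
    (trans (mod2-shift (n * n) (invMinusPoch (2 * n)) M) (at (·-cong (≈-refl {q^ (n * n)}) (≈-trans (mod2-invMinusPoch (2 * n)) (≡⇒≈ (cong (λ k → Pₙ (n + k)) (+-identityʳ n))))) M)))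

par-chi10 : ∀ M → par (chi10 M) ≡ coeff (P · θ (B₀ ⊎ʷ B₁)) M
par-chi10 M = trans (par-sumTo M _) (trans (antidiag-cong M (λ n b _ → term n)) (trans reindex (rogers-B M)))
  where
  H : ℕ → Bool
  H n = coeff (q^ (n * n) · β-V n) M
  term : ∀ n → par (sgn n ℤ.* shift (suc n * suc n) (invMinusPoch (suc (2 * n))) M) ≡ H (suc n)
  term n = trans (par-* (sgn n) _) (trans (cong (_∧ par (shift (suc n * suc n) (invMinusPoch (suc (2 * n))) M)) (par-sgn n))
    (trans (mod2-shift (suc n * suc n) (invMinusPoch (suc (2 * n))) M) (at (·-cong (≈-refl {q^ (suc n * suc n)}) (≈-trans (mod2-invMinusPoch (suc (2 * n))) (≡⇒≈ (cong (λ k → Pₙ (suc (n + k))) (+-identityʳ n))))) M)))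
  -- The term n = 0 vanishes because β-V 0 = 0, the term n = M + 1 because (M + 1)² > M.
  reindex : antidiag M (λ n _ → H (suc n)) ≡ antidiag M (λ n _ → H n)
  reindex = trans (cong (_xor antidiag M (λ n _ → H (suc n))) (sym (at (·-zeroʳ (q^ 0)) M)))
    (trans (antidiag-last M (λ n _ → H n)) (trans (cong (antidiag M (λ n _ → H n) xor_) (q^·-at-< (suc M * suc M) (β-V (suc M)) (m≤n*m (suc M) (suc M)))) (xor-identityʳ _)))

-- Partitions without multiples of 10

∑-filterᵇ : ∀ {A : Set} (p : A → Bool) xs (f : A → Bool) → ∑ (filterᵇ p xs) f ≡ ∑ xs (λ x → p x ∧ f x)
∑-filterᵇ p [] f = refl
∑-filterᵇ p (x ∷ xs) f with p x
... | true = cong (f x xor_) (∑-filterᵇ p xs f)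
... | false = ∑-filterᵇ p xs f

odd-length-filterᵇ : ∀ {A : Set} (p : A → Bool) xs → odd (length (filterᵇ p xs)) ≡ ∑ xs p
odd-length-filterᵇ p [] = refl
odd-length-filterᵇ p (x ∷ xs) with p x
... | true = cong not (odd-length-filterᵇ p xs)
... | false = odd-length-filterᵇ p xs

∑-concatMap : ∀ {A B : Set} (g : A → List B) xs (f : B → Bool) → ∑ (concatMap g xs) f ≡ ∑ xs (λ x → ∑ (g x) f)
∑-concatMap g [] f = refl
∑-concatMap g (x ∷ xs) f = trans (∑-++ (g x) (concatMap g xs) f) (cong (∑ (g x) f xor_) (∑-concatMap g xs f))

module _ (ok : ℕ → Bool) where

  restrictedGeom : ℕ → Ser
  restrictedGeom i = if ok i then geom₂ i else 𝟙

  Rₙ : ℕ → Ser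
  Rₙ = ∏ restrictedGeom

  private
    geom-unfold : ∀ k → geom₂ (suc k) ≈ 𝟙 ⊕ q^ (suc k) · geom₂ (suc k)
    geom-unfold k = ≈-trans (solve 2 (λ x g → g := (con true :+ x) :* g :+ x :* g) ≈-refl (q^ (suc k)) (geom₂ (suc k))) (⊕-cong (1+q^-geom k) ≈-refl)

    Rₙ-suc : ∀ k → Rₙ (suc k) ≈ Rₙ k ⊕ constant (ok (suc k)) · (q^ (suc k) · Rₙ (suc k))
    Rₙ-suc k with ok (suc k)
    ... | true = ≈-trans (·-cong ≈-refl (geom-unfold k)) (solve 3 (λ r x g → r :* (con true :+ x :* g) := r :+ con true :* (x :* (r :* g))) ≈-refl (Rₙ k) (q^ (suc k)) (geom₂ (suc k)))
    ... | false = solve 2 (λ r x → r :* con true := r :+ con false :* (x :* (r :* con true))) ≈-refl (Rₙ k) (q^ (suc k))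

    -- Iterating `Rₙ-suc` sorts the partitions of n + 1 by their largest part i + 1, the remaining
    -- parts being at most i + 1. The monomial is q^i because one unit of the part is absorbed by
    -- `suc n`.
    Rₙ-at-suc : ∀ k n → coeff (Rₙ k) (suc n) ≡ ∑ (upTo k) (λ i → ok (suc i) ∧ coeff (q^ i · Rₙ (suc i)) n)
    Rₙ-at-suc zero n = refl
    Rₙ-at-suc (suc k) n = begin
      coeff (Rₙ (suc k)) (suc n) ≡⟨ at (Rₙ-suc k) (suc n) ⟩
      coeff (Rₙ k) (suc n) xor coeff (constant (ok (suc k)) · (q^ (suc k) · Rₙ (suc k))) (suc n) ≡⟨ cong₂ _xor_ (Rₙ-at-suc k n) (constant·-at (ok (suc k)) (q^ (suc k) · Rₙ (suc k)) (suc n)) ⟩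
      ∑ (upTo k) term xor term k ≡⟨ cong (∑ (upTo k) term xor_) (sym (xor-identityʳ (term k))) ⟩
      ∑ (upTo k) term xor ∑ [ k ] term ≡⟨ sym (∑-++ (upTo k) [ k ] term) ⟩
      ∑ (upTo k ∷ʳ k) term ≡⟨ cong (λ xs → ∑ xs term) (upTo-∷ʳ k) ⟩
      ∑ (upTo (suc k)) term ∎
      where
      open ≡-Reasoning
      term : ℕ → Bool
      term i = ok (suc i) ∧ coeff (q^ i · Rₙ (suc i)) n

    ≤ᵇ-true : ∀ {m n} → (m ≤ᵇ n) ≡ true → m ≤ n
    ≤ᵇ-true {m} {n} e = ≤ᵇ⇒≤ m n (subst T (sym e) tt)

    true-≤ᵇ : ∀ {m n} → m ≤ n → (m ≤ᵇ n) ≡ true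
    true-≤ᵇ {m} {n} p with m ≤ᵇ n | ≤⇒≤ᵇ p
    ... | true | _ = refl

  -- Removing the largest part is the recursion of `partsBounded`, and by `Rₙ-at-suc` also that of
  -- the generating product.
  parts-count : ∀ f n k → n ≤ f → ∑ (partsBounded f n k) (allᵇ ok) ≡ coeff (Rₙ k) n
  parts-count f zero k _ = sym (Rₙ-at-0 k)
    where
    Rₙ-at-0 : ∀ k → coeff (Rₙ k) 0 ≡ true
    Rₙ-at-0 zero = refl
    Rₙ-at-0 (suc k) with ok (suc k)
    ... | true = trans (cong₂ _∧_ (Rₙ-at-0 k) (at≤ (geom-unit 0 (suc k) (s≤s z≤n)) z≤n)) refl
    ... | false = cong (_∧ true) (Rₙ-at-0 k)
  parts-count (suc f) (suc n) k (s≤s n≤f) = begin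
    ∑ (concatMap block (filterᵇ (_≤ᵇ k) (map suc (upTo (suc n))))) (allᵇ ok) ≡⟨ ∑-concatMap block (filterᵇ (_≤ᵇ k) (map suc (upTo (suc n)))) (allᵇ ok) ⟩
    ∑ (filterᵇ (_≤ᵇ k) (map suc (upTo (suc n)))) (λ p → ∑ (block p) (allᵇ ok)) ≡⟨ ∑-filterᵇ (_≤ᵇ k) (map suc (upTo (suc n))) _ ⟩
    ∑ (map suc (upTo (suc n))) (λ p → (p ≤ᵇ k) ∧ ∑ (block p) (allᵇ ok)) ≡⟨ ∑-map suc (upTo (suc n)) (λ p → (p ≤ᵇ k) ∧ ∑ (block p) (allᵇ ok)) ⟩
    ∑ (upTo (suc n)) (λ i → (suc i ≤ᵇ k) ∧ ∑ (block (suc i)) (allᵇ ok)) ≡⟨ ∑-cong (upTo (suc n)) (λ {i} _ → cong ((suc i ≤ᵇ k) ∧_) (block-sum i)) ⟩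
    ∑ (upTo (suc n)) (λ i → (suc i ≤ᵇ k) ∧ (ok (suc i) ∧ coeff (Rₙ (suc i)) (n ∸ i)))
      -- The list side runs over i ≤ n and filters by i < k; the product side runs over i < k, and
      -- its terms with i > n vanish. The supports coincide.
      ≡⟨ ∑-bijection _≟_ _ _ id id (upTo⁺ (suc n)) (upTo⁺ k)
           (λ {i} i∈ e → let i<k , t = ∧-true {suc i ≤ᵇ k} e ; i≤n = ≤-pred (∈-upTo⁻ i∈) in ∈-upTo⁺ (≤ᵇ-true i<k) , trans (cong (ok (suc i) ∧_) (shifted i i≤n)) t , refl)
           (λ {i} i∈ e → let i≤n = below i (proj₂ (∧-true {ok (suc i)} e)) in
             ∈-upTo⁺ (s≤s i≤n) , cong₂ _∧_ (true-≤ᵇ (∈-upTo⁻ i∈)) (trans (cong (ok (suc i) ∧_) (sym (shifted i i≤n))) e) , refl) ⟩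
    ∑ (upTo k) (λ i → ok (suc i) ∧ coeff (q^ i · Rₙ (suc i)) n) ≡⟨ sym (Rₙ-at-suc k n) ⟩
    coeff (Rₙ k) (suc n) ∎
    where
    open ≡-Reasoning
    block : ℕ → List (List ℕ)
    block p = map (p ∷_) (partsBounded f (suc n ∸ p) p)
    block-sum : ∀ i → ∑ (block (suc i)) (allᵇ ok) ≡ ok (suc i) ∧ coeff (Rₙ (suc i)) (n ∸ i)
    block-sum i = trans (∑-map (suc i ∷_) (partsBounded f (n ∸ i) (suc i)) (allᵇ ok))
      (trans (∑-∧ˡ (partsBounded f (n ∸ i) (suc i)) (ok (suc i)) (allᵇ ok)) (cong (ok (suc i) ∧_) (parts-count f (n ∸ i) (suc i) (≤-trans (m∸n≤m n i) n≤f))))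
    shifted : ∀ i → i ≤ n → coeff (q^ i · Rₙ (suc i)) n ≡ coeff (Rₙ (suc i)) (n ∸ i)
    shifted i i≤n = trans (cong (coeff (q^ i · Rₙ (suc i))) (sym (m+[n∸m]≡n i≤n))) (q^·-at-+ i (Rₙ (suc i)) (n ∸ i))
    below : ∀ i → coeff (q^ i · Rₙ (suc i)) n ≡ true → i ≤ n
    below i e with n <? i
    ... | yes n<i = contradiction (trans (sym e) (q^·-at-< i (Rₙ (suc i)) n<i)) (λ ())
    ... | no n≮i = ≮⇒≥ n≮i

not-multiple : ℕ → Bool
not-multiple p = not (p % 10 ≡ᵇ 0)

-- These factors cancel 1/(1 - q^i) exactly for the multiples i of 10, so the restricted product is
-- P times the product of all 1 - q^(10k), which is E₅² modulo 2.
multipleFactor : ℕ → Ser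
multipleFactor i = if not-multiple i then 𝟙 else 1+q^ i

multipleFactor-unital : Unital multipleFactor
multipleFactor-unital N with not-multiple (suc N)
... | true = ≈[]-refl
... | false = 1+q^-unital N

∏∞-multipleFactor : ∏∞ multipleFactor ≈ dil 10 E
∏∞-multipleFactor = ≈-trans (≈[]⇒≈ (λ N → ≈[]-trans (∏∞-≈ multipleFactor-unital N) (≈[]-trans (≈[]-sym (∏-≤ multipleFactor-unital (m≤n*m N 10)))
    (≈[]-trans (≈⇒≈[] (finite N)) (≈[]-sym (∏∞-≈ (1+q^-dil-unital 10) N)))))) (∏∞-dil 10)
  where
  periodic : ∀ i N → not-multiple (i + 10 * N) ≡ not-multiple i
  periodic i N = cong (λ r → not (r ≡ᵇ 0)) (trans (cong (λ x → (i + x) % 10) (*-comm 10 N)) ([m+kn]%n≡m%n i N 10))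
  skip : ∀ i N → not-multiple i ≡ true → multipleFactor (i + 10 * N) ≈ 𝟙
  skip i N e = ≡⇒≈ (cong (λ b → if b then 𝟙 else 1+q^ (i + 10 * N)) (trans (periodic i N) e))
  absorb : ∀ i N {f} → not-multiple i ≡ true → f · multipleFactor (i + 10 * N) ≈ f
  absorb i N e = ≈-trans (·-cong ≈-refl (skip i N e)) (·-identityʳ _)
  finite : ∀ N → ∏ multipleFactor (10 * N) ≈ ∏ (λ k → 1+q^ (10 * k)) N
  finite zero = ≈-refl
  -- Ten consecutive factors are added at once: nine are 1, and the tenth is 1 + q^(10(N+1)).
  finite (suc N) = ≈-trans (≡⇒≈ (cong (∏ multipleFactor) (*-suc 10 N)))
    (·-cong (≈-trans (absorb 9 N refl) (≈-trans (absorb 8 N refl) (≈-trans (absorb 7 N refl) (≈-trans (absorb 6 N refl) (≈-trans (absorb 5 N refl)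
        (≈-trans (absorb 4 N refl) (≈-trans (absorb 3 N refl) (≈-trans (absorb 2 N refl) (≈-trans (absorb 1 N refl) (finite N))))))))))
      (≈-trans (≡⇒≈ (cong (λ b → if b then 𝟙 else 1+q^ (10 + 10 * N)) (periodic 10 N))) (≡⇒≈ (cong 1+q^ (sym (*-suc 10 N))))))

par-p10 : ∀ n → par (+ p10 n) ≡ coeff (E₅ · E₅ · P) n
par-p10 n = begin
  odd (p10 n) ≡⟨ odd-length-filterᵇ (allᵇ not-multiple) (partitions n) ⟩
  ∑ (partitions n) (allᵇ not-multiple) ≡⟨ parts-count not-multiple n n n ≤-refl ⟩
  coeff (∏∞ (restrictedGeom not-multiple)) n ≡⟨ at (∏∞-cong (λ k → factor (not-multiple (suc k)) k)) n ⟩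
  coeff (∏∞ (λ i → geom₂ i · multipleFactor i)) n ≡⟨ at (∏∞-· geom-unital multipleFactor-unital) n ⟩
  coeff (P · ∏∞ multipleFactor) n ≡⟨ at (≈-trans (·-cong ≈-refl (≈-trans ∏∞-multipleFactor dil-10-E)) (·-comm P (E₅ · E₅))) n ⟩
  coeff (E₅ · E₅ · P) n ∎
  where
  open ≡-Reasoning
  factor : ∀ b k → (if b then geom₂ (suc k) else 𝟙) ≈ geom₂ (suc k) · (if b then 𝟙 else 1+q^ (suc k))
  factor true k = ≈-sym (·-identityʳ _)
  factor false k = ≈-sym (≈-trans (·-comm _ _) (1+q^-geom k))

-- The congruences

par-c5-even : ∀ n → par (c5 (2 * n)) ≡ false
par-c5-even n = trans (at mod2-F5 (suc (2 * n))) (square-odd G n)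

par-c5-odd : ∀ m k → suc m ≡ 2 * k → par (c5 m) ≡ coeff G k
par-c5-odd m k e = trans (at mod2-F5 (suc m)) (trans (cong (coeff (G · G)) e) (square-even G k))

-- The shift by one in `c5` makes m + 1 = 8k the relevant exponent. It is halved three times: once
-- for G² and twice for the part C⁴ of G. The other lemmas of this kind follow the remaining
-- branches of the dissection.
par-c5-C : ∀ m k → suc m ≡ 2 * (2 * (2 * k)) → par (c5 m) ≡ coeff C k
par-c5-C m k e = trans (par-c5-odd m (2 * (2 * k)) e) (trans (dissect-even G-split (2 * k)) (square-even C k))

par-c5-E³ : ∀ m k → suc m ≡ 2 * suc (2 * (2 * k)) → par (c5 m) ≡ coeff E³ k
par-c5-E³ m k e = trans (par-c5-odd m (suc (2 * (2 * k))) e) (trans (dissect-odd G-split (2 * k)) (dissect-even E·E₅-split k))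

par-c5-E₅³ : ∀ m k → suc m ≡ 2 * suc (2 * suc (2 * k)) → par (c5 m) ≡ coeff E₅³ k
par-c5-E₅³ m k e = trans (par-c5-odd m (suc (2 * suc (2 * k))) e) (trans (dissect-odd G-split (suc (2 * k))) (dissect-odd E·E₅-split k))

c5≡c10 : ∀ n → n ≥ 1 → c5 n ≡₂ c10 n
c5≡c10 (suc n) _ = par⇒≡₂ (c5 (suc n)) (c10 (suc n)) (trans (at mod2-F5 (suc (suc n))) (sym (trans (at mod2-F10 (suc (suc n))) (xor-identityʳ _))))

-- Here (m + 1)/2 is 2 modulo 4, an index belonging to the odd exponents of C², and a square has
-- none.
c5-8n+3 : ∀ n → c5 (8 * n + 3) ≡₂ + 0
c5-8n+3 n = par⇒≡₂ (c5 (8 * n + 3)) (+ 0) (trans (par-c5-odd (8 * n + 3) (2 * suc (2 * n)) (index n)) (trans (dissect-even G-split (suc (2 * n))) (square-odd C n)))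
  where
  index : ∀ n → suc (8 * n + 3) ≡ 2 * (2 * suc (2 * n))
  index = solve-∀

-- Since m + 1 = 8(5n + i) + 6, the index in E₅³ is 5n + i; it is not a multiple of 5, while E₅³ is
-- a series in q⁵.
c5-40n+5+8i : ∀ n i → 1 ≤ i × i ≤ 4 → c5 (40 * n + 5 + 8 * i) ≡₂ + 0
c5-40n+5+8i n (suc i) (_ , i≤4) = par⇒≡₂ (c5 (40 * n + 5 + 8 * suc i)) (+ 0) (trans (par-c5-E₅³ (40 * n + 5 + 8 * suc i) (5 * n + suc i) (index n i)) (trans (sym (at dil-E³ (5 * n + suc i))) (dil-none 5 E³ n i (s≤s i≤4))))
  where
  index : ∀ n i → suc (40 * n + 5 + 8 * suc i) ≡ 2 * suc (2 * suc (2 * (5 * n + suc i)))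
  index = solve-∀

C-vanish : ∀ n c → c < 4 → c ≢ 0 → c ≢ 2 → coeff C (5 * n + c) ≡ false
C-vanish n c c<4 c≢0 c≢2 = trans (C-section c n (≤-trans c<4 (n≤1+n 4)))
  (at (≈-trans (·-cong (pointwise {section 5 c (θ 2×pentagonal)} {𝟘} (λ k → 2×pentagonal-none k c c<4 c≢0 c≢2)) (≈-refl {P})) (·-zeroˡ P)) n)

c5-40n+7+8j : ∀ n j → (j ≡ 0 ⊎ j ≡ 2) → c5 (40 * n + 7 + 8 * j) ≡₂ + 0
c5-40n+7+8j n _ (inj₁ refl) = par⇒≡₂ (c5 (40 * n + 7 + 8 * 0)) (+ 0) (trans (par-c5-C (40 * n + 7 + 8 * 0) (5 * n + 1) (index n)) (C-vanish n 1 (s≤s (s≤s z≤n)) (λ ()) (λ ())))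
  where
  index : ∀ n → suc (40 * n + 7 + 8 * 0) ≡ 2 * (2 * (2 * (5 * n + 1)))
  index = solve-∀
c5-40n+7+8j n _ (inj₂ refl) = par⇒≡₂ (c5 (40 * n + 7 + 8 * 2)) (+ 0) (trans (par-c5-C (40 * n + 7 + 8 * 2) (5 * n + 3) (index n)) (C-vanish n 3 (s≤s (s≤s (s≤s (s≤s z≤n)))) (λ ()) (λ ())))
  where
  index : ∀ n → suc (40 * n + 7 + 8 * 2) ≡ 2 * (2 * (2 * (5 * n + 3)))
  index = solve-∀

c5-X10 : ∀ n → n ≥ 1 → c5 (40 * n ∸ 1) ≡₂ X10 n
c5-X10 (suc n) _ = par⇒≡₂ (c5 (40 * suc n ∸ 1)) (X10 (suc n)) (begin
  par (c5 (40 * suc n ∸ 1)) ≡⟨ par-c5-C (40 * suc n ∸ 1) (5 * suc n + 0) (index n) ⟩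
  coeff C (5 * suc n + 0) ≡⟨ C-section 0 (suc n) (s≤s z≤n) ⟩
  coeff (section 5 0 (θ 2×pentagonal) · P) (suc n) ≡⟨ at (·-cong (pointwise {section 5 0 (θ 2×pentagonal)} {θ (A₀ ⊎ʷ A₁)} 2×pentagonal-0) (≈-refl {P})) (suc n) ⟩
  coeff (θ (A₀ ⊎ʷ A₁) · P) (suc n) ≡⟨ at (·-comm (θ (A₀ ⊎ʷ A₁)) P) (suc n) ⟩
  coeff (P · θ (A₀ ⊎ʷ A₁)) (suc n) ≡⟨ sym (par-X10 (suc n)) ⟩
  par (X10 (suc n)) ∎)
  where
  open ≡-Reasoning
  index : ∀ n → suc (40 * suc n ∸ 1) ≡ 2 * (2 * (2 * (5 * suc n + 0)))
  index n = trans (cong (λ x → suc (x ∸ 1)) (*-suc 40 n)) (identity n)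
    where
    identity : ∀ n → suc (39 + 40 * n) ≡ 2 * (2 * (2 * (5 * suc n + 0)))
    identity = solve-∀

c5-chi10 : ∀ n → n ≥ 1 → c5 (40 * n ∸ 9) ≡₂ chi10 n
c5-chi10 (suc n) _ = par⇒≡₂ (c5 (40 * suc n ∸ 9)) (chi10 (suc n)) (begin
  par (c5 (40 * suc n ∸ 9)) ≡⟨ par-c5-C (40 * suc n ∸ 9) (5 * n + 4) (index n) ⟩
  coeff C (5 * n + 4) ≡⟨ C-section 4 n (s≤s (s≤s (s≤s (s≤s (s≤s z≤n))))) ⟩
  coeff (section 5 4 (θ 2×pentagonal) · P) n ≡⟨ at (·-cong (pointwise {section 5 4 (θ 2×pentagonal)} {tail (θ B)} 2×pentagonal-4) (≈-refl {P})) n ⟩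
  -- The constant term of `θ B` is 0, so passing from the tail to the whole series merely raises the
  -- index by one.
  coeff (tail (θ B) · P) n ≡⟨ cong (λ b → (b ∧ coeff P (suc n)) xor coeff (tail (θ B) · P) n) (sym (θ-none B 0 positive)) ⟩
  coeff (θ B · P) (suc n) ≡⟨ at (·-comm (θ B) P) (suc n) ⟩
  coeff (P · θ B) (suc n) ≡⟨ sym (par-chi10 (suc n)) ⟩
  par (chi10 (suc n)) ∎)
  where
  open ≡-Reasoning
  B : Weighted (ℤ ⊎ ℤ)
  B = B₀ ⊎ʷ B₁
  positive : ∀ y → wt B y ≢ 0
  positive (inj₁ k) e = contradiction (trans (2pent-1 k) (cong (5 *_) e)) (λ ())
  positive (inj₂ k) e = contradiction (trans (2pent-2 k) (cong (5 *_) e)) (λ ())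
  index : ∀ n → suc (40 * suc n ∸ 9) ≡ 2 * (2 * (2 * (5 * n + 4)))
  index n = trans (cong (λ x → suc (x ∸ 9)) (*-suc 40 n)) (identity n)
    where
    identity : ∀ n → suc (31 + 40 * n) ≡ 2 * (2 * (2 * (5 * n + 4)))
    identity = solve-∀

par-c5-8n+1 : ∀ n → par (c5 (8 * n + 1)) ≡ coeff E³ n
par-c5-8n+1 n = par-c5-E³ (8 * n + 1) n (index n)
  where
  index : ∀ n → suc (8 * n + 1) ≡ 2 * suc (2 * (2 * n))
  index = solve-∀

c5-40n+5 : ∀ n → c5 (8 * n + 1) ≡₂ c5 (40 * n + 5)
c5-40n+5 n = par⇒≡₂ (c5 (8 * n + 1)) (c5 (40 * n + 5)) (trans (par-c5-8n+1 n) (sym (trans (par-c5-E₅³ (40 * n + 5) (5 * n + 0) (index n)) (trans (sym (at dil-E³ (5 * n + 0))) (dil-at 5 E³ n)))))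
  where
  index : ∀ n → suc (40 * n + 5) ≡ 2 * suc (2 * suc (2 * (5 * n + 0)))
  index = solve-∀

-- The component of residue 2 in E² is Σ q^(10 pent k) = E₅², so C contributes E₅² P, which modulo 2
-- is the quotient of the products of 1 - q^(10k) and 1 - q^k.
c5-40n+15 : ∀ n → c5 (40 * n + 15) ≡₂ + p10 n
c5-40n+15 n = par⇒≡₂ (c5 (40 * n + 15)) (+ p10 n) (begin
  par (c5 (40 * n + 15)) ≡⟨ par-c5-C (40 * n + 15) (5 * n + 2) (index n) ⟩
  coeff C (5 * n + 2) ≡⟨ C-section 2 n (s≤s (s≤s (s≤s z≤n))) ⟩
  coeff (section 5 2 (θ 2×pentagonal) · P) n ≡⟨ at (·-cong (≈-trans (pointwise {section 5 2 (θ 2×pentagonal)} {θ (affine 10 0 pentagonal)} 2×pentagonal-2) (≈-trans (θ-10 pentagonal) (·-cong to-E₅ to-E₅))) (≈-refl {P})) n ⟩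
  coeff (E₅ · E₅ · P) n ≡⟨ sym (par-p10 n) ⟩
  par (+ p10 n) ∎)
  where
  open ≡-Reasoning
  to-E₅ : dil 5 (θ pentagonal) ≈ E₅
  to-E₅ = dil-cong 5 (≈-sym pentagonal-theorem)
  index : ∀ n → suc (40 * n + 15) ≡ 2 * (2 * (2 * (5 * n + 2)))
  index = solve-∀

-- Exponents of the cube of Euler's product

square-injective : ∀ a b → a * a ≡ b * b → a ≡ b
square-injective a b e with <-cmp a b
... | tri< a<b _ _ = contradiction e (<⇒≢ (*-mono-< a<b a<b))
... | tri≈ _ a≡b _ = a≡b
... | tri> _ _ b<a = contradiction (sym e) (<⇒≢ (*-mono-< b<a b<a))

∣x∣≡∣y∣⇒x≡±y : ∀ x y → ∣ x ∣ ≡ ∣ y ∣ → x ≡ y ⊎ x ≡ ℤ.- y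
∣x∣≡∣y∣⇒x≡±y (+ m) (+ .m) refl = inj₁ refl
∣x∣≡∣y∣⇒x≡±y (+ _) -[1+ n ] refl = inj₂ refl
∣x∣≡∣y∣⇒x≡±y -[1+ m ] (+ _) refl = inj₂ refl
∣x∣≡∣y∣⇒x≡±y -[1+ m ] -[1+ .m ] refl = inj₁ refl

-- 8 t(2t+1) + 1 = (4t+1)², and 4t+1 is determined by its absolute value.
tri-injective : ∀ s t → tri s ≡ tri t → s ≡ t
tri-injective s t e = signs (∣x∣≡∣y∣⇒x≡±y 4[ s ]+1 4[ t ]+1 (square-injective ∣ 4[ s ]+1 ∣ ∣ 4[ t ]+1 ∣ (ℤₚ.+-injective (trans (square s) (trans (cong (λ z → + 8 ℤ.* + z ℤ.+ + 1) e) (sym (square t)))))))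
  where
  4[_]+1 : ℤ → ℤ
  4[ x ]+1 = + 4 ℤ.* x ℤ.+ + 1
  square : ∀ x → + sq 4[ x ]+1 ≡ + 8 ℤ.* + tri x ℤ.+ + 1
  square x = trans (sq-ℤ 4[ x ]+1) (trans (identity x) (cong (λ z → + 8 ℤ.* z ℤ.+ + 1) (sym (tri-ℤ x))))
    where
    identity : ∀ x → (+ 4 ℤ.* x ℤ.+ + 1) ℤ.* (+ 4 ℤ.* x ℤ.+ + 1) ≡ + 8 ℤ.* (x ℤ.* (+ 2 ℤ.* x ℤ.+ + 1)) ℤ.+ + 1
    identity = ℤ-solve-∀
  signs : 4[ s ]+1 ≡ 4[ t ]+1 ⊎ 4[ s ]+1 ≡ ℤ.- 4[ t ]+1 → s ≡ t
  signs (inj₁ p) = proj₁ (quotient-unique 4 s t (s≤s (s≤s z≤n)) (s≤s (s≤s z≤n)) p)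
  signs (inj₂ p) = contradiction (proj₂ (quotient-unique 4 s (reflect t) (s≤s (s≤s z≤n)) (s≤s (s≤s (s≤s (s≤s z≤n)))) (trans p (identity t)))) (λ ())
    where
    identity : ∀ t → ℤ.- (+ 4 ℤ.* t ℤ.+ + 1) ≡ + 4 ℤ.* (ℤ.- t ℤ.- + 1) ℤ.+ + 3
    identity = ℤ-solve-∀

-- Even indices k = 2n come from t = n, odd indices k = 2n + 1 from t = -(n + 1).
triangle-index : ∀ t → ∃ λ k → tri t ≡ (k * (k + 1)) / 2
triangle-index (+ n) = 2 * n , sym (trans (cong (_/ 2) (identity n)) (m*n/n≡m (n * (2 * n + 1)) 2))
  where
  identity : ∀ n → 2 * n * (2 * n + 1) ≡ n * (2 * n + 1) * 2
  identity = solve-∀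
triangle-index -[1+ n ] = 2 * n + 1 , sym (trans (cong (_/ 2) (identity n)) (m*n/n≡m (suc n * (2 * n + 1)) 2))
  where
  identity : ∀ n → (2 * n + 1) * (2 * n + 1 + 1) ≡ suc n * (2 * n + 1) * 2
  identity = solve-∀

triangle-root : ∀ k → ∃ λ t → tri t ≡ (k * (k + 1)) / 2
triangle-root k with even-or-odd k
... | inj₁ (m , refl) = + m , proj₂ (triangle-index (+ m))
... | inj₂ (m , refl) = -[1+ m ] , trans (proj₂ (triangle-index -[1+ m ])) (cong (λ k → k * (k + 1) / 2) (+-comm (2 * m) 1))

∑-true : ∀ {A : Set} xs (f : A → Bool) → ∑ xs f ≡ true → ∃ λ x → f x ≡ true
∑-true (x ∷ xs) f e with f x in fx
... | true = x , fx
... | false = ∑-true xs f e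

-- Injectivity of `tri` is essential for the backward direction: a triangular exponent occurs for
-- exactly one t, so its coefficient is 1 and cannot cancel modulo 2.
c5-8n+1-odd : ∀ n → (c5 (8 * n + 1) ≡₂ + 1) ⇔ ∃ (λ k → n ≡ (k * (k + 1)) / 2)
c5-8n+1-odd n = mk⇔ to from
  where
  par-eq : par (c5 (8 * n + 1)) ≡ coeff (θ triangular) n
  par-eq = trans (par-c5-8n+1 n) (at E³≈triangular n)
  to : c5 (8 * n + 1) ≡₂ + 1 → ∃ (λ k → n ≡ (k * (k + 1)) / 2)
  to d = let t , e = ∑-true (support triangular n) _ (trans (sym par-eq) (≡₂⇒par (c5 (8 * n + 1)) (+ 1) d)) ; k , e′ = triangle-index t in k , trans (sym (≡ᵇ-true e)) e′
  from : ∃ (λ k → n ≡ (k * (k + 1)) / 2) → c5 (8 * n + 1) ≡₂ + 1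
  from (k , e) = let t , e′ = triangle-root k in
    par⇒≡₂ (c5 (8 * n + 1)) (+ 1) (trans par-eq (θ-one triangular n t (trans e′ (sym e)) (λ s e″ → tri-injective s t (trans e″ (trans e (sym e′))))))

theorem1p3 : (∀ (n : ℕ) → n ≥ 1 → c5 n ≡₂ c10 n)
    × ((∀ (n : ℕ) → n ≥ 1 → c5 (2 * n) ≡₂ + 0)
    × (∀ (n : ℕ) → c5 (8 * n + 3) ≡₂ + 0)
    × (∀ (n i : ℕ) → 1 ≤ i × i ≤ 4 → c5 (40 * n + 5 + 8 * i) ≡₂ + 0)
    × (∀ (n j : ℕ) → (j ≡ 0 ⊎ j ≡ 2) → c5 (40 * n + 7 + 8 * j) ≡₂ + 0))
    × (∀ (n : ℕ) → n ≥ 1 → c5 (40 * n ∸ 1) ≡₂ X10 n)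
    × (∀ (n : ℕ) → n ≥ 1 → c5 (40 * n ∸ 9) ≡₂ chi10 n)
    × (∀ (n : ℕ) → (c5 (8 * n + 1) ≡₂ c5 (40 * n + 5))
    × ((c5 (8 * n + 1) ≡₂ + 1) ⇔ ∃ (λ (k : ℕ) → n ≡ (k * (k + 1)) / 2)))
    × (∀ (n : ℕ) → c5 (40 * n + 15) ≡₂ + (p10 n))
theorem1p3 =
  c5≡c10 ,
  ((λ n _ → par⇒≡₂ (c5 (2 * n)) (+ 0) (par-c5-even n)) , c5-8n+3 , c5-40n+5+8i , c5-40n+7+8j) ,
  c5-X10 ,
  c5-chi10 ,
  (λ n → c5-40n+5 n , c5-8n+1-odd n) ,
  c5-40n+15
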